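{- Let $\Phi=B_n$ or $\Phi=D_n$, and fix any $\mathbf s\in{\rm Score}(\Phi)$. Then lazy simple random walk on the Coxeter interchange graph ${\rm IntGr}(\Phi,\mathbf s)$ is rapidly mixing, with mixing time $t_{\rm mix}=O(d\log n)$, where $d$ is the degree of ${\rm IntGr}(\Phi,\mathbf s)$ and the implied constant does not depend on $n$ or $\mathbf s$.
   Context: Vectors: $\mathbf e^{\pm}_{ij}=\mathbf e_i\pm\mathbf e_j$ ($i>j$), $\mathbf e^h_i=\mathbf e_i$ for negative edges $e^-_{ij}$, positive edges $e^+_{ij}$, half edges $e^h_i$. $\mathcal K_{D_n}$ is the signed graph on $[n]$ with all negative and positive edges (one of each per pair); $\mathcal K_{B_n}$ additionally has all half edges. A Coxeter tournament on $\mathcal K_\Phi$ is $(w_e)$, $w_e\in\{0,1\}$, over its edges (games); score $\sum_e(w_e-\frac12)\mathbf e$; a sub-tournament is neutral if this sum over its games is $\mathbf 0$; $\mathcal T*\mathcal X$ flips outcomes of the games of $\mathcal X$. ${\rm Score}(\Phi)$ = set of score sequences of tournaments on $\mathcal K_\Phi$. A copy of a type-$\Phi$ generator is a neutral sub-tournament whose games are: three negative edges pairwise joining three distinct vertices, or one negative and two positive edges pairwise joining three distinct vertices; or (only for $B_n$) a negative or positive edge between $i\ne j$ plus $e^h_i,e^h_j$. ${\rm IntGr}(\Phi,\mathbf s)$ is the graph on tournaments on $\mathcal K_\Phi$ with score $\mathbf s$, with $\mathcal T_1,\mathcal T_2$ adjacent iff $\mathcal T_2=\mathcal T_1*\mathcal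 G$ for a generator copy $\mathcal G\subseteq\mathcal T_1$. It is known to be regular; $d$ is its common degree. Lazy simple random walk: at each step stay put with probability $1/2$, otherwise move to a uniformly random neighbour. Mixing time $t_{\rm mix}=\min\{t:\max_x\frac12\sum_y|P^t(x,y)-\pi(y)|\le1/4\}$, $\pi$ the stationary distribution. -}

module Defs where

open import Data.Bool using (Bool; true; false; _∧_; _∨_; not; if_then_else_)
import Data.Bool.Properties as BoolP
open import Data.Nat as ℕ using (ℕ; zero; suc)
open import Data.Fin using (Fin; toℕ)
open import Data.Integer using (+_)
open import Data.Rational as ℚ using (ℚ; 0ℚ; 1ℚ; ½; _+_; _-_; _*_; ∣_∣; _≤_)
import Data.Rational.Properties as ℚP
open import Data.List as L using (List; []; _∷_; allFin; filter; concatMap; map; foldr; length)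
open import Data.Bool.ListAction using (any; all)
open import Data.Vec as V using (Vec; tabulate; fromList; lookup; updateAt)
import Data.Vec.Properties as VP
open import Data.Product using (_×_; _,_; Σ; ∃-syntax)
open import Relation.Nullary.Decidable using (⌊_⌋)
open import Relation.Binary.PropositionalEquality using (_≡_)

data Typ : Set where
  B D : Typ

-- Edges of the signed graph on [n] = Fin n.
-- neg i j : negative edge e⁻_{ij}, vector e_i - e_j   (j < i)
-- pos i j : positive edge e⁺_{ij}, vector e_i + e_j   (j < i)
-- half i  : half edge e^h_i,       vector e_i
data Edge (n : ℕ) : Set where
  neg pos : Fin n → Fin n → Edge n
  half    : Fin n → Edge n

pairs : (n : ℕ) → List (Fin n × Fin n)
pairs n = concatMap (λ i → map (λ j → (i , j))
            (filter (λ j → toℕ j ℕ.<? toℕ i) (allFin n))) (allFin n)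

edgesD : (n : ℕ) → List (Edge n)
edgesD n = concatMap (λ { (i , j) → neg i j ∷ pos i j ∷ [] }) (pairs n)

edges : Typ → (n : ℕ) → List (Edge n)
edges D n = edgesD n
edges B n = edgesD n L.++ map half (allFin n)

games : Typ → ℕ → ℕ
games Φ n = length (edges Φ n)

edgeAt : (Φ : Typ) (n : ℕ) → Fin (games Φ n) → Edge n
edgeAt Φ n = lookup (fromList (edges Φ n))

-- Coxeter tournament on K_Φ: an outcome w_e ∈ {0,1} (false/true) per game
Tournament : Typ → ℕ → Set
Tournament Φ n = Vec Bool (games Φ n)

allVecs : (m : ℕ) → List (Vec Bool m)
allVecs zero = V.[] ∷ []
allVecs (suc m) = concatMap (λ v → (false V.∷ v) ∷ (true V.∷ v) ∷ []) (allVecs m)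

Vecℚ : ℕ → Set
Vecℚ n = Vec ℚ n

unit : {n : ℕ} → Fin n → Vecℚ n
unit i = tabulate (λ k → if ⌊ toℕ k ℕ.≟ toℕ i ⌋ then 1ℚ else 0ℚ)

_⊕_ : {n : ℕ} → Vecℚ n → Vecℚ n → Vecℚ n
u ⊕ v = V.zipWith _+_ u v

_⊖_ : {n : ℕ} → Vecℚ n → Vecℚ n → Vecℚ n
u ⊖ v = V.zipWith _-_ u v

_·_ : {n : ℕ} → ℚ → Vecℚ n → Vecℚ n
c · v = V.map (c *_) v

zeroV : {n : ℕ} → Vecℚ n
zeroV = V.replicate _ 0ℚ

vecOf : {n : ℕ} → Edge n → Vecℚ n
vecOf (neg i j) = unit i ⊖ unit j
vecOf (pos i j) = unit i ⊕ unit j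
vecOf (half i)  = unit i

-- w_e - 1/2
outcome : Bool → ℚ
outcome true  = ½
outcome false = ℚ.- ½

contrib : (Φ : Typ) (n : ℕ) → Tournament Φ n → Fin (games Φ n) → Vecℚ n
contrib Φ n T k = outcome (lookup T k) · vecOf (edgeAt Φ n k)

score : (Φ : Typ) (n : ℕ) → Tournament Φ n → Vecℚ n
score Φ n T = foldr _⊕_ zeroV (map (contrib Φ n T) (allFin (games Φ n)))

_=ℚv_ : {n : ℕ} → Vecℚ n → Vecℚ n → Bool
u =ℚv v = ⌊ VP.≡-dec ℚP._≟_ u v ⌋

_=T_ : {m : ℕ} → Vec Bool m → Vec Bool m → Bool
u =T v = ⌊ VP.≡-dec BoolP._≟_ u v ⌋

-- Generator copies.  A set of three games is given by positions a < b < c.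
Triple : ℕ → Set
Triple m = Fin m × Fin m × Fin m

triples : (m : ℕ) → List (Triple m)
triples m = concatMap (λ a → concatMap (λ b → map (λ c → (a , b , c))
              (filter (λ c → toℕ b ℕ.<? toℕ c) (allFin m)))
              (filter (λ b → toℕ a ℕ.<? toℕ b) (allFin m))) (allFin m)

_=F_ : {n : ℕ} → Fin n → Fin n → Bool
i =F j = ⌊ toℕ i ℕ.≟ toℕ j ⌋

_<F_ : {n : ℕ} → Fin n → Fin n → Bool
i <F j = ⌊ toℕ i ℕ.<? toℕ j ⌋

isNeg isPos : {n : ℕ} → Edge n → Bool
isNeg (neg _ _) = true
isNeg _ = false
isPos (pos _ _) = true
isPos _ = false

ends : {n : ℕ} → Edge n → Fin n × Fin n
ends (neg i j) = i , j
ends (pos i j) = i , j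
ends (half i)  = i , i

samePair : {n : ℕ} → Fin n × Fin n → Fin n × Fin n → Bool
samePair (i , j) (k , l) = (i =F k) ∧ (j =F l)

-- the three edges (all neg/pos) pairwise join three distinct vertices,
-- i.e. their endpoint pairs are exactly the three pairs of some c < b < a
triangle : {n : ℕ} → Edge n → Edge n → Edge n → Bool
triangle {n} e₁ e₂ e₃ =
  not (samePair p₁ p₂) ∧ not (samePair p₁ p₃) ∧ not (samePair p₂ p₃) ∧
  any (λ a → any (λ b → any (λ c →
      (b <F a) ∧ (c <F b) ∧ inT a b c p₁ ∧ inT a b c p₂ ∧ inT a b c p₃)
      (allFin n)) (allFin n)) (allFin n)
  where
  p₁ = ends e₁
  p₂ = ends e₂
  p₃ = ends e₃
  inT : Fin n → Fin n → Fin n → Fin n × Fin n → Bool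
  inT a b c p = samePair p (a , b) ∨ samePair p (a , c) ∨ samePair p (b , c)

negOrPos : {n : ℕ} → Edge n → Bool
negOrPos e = isNeg e ∨ isPos e

-- shape (i): three negative edges pairwise joining three distinct vertices
-- shape (ii): one negative and two positive edges pairwise joining three distinct vertices
-- shape (iii): a neg/pos edge between i ≠ j plus half edges e^h_i, e^h_j
--              (only possible when half edges exist, i.e. for B_n)
halfShape : {n : ℕ} → Edge n → Edge n → Edge n → Bool
halfShape e (half i) (half j) =
  negOrPos e ∧ not (i =F j) ∧
  (samePair (ends e) (i , j) ∨ samePair (ends e) (j , i))
halfShape _ _ _ = false

count : {A : Set} → (A → Bool) → List A → ℕ
count p xs = length (filter (λ x → Data.Bool.T? (p x)) xs)
  where import Data.Bool

shapeOK : {n : ℕ} → Edge n → Edge n → Edge n → Bool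
shapeOK e₁ e₂ e₃ =
  (all negOrPos (e₁ ∷ e₂ ∷ e₃ ∷ []) ∧ triangle e₁ e₂ e₃ ∧
    ((count isNeg (e₁ ∷ e₂ ∷ e₃ ∷ []) ℕ.≡ᵇ 3) ∨
     ((count isNeg (e₁ ∷ e₂ ∷ e₃ ∷ []) ℕ.≡ᵇ 1) ∧ (count isPos (e₁ ∷ e₂ ∷ e₃ ∷ []) ℕ.≡ᵇ 2))))
  ∨ halfShape e₁ e₂ e₃ ∨ halfShape e₂ e₁ e₃ ∨ halfShape e₃ e₁ e₂

neutral : (Φ : Typ) (n : ℕ) → Tournament Φ n → Triple (games Φ n) → Bool
neutral Φ n T (a , b , c) =
  (contrib Φ n T a ⊕ (contrib Φ n T b ⊕ contrib Φ n T c)) =ℚv zeroV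

isGenCopy : (Φ : Typ) (n : ℕ) → Tournament Φ n → Triple (games Φ n) → Bool
isGenCopy Φ n T (a , b , c) =
  shapeOK (edgeAt Φ n a) (edgeAt Φ n b) (edgeAt Φ n c) ∧ neutral Φ n T (a , b , c)

flipG : {m : ℕ} → Vec Bool m → Triple m → Vec Bool m
flipG T (a , b , c) = updateAt (updateAt (updateAt T a not) b not) c not

vertices : (Φ : Typ) (n : ℕ) → Vecℚ n → List (Tournament Φ n)
vertices Φ n s = filter (λ T → Data.Bool.T? (score Φ n T =ℚv s)) (allVecs (games Φ n))
  where import Data.Bool

adj : (Φ : Typ) (n : ℕ) → Tournament Φ n → Tournament Φ n → Bool
adj Φ n T₁ T₂ = any (λ G → isGenCopy Φ n T₁ G ∧ (T₂ =T flipG T₁ G)) (triples (games Φ n))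

degree : (Φ : Typ) (n : ℕ) → Vecℚ n → Tournament Φ n → ℕ
degree Φ n s T = count (adj Φ n T) (vertices Φ n s)

inv : ℕ → ℚ
inv zero = 0ℚ
inv (suc k) = + 1 ℚ./ suc k

P : (Φ : Typ) (n : ℕ) → Vecℚ n → Tournament Φ n → Tournament Φ n → ℚ
P Φ n s x y =
  (if x =T y then ½ else 0ℚ) +
  (if adj Φ n x y then ½ * inv (degree Φ n s x) else 0ℚ)

sumOver : {A : Set} → List A → (A → ℚ) → ℚ
sumOver xs f = foldr _+_ 0ℚ (map f xs)

Pt : (Φ : Typ) (n : ℕ) → Vecℚ n → ℕ → Tournament Φ n → Tournament Φ n → ℚ
Pt Φ n s zero x y = if x =T y then 1ℚ else 0ℚ
Pt Φ n s (suc t) x y = sumOver (vertices Φ n s) (λ z → Pt Φ n s t x z * P Φ n s z y)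

Stationary : (Φ : Typ) (n : ℕ) → Vecℚ n → (Tournament Φ n → ℚ) → Set
Stationary Φ n s π =
  ((y : Tournament Φ n) → score Φ n y ≡ s → 0ℚ ≤ π y) ×
  (sumOver (vertices Φ n s) π ≡ 1ℚ) ×
  ((y : Tournament Φ n) → score Φ n y ≡ s →
     sumOver (vertices Φ n s) (λ z → π z * P Φ n s z y) ≡ π y)

tvDist : (Φ : Typ) (n : ℕ) → Vecℚ n → ℕ → Tournament Φ n → (Tournament Φ n → ℚ) → ℚ
tvDist Φ n s t x π = ½ * sumOver (vertices Φ n s) (λ y → ∣ Pt Φ n s t x y - π y ∣)

¼ : ℚ
¼ = + 1 ℚ./ 4

-- t_mix ≤ bound  (t_mix is a minimum, so this says some t ≤ bound works)
MixesBy : (Φ : Typ) (n : ℕ) → Vecℚ n → (Tournament Φ n → ℚ) → ℕ → Set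
MixesBy Φ n s π bound =
  ∃[ t ] (t ℕ.≤ bound ×
    ((x : Tournament Φ n) → score Φ n x ≡ s → tvDist Φ n s t x π ≤ ¼))

{-# OPTIONS --safe #-}
-- Orient every game by the signed root ± e that it contributes to the score; a generator copy is then
-- a triple of games whose signed roots sum to zero, and this alone forces the shape of the triple.
--
-- Path coupling is used in its dual form: if f changes by at most K along edges of the graph, then Pf
-- changes by at most (1 − 1/d) K.  For adjacent x and x′ = x ∗ Δ the moves to x′ and to x are exchanged,
-- and the other moves are paired so that paired results are again adjacent: a triple disjoint from Δ is
-- paired with itself, and if a triple meets Δ the two span a tetrahedron of six roots in which exactly
-- one of the two remaining faces is neutral in x′.  Existence of the fourth face follows from inner
-- products, uniqueness from a parity count on the squared lengths, which are 1 or 2.  The pairing also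
-- shows that the degree is constant.
--
-- If x and y have the same score, the roots of the games on which they differ sum to zero, so two of
-- them have negative inner product and add up to a root.  Repeating this gives a move that brings x and
-- y closer in Hamming distance, so the diameter is at most the number of games, hence at most n².
-- Testing against the sign of Pᵗ(x, ·) − π bounds the total variation distance by n² (1 − 1/d)ᵗ.
module Submission where

open import Data.Bool using (Bool; true; false; not; T; T?; _∧_; _∨_; _xor_; if_then_else_)
import Data.Bool.Properties as BoolP
open import Data.Nat as ℕ using (ℕ; zero; suc)
import Data.Nat.Properties as ℕP
open import Data.Fin as Fin using (Fin; zero; suc; toℕ)
import Data.Fin.Properties as FinP
open import Data.Integer as ℤ using (ℤ)
open import Data.List as List using (List; []; _∷_; allFin; filter; length)
open import Data.List.Membership.Propositional using (_∈_)
open import Data.List.Relation.Unary.Any as Any using (here; there)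
open import Data.List.Relation.Unary.All as All using (All; []; _∷_)
open import Data.List.Relation.Unary.AllPairs as AllPairs using ([]; _∷_)
open import Data.List.Relation.Unary.Unique.Propositional using (Unique)
open import Data.List.Relation.Binary.Permutation.Propositional as Perm using (_↭_; prep; swap)
import Data.List.Relation.Binary.Permutation.Propositional.Properties as PermP
open import Data.List.Relation.Binary.Pointwise as Pointwise using (Pointwise; []; _∷_)
open import Data.Vec as Vec using (Vec; []; _∷_; lookup; updateAt)
import Data.Vec.Properties as VecP
open import Data.Product using (_×_; _,_; proj₁; proj₂; ∃-syntax)
open import Data.Sum using (_⊎_; inj₁; inj₂)
open import Data.Empty using (⊥; ⊥-elim)
open import Function using (_∘_; _$_)
open import Relation.Nullary using (Dec; yes; no; ¬_)
open import Relation.Binary.PropositionalEquality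

-- The dual form needs neither couplings nor a transport distance: it consists of finite sums over
-- neighbour lists, so all estimates stay in exact rational arithmetic. Laziness is what makes the
-- exchange of x and x′ harmless, since staying put outweighs swapping.
--
-- Both types are treated at once because the combinatorics uses only two facts about roots: squared
-- lengths are 1 or 2, and two roots of different games with negative inner product add up to a
-- root. In type D all squared lengths are 2 and inner products would settle which difference of
-- roots is again a root; type B mixes two lengths, and the parity count covers both.
--
-- The constant 4: with L = ⌈log₂ n⌉ there are at most 2^(2L) games, and (1 - 1/d)^d ≤ 1/2, so after
-- 4dL steps the bound is 2^(-2L), which is at most 1/4 once L ≥ 1. If L = 0 there is at most one
-- game and hence no move; then d = 0 and no π is stationary.

module Chains where

  open import Defs using (sumOver; inv; count)
  import Data.Integer.Properties as ℤP
  open import Data.Rational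
  open import Data.Rational.Properties
  import Data.Rational.Unnormalised as ℚᵘ
  import Data.Rational.Unnormalised.Properties as ℚᵘP
  open import Data.Rational.Solver

  open +-*-Solver using (solve; _:+_; _:*_; :-_; _:-_; _:=_; con)

  -- Rational arithmetic, powers and Bernoulli's inequality.

  fromℚᵘ-+ : ∀ p q → fromℚᵘ (p ℚᵘ.+ q) ≡ fromℚᵘ p + fromℚᵘ q
  fromℚᵘ-+ p q = toℚᵘ-injective (ℚᵘP.≃-trans (toℚᵘ-fromℚᵘ (p ℚᵘ.+ q))
    (ℚᵘP.≃-sym (ℚᵘP.≃-trans (toℚᵘ-homo-+ (fromℚᵘ p) (fromℚᵘ q))
      (ℚᵘP.+-cong (toℚᵘ-fromℚᵘ p) (toℚᵘ-fromℚᵘ q)))))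

  fromℚᵘ-* : ∀ p q → fromℚᵘ (p ℚᵘ.* q) ≡ fromℚᵘ p * fromℚᵘ q
  fromℚᵘ-* p q = toℚᵘ-injective (ℚᵘP.≃-trans (toℚᵘ-fromℚᵘ (p ℚᵘ.* q))
    (ℚᵘP.≃-sym (ℚᵘP.≃-trans (toℚᵘ-homo-* (fromℚᵘ p) (fromℚᵘ q))
      (ℚᵘP.*-cong (toℚᵘ-fromℚᵘ p) (toℚᵘ-fromℚᵘ q)))))

  ι : ℤ → ℚ
  ι z = fromℚᵘ (ℚᵘ.mkℚᵘ z 0)

  ι-+ : ∀ y z → ι (y ℤ.+ z) ≡ ι y + ι z
  ι-+ y z = trans (fromℚᵘ-cong {ℚᵘ.mkℚᵘ (y ℤ.+ z) 0} {ℚᵘ.mkℚᵘ y 0 ℚᵘ.+ ℚᵘ.mkℚᵘ z 0} (ℚᵘ.*≡* (cong (ℤ._* ℤ.+ 1) (sym (cong₂ ℤ._+_ (ℤP.*-identityʳ y) (ℤP.*-identityʳ z))))))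
                  (fromℚᵘ-+ (ℚᵘ.mkℚᵘ y 0) (ℚᵘ.mkℚᵘ z 0))

  ι-neg : ∀ z → ι (ℤ.- z) ≡ - ι z
  ι-neg z = toℚᵘ-injective (ℚᵘP.≃-trans (toℚᵘ-fromℚᵘ (ℚᵘ.mkℚᵘ (ℤ.- z) 0))
    (ℚᵘP.≃-sym (ℚᵘP.≃-trans (toℚᵘ-homo‿- (ι z)) (ℚᵘP.-‿cong (toℚᵘ-fromℚᵘ (ℚᵘ.mkℚᵘ z 0))))))

  ι-injective : ∀ {y z} → ι y ≡ ι z → y ≡ z
  ι-injective {y} {z} eq with fromℚᵘ-injective {ℚᵘ.mkℚᵘ y 0} {ℚᵘ.mkℚᵘ z 0} eq
  ... | ℚᵘ.*≡* e = trans (sym (ℤP.*-identityʳ y)) (trans e (ℤP.*-identityʳ z))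

  nat : ℕ → ℚ
  nat k = ι (ℤ.+ k)

  nat-suc : ∀ k → nat (suc k) ≡ 1ℚ + nat k
  nat-suc k = ι-+ (ℤ.+ 1) (ℤ.+ k)

  nat-nonNeg : ∀ k → 0ℚ ≤ nat k
  nat-nonNeg zero = ≤-refl
  nat-nonNeg (suc k) = subst (0ℚ ≤_) (sym (nat-suc k)) (+-mono-≤ (≤ᵇ⇒≤ {0ℚ} {1ℚ} _) (nat-nonNeg k))

  nat-mono : ∀ {j k} → j ℕ.≤ k → nat j ≤ nat k
  nat-mono {k = k} ℕ.z≤n = nat-nonNeg k
  nat-mono (ℕ.s≤s {j} {k} j≤k) = subst₂ _≤_ (sym (nat-suc j)) (sym (nat-suc k)) (+-monoʳ-≤ 1ℚ (nat-mono j≤k))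

  inv-*-nat : ∀ l → inv (suc l) * nat (suc l) ≡ 1ℚ
  inv-*-nat l = trans (sym (fromℚᵘ-* (ℚᵘ.mkℚᵘ (ℤ.+ 1) l) (ℚᵘ.mkℚᵘ (ℤ.+ suc l) 0)))
    (fromℚᵘ-cong {ℚᵘ.mkℚᵘ (ℤ.+ 1) l ℚᵘ.* ℚᵘ.mkℚᵘ (ℤ.+ suc l) 0} {ℚᵘ.1ℚᵘ} (ℚᵘ.*≡* (trans (ℤP.*-identityʳ _) (trans (ℤP.*-identityˡ (ℤ.+ suc l))
      (sym (trans (ℤP.*-identityˡ _) (cong ℤ.+_ (ℕP.*-identityʳ (suc l)))))))))

  inv-nonNeg : ∀ l → 0ℚ ≤ inv l
  inv-nonNeg zero = ≤-refl
  inv-nonNeg (suc l) = nonNegative⁻¹ (inv (suc l)) {{normalize-nonNeg 1 (suc l)}}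

  *-nonNeg : ∀ {p q} → 0ℚ ≤ p → 0ℚ ≤ q → 0ℚ ≤ p * q
  *-nonNeg {p} {q} 0≤p 0≤q = nonNegative⁻¹ (p * q)
    {{nonNeg*nonNeg⇒nonNeg p {{nonNegative 0≤p}} q {{nonNegative 0≤q}}}}

  *-monoˡ : ∀ {r p q} → 0ℚ ≤ r → p ≤ q → r * p ≤ r * q
  *-monoˡ {r} 0≤r = *-monoˡ-≤-nonNeg r {{nonNegative 0≤r}}

  *-mono : ∀ {p q r s} → 0ℚ ≤ r → 0ℚ ≤ q → p ≤ q → r ≤ s → p * r ≤ q * s
  *-mono {p} {q} {r} 0≤r 0≤q p≤q r≤s = ≤-trans (*-monoʳ-≤-nonNeg r {{nonNegative 0≤r}} p≤q) (*-monoˡ 0≤q r≤s)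

  pow : ℚ → ℕ → ℚ
  pow q zero = 1ℚ
  pow q (suc k) = q * pow q k

  pow-nonNeg : ∀ {q} → 0ℚ ≤ q → ∀ k → 0ℚ ≤ pow q k
  pow-nonNeg 0≤q zero = ≤ᵇ⇒≤ {0ℚ} {1ℚ} _
  pow-nonNeg 0≤q (suc k) = *-nonNeg 0≤q (pow-nonNeg 0≤q k)

  pow-+ : ∀ q j k → pow q (j ℕ.+ k) ≡ pow q j * pow q k
  pow-+ q zero k = sym (*-identityˡ _)
  pow-+ q (suc j) k = trans (cong (q *_) (pow-+ q j k)) (sym (*-assoc q (pow q j) (pow q k)))

  pow-* : ∀ q j k → pow q (k ℕ.* j) ≡ pow (pow q j) k
  pow-* q j zero = refl
  pow-* q j (suc k) = trans (pow-+ q j (k ℕ.* j)) (cong (pow q j *_) (pow-* q j k))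

  pow-mono : ∀ {p q} → 0ℚ ≤ p → p ≤ q → ∀ k → pow p k ≤ pow q k
  pow-mono 0≤p p≤q zero = ≤-refl
  pow-mono 0≤p p≤q (suc k) = *-mono (pow-nonNeg 0≤p k) (≤-trans 0≤p p≤q) p≤q (pow-mono 0≤p p≤q k)

  -- Since (1 - y)(1 + (k + 1)y) = 1 + ky - (k + 1)y², each further factor can only decrease the
  -- product. Keeping 1 + ky on the left avoids a division.
  bernoulli : ∀ {y} → 0ℚ ≤ y → 0ℚ ≤ 1ℚ - y → ∀ k → pow (1ℚ - y) k * (1ℚ + nat k * y) ≤ 1ℚ
  bernoulli {y} 0≤y 0≤z zero = ≤-reflexive (solve 1 (λ y → con 1ℚ :* (con 1ℚ :+ con 0ℚ :* y) := con 1ℚ) refl y)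
  bernoulli {y} 0≤y 0≤z (suc k) = begin
    (z * pow z k) * (1ℚ + nat (suc k) * y)  ≡⟨ cong (λ a → (z * pow z k) * (1ℚ + a * y)) (nat-suc k) ⟩
    (z * pow z k) * (1ℚ + (1ℚ + nat k) * y) ≡⟨ solve 3 (λ y p n → ((con 1ℚ :- y) :* p) :* (con 1ℚ :+ (con 1ℚ :+ n) :* y)
                                                := p :* (con 1ℚ :+ n :* y) :- p :* ((con 1ℚ :+ n) :* (y :* y))) refl y (pow z k) (nat k) ⟩
    pow z k * (1ℚ + nat k * y) - pow z k * ((1ℚ + nat k) * (y * y))
      ≤⟨ +-monoʳ-≤ (pow z k * (1ℚ + nat k * y)) (neg-antimono-≤ {0ℚ} (*-nonNeg (pow-nonNeg 0≤z k)
           (*-nonNeg (subst (0ℚ ≤_) (nat-suc k) (nat-nonNeg (suc k))) (*-nonNeg 0≤y 0≤y)))) ⟩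
    pow z k * (1ℚ + nat k * y) + 0ℚ ≡⟨ +-identityʳ _ ⟩
    pow z k * (1ℚ + nat k * y) ≤⟨ bernoulli 0≤y 0≤z k ⟩
    1ℚ ∎
    where
    z = 1ℚ - y
    open ≤-Reasoning

  κ : ℕ → ℚ
  κ d = 1ℚ - inv d

  κ-suc : ∀ l → κ (suc l) ≡ inv (suc l) * nat l
  κ-suc l = begin
    1ℚ - i ≡⟨ cong (_- i) (sym (inv-*-nat l)) ⟩
    i * nat (suc l) - i ≡⟨ cong (λ a → i * a - i) (nat-suc l) ⟩
    i * (1ℚ + nat l) - i ≡⟨ solve 2 (λ i n → i :* (con 1ℚ :+ n) :- i := i :* n) refl i (nat l) ⟩
    i * nat l ∎
    where
    i = inv (suc l)
    open ≡-Reasoning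

  κ-nonNeg : ∀ l → 0ℚ ≤ κ (suc l)
  κ-nonNeg l = subst (0ℚ ≤_) (sym (κ-suc l)) (*-nonNeg (inv-nonNeg (suc l)) (nat-nonNeg l))

  -- Bernoulli with y = 1/d and k = d, where d = `suc l`: the factor 1 + ky is then exactly 2.
  κ-halves : ∀ l → pow (κ (suc l)) (suc l) ≤ ½
  κ-halves l = *-cancelʳ-≤-pos (1ℚ + 1ℚ) (begin
    p * (1ℚ + 1ℚ) ≡⟨ cong (λ a → p * (1ℚ + a)) (sym (trans (*-comm (nat (suc l)) (inv (suc l))) (inv-*-nat l))) ⟩
    p * (1ℚ + nat (suc l) * inv (suc l)) ≤⟨ bernoulli (inv-nonNeg (suc l)) (κ-nonNeg l) (suc l) ⟩
    1ℚ ∎)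
    where
    p = pow (κ (suc l)) (suc l)
    open ≤-Reasoning

  -- Finite sums of rationals.

  module _ {A : Set} where

    sum-cong : ∀ {f g : A → ℚ} (xs : List A) → (∀ {x} → x ∈ xs → f x ≡ g x) → sumOver xs f ≡ sumOver xs g
    sum-cong [] eq = refl
    sum-cong (x ∷ xs) eq = cong₂ _+_ (eq (here refl)) (sum-cong xs (λ x∈ → eq (there x∈)))

    sum-mono : ∀ {f g : A → ℚ} (xs : List A) → (∀ {x} → x ∈ xs → f x ≤ g x) → sumOver xs f ≤ sumOver xs g
    sum-mono [] le = ≤-refl
    sum-mono (x ∷ xs) le = +-mono-≤ (le (here refl)) (sum-mono xs (λ x∈ → le (there x∈)))

    sum-+ : ∀ (xs : List A) (f g : A → ℚ) → sumOver xs (λ x → f x + g x) ≡ sumOver xs f + sumOver xs g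
    sum-+ [] f g = refl
    sum-+ (x ∷ xs) f g = trans (cong ((f x + g x) +_) (sum-+ xs f g))
      (solve 4 (λ a b c d → (a :+ b) :+ (c :+ d) := (a :+ c) :+ (b :+ d)) refl (f x) (g x) (sumOver xs f) (sumOver xs g))

    sum-*ˡ : ∀ (xs : List A) c (f : A → ℚ) → sumOver xs (λ x → c * f x) ≡ c * sumOver xs f
    sum-*ˡ [] c f = sym (*-zeroʳ c)
    sum-*ˡ (x ∷ xs) c f = trans (cong (c * f x +_) (sum-*ˡ xs c f)) (sym (*-distribˡ-+ c (f x) (sumOver xs f)))

    sum-*ʳ : ∀ (xs : List A) c (f : A → ℚ) → sumOver xs (λ x → f x * c) ≡ sumOver xs f * c
    sum-*ʳ xs c f = trans (sum-cong xs (λ {x} _ → *-comm (f x) c)) (trans (sum-*ˡ xs c f) (*-comm c _))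

    sum-0 : ∀ (xs : List A) → sumOver xs (λ _ → 0ℚ) ≡ 0ℚ
    sum-0 [] = refl
    sum-0 (x ∷ xs) = trans (+-identityˡ _) (sum-0 xs)

    sum-neg : ∀ (xs : List A) (f : A → ℚ) → sumOver xs (λ x → - f x) ≡ - sumOver xs f
    sum-neg [] f = refl
    sum-neg (x ∷ xs) f = trans (cong (- f x +_) (sum-neg xs f)) (sym (neg-distrib-+ (f x) (sumOver xs f)))

    sum-↭ : ∀ {xs ys : List A} (f : A → ℚ) → xs ↭ ys → sumOver xs f ≡ sumOver ys f
    sum-↭ f Perm.refl = refl
    sum-↭ f (prep x p) = cong (f x +_) (sum-↭ f p)
    sum-↭ f (swap {xs} {ys} x y p) = trans (cong (λ a → f x + (f y + a)) (sum-↭ f p))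
      (solve 3 (λ a b c → a :+ (b :+ c) := b :+ (a :+ c)) refl (f x) (f y) (sumOver ys f))
    sum-↭ f (Perm.trans p q) = trans (sum-↭ f p) (sum-↭ f q)

    sum-filter : ∀ (a : A → Bool) c (f : A → ℚ) xs →
      sumOver xs (λ y → (if a y then c else 0ℚ) * f y) ≡ c * sumOver (filter (λ y → T? (a y)) xs) f
    sum-filter a c f [] = sym (*-zeroʳ c)
    sum-filter a c f (x ∷ xs) with a x
    ... | true = trans (cong (c * f x +_) (sum-filter a c f xs)) (sym (*-distribˡ-+ c (f x) (sumOver (filter (λ y → T? (a y)) xs) f)))
    ... | false = trans (cong₂ _+_ (*-zeroˡ (f x)) (sum-filter a c f xs)) (+-identityˡ _)

    sum-indicator : ∀ (a : A → Bool) c (f : A → ℚ) {x xs} → Unique xs → x ∈ xs → T (a x) →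
      (∀ {y} → T (a y) → x ≡ y) →
      sumOver xs (λ y → (if a y then c else 0ℚ) * f y) ≡ c * f x
    sum-indicator a c f {x} (px ∷ _) (here {_} {xs} refl) ax only with a x
    ... | true = trans (cong (c * f x +_) (trans (sum-cong xs vanish) (sum-0 xs))) (+-identityʳ (c * f x))
      where
      vanish : ∀ {y} → y ∈ xs → (if a y then c else 0ℚ) * f y ≡ 0ℚ
      vanish {y} y∈ with a y | only {y}
      ... | true | o = ⊥-elim (All.lookup px y∈ (o _))
      ... | false | _ = *-zeroˡ (f y)
    sum-indicator a c f {x} (pz ∷ u) (there {z} x∈) ax only with a z | only {z}
    ... | true | o = ⊥-elim (All.lookup pz x∈ (sym (o _)))
    ... | false | _ = trans (cong₂ _+_ (*-zeroˡ (f z)) (sum-indicator a c f u x∈ ax only)) (+-identityˡ _)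

  sum-swap : ∀ {A B : Set} (xs : List A) (ys : List B) (f : A → B → ℚ) →
    sumOver xs (λ x → sumOver ys (f x)) ≡ sumOver ys (λ y → sumOver xs (λ x → f x y))
  sum-swap [] ys f = sym (sum-0 ys)
  sum-swap (x ∷ xs) ys f = trans (cong (sumOver ys (f x) +_) (sum-swap xs ys f)) (sym (sum-+ ys (f x) (λ y → sumOver xs (λ x → f x y))))

  -- Dual path coupling for a finite chain.

  module Contraction {A : Set} (V : List A) (p : A → A → ℚ) (pt : ℕ → A → A → ℚ) (Adj : A → A → Set)
    (pt-zero : ∀ (f : A → ℚ) {x} → x ∈ V → sumOver V (λ y → pt 0 x y * f y) ≡ f x)
    (pt-suc : ∀ t x y → pt (suc t) x y ≡ sumOver V (λ z → pt t x z * p z y))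
    where

    Lip : (A → ℚ) → ℚ → Set
    Lip f K = ∀ {x y} → x ∈ V → y ∈ V → Adj x y → f x ≤ f y + K

    act : (A → ℚ) → A → ℚ
    act f x = sumOver V (λ y → p x y * f y)

    -- The powers of the walk acting on functions. Applying `act` first agrees with `pt-suc`, which
    -- adds the last step of the chain on the right.
    iter : ℕ → (A → ℚ) → A → ℚ
    iter zero f = f
    iter (suc t) f = iter t (act f)

    private
      -- Interchanging the two sums moves one step of the chain from the weights to the test
      -- function.
      exchange : ∀ (w : A → ℚ) (f : A → ℚ) →
        sumOver V (λ y → sumOver V (λ z → w z * p z y) * f y) ≡ sumOver V (λ z → w z * act f z)
      exchange w f = begin
        sumOver V (λ y → sumOver V (λ z → w z * p z y) * f y)
          ≡⟨ sum-cong V (λ {y} _ → sym (sum-*ʳ V (f y) (λ z → w z * p z y))) ⟩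
        sumOver V (λ y → sumOver V (λ z → (w z * p z y) * f y)) ≡⟨ sum-swap V V _ ⟩
        sumOver V (λ z → sumOver V (λ y → (w z * p z y) * f y))
          ≡⟨ sum-cong V (λ {z} _ → trans (sum-cong V (λ {y} _ → *-assoc (w z) (p z y) (f y))) (sum-*ˡ V (w z) _)) ⟩
        sumOver V (λ z → w z * act f z) ∎
        where open ≡-Reasoning

    expectation : ∀ t (f : A → ℚ) {x} → x ∈ V → sumOver V (λ y → pt t x y * f y) ≡ iter t f x
    expectation zero f x∈ = pt-zero f x∈
    expectation (suc t) f {x} x∈ = trans (sum-cong V (λ {y} _ → cong (_* f y) (pt-suc t x y)))
      (trans (exchange (pt t x) f) (expectation t (act f) x∈))

    module _ (π : A → ℚ) (π-nonNeg : ∀ {x} → x ∈ V → 0ℚ ≤ π x) (π-total : sumOver V π ≡ 1ℚ)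
      (π-stat : ∀ {y} → y ∈ V → sumOver V (λ z → π z * p z y) ≡ π y) where

      π-iter : ∀ t f → sumOver V (λ z → π z * iter t f z) ≡ sumOver V (λ z → π z * f z)
      π-iter zero f = refl
      π-iter (suc t) f = trans (π-iter t (act f)) (trans (sym (exchange π f))
        (sum-cong V (λ {y} y∈ → cong (_* f y) (π-stat y∈))))

      module _ (k D : ℚ) (contract : ∀ {f K} → 0ℚ ≤ K → Lip f K → Lip (act f) (k * K)) (0≤k : 0ℚ ≤ k)
        (diameter : ∀ {f K} → 0ℚ ≤ K → Lip f K → ∀ {x y} → x ∈ V → y ∈ V → f x ≤ f y + D * K) where

        iter-Lip : ∀ t {f K} → 0ℚ ≤ K → Lip f K → Lip (iter t f) (pow k t * K)
        iter-Lip zero {f} {K} 0≤K lip = subst (Lip f) (sym (*-identityˡ K)) lip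
        iter-Lip (suc t) {f} {K} 0≤K lip = subst (Lip (iter t (act f)))
          (solve 3 (λ a b c → a :* (b :* c) := (b :* a) :* c) refl (pow k t) k K)
          (iter-Lip t (*-nonNeg 0≤k 0≤K) (contract 0≤K lip))

        -- As π has total mass 1, f x is its own π-average and can be compared with f z term by
        -- term.
        oscillation : ∀ (f : A → ℚ) {c x} → x ∈ V → (∀ {z} → z ∈ V → f x ≤ f z + c) → f x - sumOver V (λ z → π z * f z) ≤ c
        oscillation f {c} {x} x∈ le = begin
          f x - S ≤⟨ +-monoˡ-≤ (- S) fx≤ ⟩
          (S + c) - S ≡⟨ solve 2 (λ s c → (s :+ c) :- s := c) refl S c ⟩
          c ∎
          where
          open ≤-Reasoning
          S = sumOver V (λ z → π z * f z)
          fx≤ : f x ≤ S + c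
          fx≤ = begin
            f x ≡⟨ sym (*-identityˡ (f x)) ⟩
            1ℚ * f x ≡⟨ cong (_* f x) (sym π-total) ⟩
            sumOver V π * f x ≡⟨ sym (sum-*ʳ V (f x) π) ⟩
            sumOver V (λ z → π z * f x) ≤⟨ sum-mono V (λ z∈ → *-monoˡ (π-nonNeg z∈) (le z∈)) ⟩
            sumOver V (λ z → π z * (f z + c)) ≡⟨ sum-cong V (λ {z} _ → *-distribˡ-+ (π z) (f z) c) ⟩
            sumOver V (λ z → π z * f z + π z * c) ≡⟨ sum-+ V _ _ ⟩
            S + sumOver V (λ z → π z * c) ≡⟨ cong (S +_) (trans (sum-*ʳ V c π) (trans (cong (_* c) π-total) (*-identityˡ c))) ⟩
            S + c ∎

        sign : ℚ → ℚ
        sign q with 0ℚ ≤? q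
        ... | yes _ = 1ℚ
        ... | no _ = - 1ℚ

        sign-abs : ∀ q → ∣ q ∣ ≡ q * sign q
        sign-abs q with 0ℚ ≤? q
        ... | yes 0≤q = trans (0≤p⇒∣p∣≡p 0≤q) (sym (*-identityʳ q))
        ... | no 0≰q = trans (sym (∣-p∣≡∣p∣ q)) (trans (0≤p⇒∣p∣≡p (neg-antimono-≤ (<⇒≤ (≰⇒> 0≰q))))
                         (solve 1 (λ q → :- q := q :* (:- con 1ℚ)) refl q))

        sign-Lip : ∀ p q → sign p ≤ sign q + (1ℚ + 1ℚ)
        sign-Lip p q with 0ℚ ≤? p | 0ℚ ≤? q
        ... | yes _ | yes _ = ≤ᵇ⇒≤ _
        ... | yes _ | no _ = ≤ᵇ⇒≤ _
        ... | no _ | yes _ = ≤ᵇ⇒≤ _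
        ... | no _ | no _ = ≤ᵇ⇒≤ _

        mixing : ∀ t {x} → x ∈ V → ½ * sumOver V (λ y → ∣ pt t x y - π y ∣) ≤ D * pow k t
        mixing t {x} x∈ = begin
          ½ * sumOver V (λ y → ∣ pt t x y - π y ∣) ≡⟨ cong (½ *_) (sum-cong V (λ {y} _ → trans (sign-abs (pt t x y - π y))
              (solve 3 (λ a b c → (a :- b) :* c := a :* c :+ :- (b :* c)) refl (pt t x y) (π y) (g y)))) ⟩
          ½ * sumOver V (λ y → pt t x y * g y + - (π y * g y)) ≡⟨ cong (½ *_) (trans (sum-+ V (λ y → pt t x y * g y) (λ y → - (π y * g y))) (cong (sumOver V (λ y → pt t x y * g y) +_) (sum-neg V (λ y → π y * g y)))) ⟩
          ½ * (sumOver V (λ y → pt t x y * g y) - sumOver V (λ y → π y * g y))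
            -- Stationarity lets g be replaced by its t-th iterate in the second sum too, so that
            -- both terms concern one and the same function.
            ≡⟨ cong (½ *_) (cong₂ _-_ (expectation t g x∈) (sym (π-iter t g))) ⟩
          ½ * (iter t g x - sumOver V (λ y → π y * iter t g y))
            -- The values of g are ± 1, so g changes by at most 2 along an edge; this 2 cancels the
            -- ½ of the total variation distance.
            ≤⟨ *-monoˡ (≤ᵇ⇒≤ {0ℚ} {½} _) (oscillation (iter t g) x∈ (λ z∈ → diameter {iter t g} (*-nonNeg (pow-nonNeg 0≤k t) (≤ᵇ⇒≤ {0ℚ} {1ℚ + 1ℚ} _))
                 (iter-Lip t {g} (≤ᵇ⇒≤ {0ℚ} {1ℚ + 1ℚ} _) (λ {u} {v} _ _ _ → sign-Lip (pt t x u - π u) (pt t x v - π v))) x∈ z∈)) ⟩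
          ½ * (D * (pow k t * (1ℚ + 1ℚ))) ≡⟨ solve 2 (λ D p → con ½ :* (D :* (p :* (con 1ℚ :+ con 1ℚ))) := D :* p) refl D (pow k t) ⟩
          D * pow k t ∎
          where
          open ≤-Reasoning
          g : A → ℚ
          g y = sign (pt t x y - π y)

  -- Lazy random walk with matched neighbourhoods.

  module LazyWalk {A : Set} (V : List A) (V-unique : Unique V) (eqb adj : A → A → Bool)
    (eqb-refl : ∀ {x} → T (eqb x x)) (eqb-only : ∀ {x y} → T (eqb x y) → x ≡ y) where

    nbrs : A → List A
    nbrs x = filter (λ y → T? (adj x y)) V

    deg : A → ℕ
    deg x = count (adj x) V

    walk : A → A → ℚ
    walk x y = (if eqb x y then ½ else 0ℚ) + (if adj x y then ½ * inv (deg x) else 0ℚ)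

    average : ∀ (f : A → ℚ) {x} → x ∈ V →
      sumOver V (λ y → walk x y * f y) ≡ ½ * f x + (½ * inv (deg x)) * sumOver (nbrs x) f
    average f {x} x∈ = begin
      sumOver V (λ y → walk x y * f y) ≡⟨ sum-cong V (λ {y} _ → *-distribʳ-+ (f y) (if eqb x y then ½ else 0ℚ) _) ⟩
      sumOver V (λ y → (if eqb x y then ½ else 0ℚ) * f y + (if adj x y then ½ * inv (deg x) else 0ℚ) * f y) ≡⟨ sum-+ V _ _ ⟩
      _ ≡⟨ cong₂ _+_ (sum-indicator (eqb x) ½ f V-unique x∈ eqb-refl eqb-only) (sum-filter (adj x) _ f V) ⟩
      ½ * f x + (½ * inv (deg x)) * sumOver (nbrs x) f ∎
      where open ≡-Reasoning

    sum-matched : ∀ {R : A → A → Set} (f : A → ℚ) {K} → (∀ {y y′} → R y y′ → f y ≤ f y′ + K) →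
      ∀ {xs ys} → Pointwise R xs ys → sumOver xs f ≤ sumOver ys f + nat (length ys) * K
    sum-matched f {K} le [] = ≤-reflexive (sym (trans (+-identityˡ _) (*-zeroˡ K)))
    sum-matched f {K} le {x ∷ xs} {y ∷ ys} (r ∷ rs) = begin
      f x + sumOver xs f ≤⟨ +-mono-≤ (le r) (sum-matched f le rs) ⟩
      (f y + K) + (sumOver ys f + nat l * K)
        ≡⟨ solve 4 (λ a K s n → (a :+ K) :+ (s :+ n :* K) := (a :+ s) :+ (con 1ℚ :+ n) :* K) refl (f y) K _ (nat l) ⟩
      (f y + sumOver ys f) + (1ℚ + nat l) * K ≡⟨ cong (λ a → (f y + sumOver ys f) + a * K) (sym (nat-suc l)) ⟩
      (f y + sumOver ys f) + nat (suc l) * K ∎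
      where
      l = length ys
      open ≤-Reasoning

    -- x and x′ are neighbours of each other and are set apart; the other neighbours are paired off
    -- by R. Permutations suffice because only sums over the neighbour lists matter.
    record Matched (R : A → A → Set) (x x′ : A) : Set where
      constructor matched
      field
        {xs ys} : List A
        left    : nbrs x ↭ x′ ∷ xs
        right   : nbrs x′ ↭ x ∷ ys
        pairing : Pointwise R xs ys

    Pointwise-length : ∀ {R : A → A → Set} {xs ys} → Pointwise R xs ys → length xs ≡ length ys
    Pointwise-length [] = refl
    Pointwise-length (_ ∷ rs) = cong suc (Pointwise-length rs)

    matched-deg : ∀ {R x x′} (M : Matched R x x′) →
      deg x ≡ suc (length (Matched.ys M)) × deg x′ ≡ suc (length (Matched.ys M))
    matched-deg (matched left right pairing) =
      trans (PermP.↭-length left) (cong suc (Pointwise-length pairing)) , PermP.↭-length right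

    -- Staying contributes ½ (f x - f x′) and the exchanged moves -½ · 1/d times the same
    -- difference. The combined weight ½ (1 - 1/d) is nonnegative, so the bound K may be inserted;
    -- the d - 1 pairs add another ½ (d - 1)/d = ½ (1 - 1/d) times K.
    matched-contract : ∀ {R x x′} → x ∈ V → x′ ∈ V → Matched R x x′ → ∀ (f : A → ℚ) {K} →
      f x ≤ f x′ + K → (∀ {y y′} → R y y′ → f y ≤ f y′ + K) →
      sumOver V (λ y → walk x y * f y) ≤ sumOver V (λ y → walk x′ y * f y) + κ (deg x) * K
    matched-contract {x = x} {x′} x∈ x′∈ M@(matched {xs} {ys} left right pairing) f {K} le leR
      rewrite average f x∈ | average f x′∈ | sum-↭ f left | sum-↭ f right | proj₁ (matched-deg M) | proj₂ (matched-deg M) = begin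
      ½ * a + (½ * i) * (b + S) ≤⟨ +-monoʳ-≤ (½ * a) (*-monoˡ (*-nonNeg (≤ᵇ⇒≤ {0ℚ} {½} _) (inv-nonNeg (suc l)))
            (+-monoʳ-≤ b (sum-matched f leR pairing))) ⟩
      ½ * a + (½ * i) * (b + (S′ + nat l * K))
        ≡⟨ solve 6 (λ a b i s n K → con ½ :* a :+ (con ½ :* i) :* (b :+ (s :+ n :* K))
              := ((con ½ :* (con 1ℚ :- i)) :* a :+ (con ½ :* i) :* (a :+ b :+ s)) :+ con ½ :* ((i :* n) :* K)) refl a b i S′ (nat l) K ⟩
      ((½ * κ (suc l)) * a + (½ * i) * (a + b + S′)) + ½ * ((i * nat l) * K)
        ≤⟨ +-monoˡ-≤ _ (+-monoˡ-≤ _ (*-monoˡ (*-nonNeg (≤ᵇ⇒≤ {0ℚ} {½} _) (κ-nonNeg l)) le)) ⟩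
      ((½ * κ (suc l)) * (b + K) + (½ * i) * (a + b + S′)) + ½ * ((i * nat l) * K)
        ≡⟨ cong (λ c → ((½ * κ (suc l)) * (b + K) + (½ * i) * (a + b + S′)) + ½ * (c * K)) (sym (κ-suc l)) ⟩
      ((½ * κ (suc l)) * (b + K) + (½ * i) * (a + b + S′)) + ½ * (κ (suc l) * K)
        ≡⟨ solve 5 (λ a b i s K → ((con ½ :* (con 1ℚ :- i)) :* (b :+ K) :+ (con ½ :* i) :* (a :+ b :+ s)) :+ con ½ :* ((con 1ℚ :- i) :* K)
               := (con ½ :* b :+ (con ½ :* i) :* (a :+ s)) :+ (con 1ℚ :- i) :* K) refl a b i S′ K ⟩
      (½ * b + (½ * i) * (a + S′)) + κ (suc l) * K ∎
      where
      l = length ys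
      a = f x
      b = f x′
      i = inv (suc l)
      S = sumOver xs f
      S′ = sumOver ys f
      open ≤-Reasoning

-- Inner products and squared lengths of integer vectors.

module InnerProducts where

  import Data.Nat.DivMod as ℕD
  open import Data.Integer hiding (suc)
  open import Data.Integer.Properties
  open import Data.Integer.Solver
  open import Relation.Nullary using (_→-dec_)
  open import Relation.Nullary.Decidable using (from-yes)
  open import Algebra.Properties.Semiring.Sum +-*-semiring using (sum; sum-cong-≗; ∑-distrib-+; *-distribˡ-sum)

  open +-*-Solver using (solve; _:+_; _:*_; :-_; _:-_; _:=_; con)

  ip : ∀ {n} → (Fin n → ℤ) → (Fin n → ℤ) → ℤ
  ip u w = sum (λ i → u i * w i)

  module _ {n : ℕ} where

    ip-cong : {u u′ w w′ : Fin n → ℤ} → (∀ i → u i ≡ u′ i) → (∀ i → w i ≡ w′ i) → ip u w ≡ ip u′ w′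
    ip-cong eu ew = sum-cong-≗ (λ i → cong₂ _*_ (eu i) (ew i))

    ip-comm : (u w : Fin n → ℤ) → ip u w ≡ ip w u
    ip-comm u w = sum-cong-≗ (λ i → *-comm (u i) (w i))

    ip-+ : (u u′ w : Fin n → ℤ) → ip (λ i → u i + u′ i) w ≡ ip u w + ip u′ w
    ip-+ u u′ w = trans (sum-cong-≗ (λ i → *-distribʳ-+ (w i) (u i) (u′ i))) (∑-distrib-+ (λ i → u i * w i) (λ i → u′ i * w i))

    ip-* : ∀ c (u w : Fin n → ℤ) → ip (λ i → c * u i) w ≡ c * ip u w
    ip-* c u w = trans (sum-cong-≗ (λ i → *-assoc c (u i) (w i))) (sym (*-distribˡ-sum c (λ i → u i * w i)))

    ip-neg : (u w : Fin n → ℤ) → ip (λ i → - u i) w ≡ - ip u w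
    ip-neg u w = trans (ip-cong (λ i → sym (-1*i≡-i (u i))) (λ i → refl)) (trans (ip-* -1ℤ u w) (-1*i≡-i (ip u w)))

    ip-zero : {u : Fin n → ℤ} (w : Fin n → ℤ) → (∀ i → u i ≡ 0ℤ) → ip u w ≡ 0ℤ
    ip-zero {u} w z = trans (ip-cong {w = w} (λ i → trans (z i) (sym (*-zeroˡ (u i)))) (λ i → refl))
                            (trans (ip-* 0ℤ u w) (*-zeroˡ (ip u w)))

    record Zero3 (u v w : Fin n → ℤ) : Set where
      constructor zero3
      field at : ∀ i → u i + (v i + w i) ≡ 0ℤ

    open Zero3 public

    rotate : {u v w : Fin n → ℤ} → Zero3 u v w → Zero3 v w u
    rotate {u} {v} {w} e = zero3 λ i → trans (sym (+-assoc (v i) (w i) (u i))) (trans (+-comm (v i + w i) (u i)) (at e i))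

    swap₂₃ : {u v w : Fin n → ℤ} → Zero3 u v w → Zero3 u w v
    swap₂₃ {u} {v} {w} e = zero3 λ i → trans (cong (λ a → u i + a) (+-comm (w i) (v i))) (at e i)

    ip-Zero3 : {u v w : Fin n → ℤ} → Zero3 u v w → ∀ z → ip u z + (ip v z + ip w z) ≡ 0ℤ
    ip-Zero3 {u} {v} {w} e z = trans (sym (trans (ip-+ u (λ i → v i + w i) z) (cong (λ a → ip u z + a) (ip-+ v w z)))) (ip-zero z (at e))

    sq-diff : {s u w : Fin n → ℤ} → (∀ i → s i ≡ u i - w i) → ip s s ≡ ip u u + ip w w - + 2 * ip u w
    sq-diff {s} {u} {w} e = begin
      ip s s ≡⟨ half s ⟩
      ip u s - ip w s ≡⟨ cong₂ _-_ (trans (ip-comm u s) (half u)) (trans (ip-comm w s) (half w)) ⟩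
      (ip u u - ip w u) - (ip u w - ip w w) ≡⟨ cong (λ a → (ip u u - a) - (ip u w - ip w w)) (ip-comm w u) ⟩
      (ip u u - ip u w) - (ip u w - ip w w)
        ≡⟨ solve 3 (λ a b c → (a :- b) :- (b :- c) := a :+ c :- con (+ 2) :* b) refl (ip u u) (ip u w) (ip w w) ⟩
      ip u u + ip w w - + 2 * ip u w ∎
      where
      open ≡-Reasoning
      half : ∀ z → ip s z ≡ ip u z - ip w z
      half z = trans (ip-cong {w = z} e (λ i → refl)) (trans (ip-+ u (λ i → - w i) z) (cong (λ a → ip u z + a) (ip-neg w z)))

    sq-Zero3 : {u v w : Fin n → ℤ} → Zero3 u v w → ip u u ≡ ip v v + ip w w + + 2 * ip v w
    sq-Zero3 {u} {v} {w} e = begin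
      -- The inner products of u + v + w = 0 with u, v and w all vanish; the first minus the other
      -- two eliminates the mixed products with u.
      uu ≡⟨ solve 6 (λ uu uv uw vv vw ww → uu := (vv :+ ww :+ con (+ 2) :* vw)
                :+ (((uu :+ (uv :+ uw)) :- (uv :+ (vv :+ vw))) :- (uw :+ (vw :+ ww)))) refl uu uv uw vv vw ww ⟩
      (vv + ww + + 2 * vw) + (((uu + (uv + uw)) - (uv + (vv + vw))) - (uw + (vw + ww)))
        ≡⟨ cong (λ a → (vv + ww + + 2 * vw) + a) (cong₂ _-_ (cong₂ _-_
             (trans (cong₂ (λ a b → uu + (a + b)) (ip-comm u v) (ip-comm u w)) (ip-Zero3 e u))
             (ip-Zero3 e v)) (trans (cong (λ a → uw + (a + ww)) (ip-comm w v)) (ip-Zero3 e w))) ⟩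
      (vv + ww + + 2 * vw) + 0ℤ ≡⟨ +-identityʳ _ ⟩
      vv + ww + + 2 * vw ≡⟨ cong (λ a → vv + ww + + 2 * a) (ip-comm w v) ⟩
      vv + ww + + 2 * ip v w ∎
      where
      open ≡-Reasoning
      uu = ip u u
      uv = ip u v
      uw = ip u w
      vv = ip v v
      vw = ip w v
      ww = ip w w

  Norm : ℤ → Set
  Norm z = z ≡ + 1 ⊎ z ≡ + 2

  norm-pos : ∀ {z} → Norm z → 0ℤ < z
  norm-pos (inj₁ refl) = +<+ (ℕ.s≤s ℕ.z≤n)
  norm-pos (inj₂ refl) = +<+ (ℕ.s≤s ℕ.z≤n)

  norm-not-4* : ∀ {y z} → Norm y → Norm z → y ≡ + 4 * z → ⊥
  norm-not-4* (inj₁ refl) (inj₁ refl) ()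
  norm-not-4* (inj₁ refl) (inj₂ refl) ()
  norm-not-4* (inj₂ refl) (inj₁ refl) ()
  norm-not-4* (inj₂ refl) (inj₂ refl) ()

  norm-code : ∀ {z} → Norm z → ∃[ f ] z ≡ + suc (toℕ {2} f)
  norm-code (inj₁ e) = zero , e
  norm-code (inj₂ e) = suc zero , e

  private
    # : Fin 2 → ℕ
    # f = suc (toℕ f)

    Even : ℕ → Set
    Even k = k ℕ.% 2 ≡ 0

    Impossible : Fin 2 → Fin 2 → Fin 2 → Fin 2 → Fin 2 → Fin 2 → Fin 2 → Set
    Impossible a b c m n s t = # s ℕ.+ # t ℕ.+ # a ≡ # b ℕ.+ # c ℕ.+ # m ℕ.+ # n →
      Even (# s ℕ.+ # b ℕ.+ # m) → Even (# a ℕ.+ # b ℕ.+ # c) → Even (# n ℕ.+ # a ℕ.+ # m) → ⊥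

    -- The evenness conditions give s ≡ b + m, a ≡ b + c and n ≡ b + c + m mod 2, and the equation
    -- then forces t ≡ c + m. Lengths 1 and 2 are told apart by parity, so each choice of b, c, m
    -- leaves one candidate, and it violates the equation. All 2⁷ cases are decided by computation.
    impossible : ∀ a b c m n s t → Impossible a b c m n s t
    impossible = from-yes (FinP.all? λ a → FinP.all? λ b → FinP.all? λ c → FinP.all? λ m → FinP.all? λ n →
      FinP.all? λ s → FinP.all? λ t → (# s ℕ.+ # t ℕ.+ # a ℕP.≟ # b ℕ.+ # c ℕ.+ # m ℕ.+ # n) →-dec
      (((# s ℕ.+ # b ℕ.+ # m) ℕ.% 2 ℕP.≟ 0) →-dec (((# a ℕ.+ # b ℕ.+ # c) ℕ.% 2 ℕP.≟ 0) →-dec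
      (((# n ℕ.+ # a ℕ.+ # m) ℕ.% 2 ℕP.≟ 0) →-dec no λ ()))))

    even : ∀ {k} z → + k ≡ + 2 * z → Even k
    even {k} z e = trans (cong (ℕ._% 2) (trans (cong ∣_∣ e) (trans (abs-* (+ 2) z) (ℕP.*-comm 2 ∣ z ∣)))) (ℕD.m*n%n≡0 ∣ z ∣ 2)

  module _ {n : ℕ} {A B C M N : Fin n → ℤ} (ABC : Zero3 A B C) (AMN : Zero3 A M N) where

    -- The squared lengths of B − M and C − M add up to |B|² + |C|² + |M|² + |N|² − |A|², which is
    -- incompatible with the parities when all lengths involved are 1 or 2.
    not-both-roots : Norm (ip A A) → Norm (ip B B) → Norm (ip C C) → Norm (ip M M) → Norm (ip N N) →
      Norm (ip B B + ip M M - + 2 * ip B M) → Norm (ip C C + ip M M - + 2 * ip C M) → ⊥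
    not-both-roots nA nB nC nM nN nS nT
      with norm-code nA | norm-code nB | norm-code nC | norm-code nM | norm-code nN | norm-code nS | norm-code nT
    ... | a , ea | b , eb | c , ec | m , em | k , en | s , es | t , et =
      impossible a b c m k s t (+-injective total) (even (bb + mm - bm) evS) (even (bb + cc + ip B C) evA) (even (aa + mm + ip A M) evN)
      where
      aa = ip A A
      bb = ip B B
      cc = ip C C
      mm = ip M M
      nn = ip N N
      bm = ip B M
      cm = ip C M
      eqN : nn ≡ aa + mm + + 2 * ip A M
      eqN = sq-Zero3 (rotate (rotate AMN))
      eqA : aa ≡ bb + cc + + 2 * ip B C
      eqA = sq-Zero3 ABC
      open ≡-Reasoning
      total : + (# s ℕ.+ # t ℕ.+ # a) ≡ + (# b ℕ.+ # c ℕ.+ # m ℕ.+ # k)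
      total = begin
        + # s + + # t + + # a ≡⟨ cong₂ _+_ (cong₂ _+_ (sym es) (sym et)) (sym ea) ⟩
        (bb + mm - + 2 * bm) + (cc + mm - + 2 * cm) + aa
          ≡⟨ solve 7 (λ aa bb cc mm am bm cm → (bb :+ mm :- con (+ 2) :* bm) :+ (cc :+ mm :- con (+ 2) :* cm) :+ aa
                := (bb :+ cc :+ mm :+ (aa :+ mm :+ con (+ 2) :* am)) :- con (+ 2) :* (am :+ (bm :+ cm))) refl aa bb cc mm (ip A M) bm cm ⟩
        (bb + cc + mm + (aa + mm + + 2 * ip A M)) - + 2 * (ip A M + (bm + cm))
          ≡⟨ cong₂ (λ x y → (bb + cc + mm + x) - + 2 * y) (sym eqN) (ip-Zero3 ABC M) ⟩
        (bb + cc + mm + nn) + 0ℤ ≡⟨ +-identityʳ _ ⟩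
        bb + cc + mm + nn ≡⟨ cong₂ _+_ (cong₂ _+_ (cong₂ _+_ eb ec) em) en ⟩
        + # b + + # c + + # m + + # k ∎
      evS : + (# s ℕ.+ # b ℕ.+ # m) ≡ + 2 * (bb + mm - bm)
      evS = trans (cong₂ _+_ (cong₂ _+_ (sym es) (sym eb)) (sym em))
        (solve 3 (λ b m x → (b :+ m :- con (+ 2) :* x) :+ b :+ m := con (+ 2) :* (b :+ m :- x)) refl bb mm bm)
      evA : + (# a ℕ.+ # b ℕ.+ # c) ≡ + 2 * (bb + cc + ip B C)
      evA = trans (cong₂ _+_ (cong₂ _+_ (trans (sym ea) eqA) (sym eb)) (sym ec))
        (solve 3 (λ b m x → (b :+ m :+ con (+ 2) :* x) :+ b :+ m := con (+ 2) :* (b :+ m :+ x)) refl bb cc (ip B C))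
      evN : + (# k ℕ.+ # a ℕ.+ # m) ≡ + 2 * (aa + mm + ip A M)
      evN = trans (cong₂ _+_ (cong₂ _+_ (trans (sym en) eqN) (sym ea)) (sym em))
        (solve 3 (λ b m x → (b :+ m :+ con (+ 2) :* x) :+ b :+ m := con (+ 2) :* (b :+ m :+ x)) refl aa mm (ip A M))

  sum-neg⇒some-neg : ∀ {x y} → x + y < 0ℤ → x < 0ℤ ⊎ y < 0ℤ
  sum-neg⇒some-neg {x} {y} s with 0ℤ ≤? x | 0ℤ ≤? y
  ... | no p | _ = inj₁ (≰⇒> p)
  ... | yes _ | no q = inj₂ (≰⇒> q)
  ... | yes p | yes q = ⊥-elim (<⇒≱ s (+-mono-≤ p q))

  -- A · B + A · C = - |A|² is negative.
  Zero3⇒some-neg : ∀ {n} {A B C : Fin n → ℤ} → Zero3 A B C → Norm (ip A A) → ip A B < 0ℤ ⊎ ip A C < 0ℤ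
  Zero3⇒some-neg {A = A} {B} {C} e nA = sum-neg⇒some-neg (begin-strict
    ip A B + ip A C ≡⟨ cong₂ _+_ (ip-comm A B) (ip-comm A C) ⟩
    ip B A + ip C A ≡⟨ sym (+-identityˡ _) ⟩
    0ℤ + (ip B A + ip C A) <⟨ +-monoˡ-< (ip B A + ip C A) (norm-pos nA) ⟩
    ip A A + (ip B A + ip C A) ≡⟨ ip-Zero3 e A ⟩
    0ℤ ∎)
    where open ≤-Reasoning

  -- B · M + C · M = - A · M is positive.
  some-pos : ∀ {n} {A B C M : Fin n → ℤ} → Zero3 A B C → ip A M < 0ℤ → 0ℤ < ip B M ⊎ 0ℤ < ip C M
  some-pos {A = A} {B} {C} {M} ABC neg with 0ℤ <? ip B M | 0ℤ <? ip C M
  ... | yes p | _ = inj₁ p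
  ... | no _ | yes q = inj₂ q
  ... | no p | no q = ⊥-elim (<-irrefl (ip-Zero3 ABC M) (+-mono-<-≤ neg (+-mono-≤ (≮⇒≥ p) (≮⇒≥ q))))

-- Flips as addition mod 2, and Hamming distance.

module Flips where

  open import Defs using (flipG)
  open import Data.Bool.Solver
  open import Data.Nat using (_<_; _≤_; s≤s; z≤n)
  open import Data.Fin using (_≟_)
  open import Data.List.Membership.Propositional.Properties using (∈-∃++)
  open import Data.List.Relation.Binary.Permutation.Propositional using (↭⇒↭ₛ)
  import Data.List.Relation.Binary.Permutation.Setoid.Properties as PermS
  open import Relation.Nullary using (does)
  open import Relation.Nullary.Decidable using (dec-true; dec-false)

  open xor-∧-Solver using (solve; _:+_; _:=_)

  ∈⇒↭ : ∀ {A : Set} {v : A} {xs} → v ∈ xs → ∃[ zs ] xs ↭ v ∷ zs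
  ∈⇒↭ {v = v} v∈ with ys , zs , refl ← ∈-∃++ v∈ = ys List.++ zs , PermP.shift v ys zs

  Unique-resp-↭ : ∀ {A : Set} {xs ys : List A} → xs ↭ ys → Unique xs → Unique ys
  Unique-resp-↭ {A} p = PermS.Unique-resp-↭ (setoid A) (↭⇒↭ₛ p)

  -- A relation that is functional, injective and total from both sides is a bijection of the two
  -- duplicate-free lists. Totality from the side of `ys` rules out leftover elements, so no lengths
  -- have to be compared.
  matching : ∀ {A B : Set} {R : A → B → Set} →
    (∀ {x y y′} → R x y → R x y′ → y ≡ y′) → (∀ {x x′ y} → R x y → R x′ y → x ≡ x′) →
    ∀ {xs ys} → Unique xs → Unique ys →
    (∀ {x} → x ∈ xs → ∃[ y ] (y ∈ ys × R x y)) → (∀ {y} → y ∈ ys → ∃[ x ] (x ∈ xs × R x y)) →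
    ∃[ zs ] (ys ↭ zs × Pointwise R xs zs)
  matching fun inj {[]} {[]} ux uy f g = [] , Perm.refl , []
  matching fun inj {[]} {y ∷ ys} ux uy f g with () ← proj₁ (proj₂ (g (here refl)))
  matching {R = R} fun inj {x ∷ xs} {ys} (x∉ ∷ ux) uy f g
    with y , y∈ , r ← f (here refl)
    with zs , p ← ∈⇒↭ y∈
    with y∉ ∷ uz ← Unique-resp-↭ p uy
    with ws , q , rs ← matching fun inj ux uz
           (λ x₁∈ → let y₁ , y₁∈ , r₁ = f (there x₁∈) in y₁ , Any.tail (λ e → All.lookup x∉ x₁∈ (inj (subst (R _) (sym e) r) r₁))
                      (PermP.∈-resp-↭ p y₁∈) , r₁)
           (λ z∈ → let x₂ , x₂∈ , r₂ = g (PermP.∈-resp-↭ (Perm.↭-sym p) (there z∈)) in x₂ , Any.tail (λ e → All.lookup y∉ z∈ (fun (subst (λ x → R x _) (sym e) r) r₂)) x₂∈ , r₂)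
    = y ∷ ws , Perm.trans p (prep y q) , r ∷ rs

  module _ {m : ℕ} where

    flip : Vec Bool m → Fin m → Vec Bool m
    flip x k = updateAt x k not

    flips : Vec Bool m → Fin m → Fin m → Fin m → Vec Bool m
    flips x a b c = flipG x (a , b , c)

    vec-ext : ∀ {x y : Vec Bool m} → (∀ k → lookup x k ≡ lookup y k) → x ≡ y
    vec-ext {x} {y} e = trans (sym (VecP.tabulate∘lookup x)) (trans (VecP.tabulate-cong e) (VecP.tabulate∘lookup y))

    -- In terms of this indicator a flip adds a characteristic vector mod 2, and identities between
    -- composed flips become ring identities over Bool for the solver.
    δ : Fin m → Fin m → Bool
    δ k a = does (k ≟ a)

    lookup-flip : ∀ x a k → lookup (flip x a) k ≡ δ k a xor lookup x k
    lookup-flip x a k with k ≟ a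
    ... | yes refl = VecP.lookup∘updateAt a x
    ... | no k≢a = VecP.lookup∘updateAt′ k a k≢a x

    lookup-flips : ∀ x a b c k → lookup (flips x a b c) k ≡ δ k c xor (δ k b xor (δ k a xor lookup x k))
    lookup-flips x a b c k = trans (lookup-flip (flip (flip x a) b) c k) (cong (δ k c xor_)
      (trans (lookup-flip (flip x a) b k) (cong (δ k b xor_) (lookup-flip x a k))))

    flips-rotate : ∀ x a b c → flips x a b c ≡ flips x b c a
    flips-rotate x a b c = vec-ext λ k → trans (lookup-flips x a b c k) (trans
      (solve 4 (λ a b c x → c :+ (b :+ (a :+ x)) := a :+ (c :+ (b :+ x))) refl (δ k a) (δ k b) (δ k c) (lookup x k))
      (sym (lookup-flips x b c a k)))

    flips-swap₂₃ : ∀ x a b c → flips x a b c ≡ flips x a c b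
    flips-swap₂₃ x a b c = vec-ext λ k → trans (lookup-flips x a b c k) (trans
      (solve 4 (λ a b c x → c :+ (b :+ (a :+ x)) := b :+ (c :+ (a :+ x))) refl (δ k a) (δ k b) (δ k c) (lookup x k))
      (sym (lookup-flips x a c b k)))

    flips-flips : ∀ x a b c d e f k →
      lookup (flips (flips x a b c) d e f) k ≡ δ k f xor (δ k e xor (δ k d xor (δ k c xor (δ k b xor (δ k a xor lookup x k)))))
    flips-flips x a b c d e f k = trans (lookup-flips (flips x a b c) d e f k)
      (cong (λ z → δ k f xor (δ k e xor (δ k d xor z))) (lookup-flips x a b c k))

    flips-involutive : ∀ x a b c → flips (flips x a b c) a b c ≡ x
    flips-involutive x a b c = vec-ext λ k → trans (flips-flips x a b c a b c k)
      (solve 4 (λ a b c x → c :+ (b :+ (a :+ (c :+ (b :+ (a :+ x))))) := x) refl (δ k a) (δ k b) (δ k c) (lookup x k))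

    flips-comm : ∀ x a b c d e f → flips (flips x a b c) d e f ≡ flips (flips x d e f) a b c
    flips-comm x a b c d e f = vec-ext λ k → trans (flips-flips x a b c d e f k) (trans
      (solve 7 (λ a b c d e f x → f :+ (e :+ (d :+ (c :+ (b :+ (a :+ x))))) := c :+ (b :+ (a :+ (f :+ (e :+ (d :+ x))))))
         refl (δ k a) (δ k b) (δ k c) (δ k d) (δ k e) (δ k f) (lookup x k))
      (sym (flips-flips x d e f a b c k)))

    -- Every edge of a tetrahedron lies on exactly two faces, so the four faces add up to zero mod
    -- 2: flipping abc and bms has the same effect as flipping amn and ncs.
    flips-tetrahedron : ∀ x a b c m′ n s → flips (flips x a b c) b m′ s ≡ flips (flips x a m′ n) n c s
    flips-tetrahedron x a b c m′ n s = vec-ext λ k → trans (flips-flips x a b c b m′ s k) (trans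
      (solve 7 (λ a b c m′ n s x → s :+ (m′ :+ (b :+ (c :+ (b :+ (a :+ x))))) := s :+ (c :+ (n :+ (n :+ (m′ :+ (a :+ x))))))
         refl (δ k a) (δ k b) (δ k c) (δ k m′) (δ k n) (δ k s) (lookup x k))
      (sym (flips-flips x a m′ n n c s k)))

    -- The result is y + x + x′ mod 2, where y = x ∗ def and x′ = x ∗ abc. It thus depends only on
    -- these three states and not on the triples that represent the moves.
    flips-difference : ∀ x a b c d e f k →
      lookup (flips (flips x a b c) d e f) k ≡ lookup (flips x d e f) k xor (lookup x k xor lookup (flips x a b c) k)
    flips-difference x a b c d e f k = trans (flips-flips x a b c d e f k) (trans
      (solve 7 (λ a b c d e f x → f :+ (e :+ (d :+ (c :+ (b :+ (a :+ x))))) := (f :+ (e :+ (d :+ x))) :+ (x :+ (c :+ (b :+ (a :+ x)))))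
         refl (δ k a) (δ k b) (δ k c) (δ k d) (δ k e) (δ k f) (lookup x k))
      (sym (cong₂ (λ u w → u xor (lookup x k xor w)) (lookup-flips x d e f k) (lookup-flips x a b c k))))

    In : Fin m → Fin m → Fin m → Fin m → Set
    In k a b c = k ≡ a ⊎ (k ≡ b ⊎ k ≡ c)

    pattern 1st e = inj₁ e
    pattern 2nd e = inj₂ (inj₁ e)
    pattern 3rd e = inj₂ (inj₂ e)

    In? : ∀ k a b c → Dec (In k a b c)
    In? k a b c with k ≟ a | k ≟ b | k ≟ c
    ... | yes e | _ | _ = yes (1st e)
    ... | no _ | yes e | _ = yes (2nd e)
    ... | no _ | no _ | yes e = yes (3rd e)
    ... | no p | no q | no r = no λ { (1st e) → p e ; (2nd e) → q e ; (3rd e) → r e }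

    lookup-out : ∀ x {k a b c} → ¬ In k a b c → lookup (flips x a b c) k ≡ lookup x k
    lookup-out x {k} {a} {b} {c} k∉ = trans (lookup-flips x a b c k) (begin
      δ k c xor (δ k b xor (δ k a xor lookup x k))
        ≡⟨ cong₂ (λ u w → u xor (w xor (δ k a xor lookup x k))) (dec-false (k ≟ c) (k∉ ∘ inj₂ ∘ inj₂)) (dec-false (k ≟ b) (k∉ ∘ inj₂ ∘ inj₁)) ⟩
      δ k a xor lookup x k ≡⟨ cong (_xor lookup x k) (dec-false (k ≟ a) (k∉ ∘ inj₁)) ⟩
      lookup x k ∎)
      where open ≡-Reasoning

    lookup-1st : ∀ x {a b c} → a ≢ b → a ≢ c → lookup (flips x a b c) a ≡ not (lookup x a)
    lookup-1st x {a} {b} {c} a≢b a≢c = trans (lookup-flips x a b c a) (begin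
      δ a c xor (δ a b xor (δ a a xor lookup x a))
        ≡⟨ cong₂ (λ u w → u xor (w xor (δ a a xor lookup x a))) (dec-false (a ≟ c) a≢c) (dec-false (a ≟ b) a≢b) ⟩
      δ a a xor lookup x a ≡⟨ cong (_xor lookup x a) (dec-true (a ≟ a) refl) ⟩
      not (lookup x a) ∎)
      where open ≡-Reasoning

    record Distinct (a b c : Fin m) : Set where
      constructor distinct
      field
        a≢b : a ≢ b
        a≢c : a ≢ c
        b≢c : b ≢ c

    lookup-2nd : ∀ x {a b c} → Distinct a b c → lookup (flips x a b c) b ≡ not (lookup x b)
    lookup-2nd x {a} {b} {c} (distinct a≢b a≢c b≢c) =
      trans (cong (λ y → lookup y b) (flips-rotate x a b c)) (lookup-1st x b≢c (≢-sym a≢b))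

    lookup-3rd : ∀ x {a b c} → Distinct a b c → lookup (flips x a b c) c ≡ not (lookup x c)
    lookup-3rd x {a} {b} {c} (distinct a≢b a≢c b≢c) =
      trans (cong (λ y → lookup y c) (trans (flips-rotate x a b c) (flips-rotate x b c a))) (lookup-1st x (≢-sym a≢c) (≢-sym b≢c))

    lookup-in : ∀ x {k a b c} → Distinct a b c → In k a b c → lookup (flips x a b c) k ≡ not (lookup x k)
    lookup-in x (distinct a≢b a≢c _) (1st refl) = lookup-1st x a≢b a≢c
    lookup-in x d (2nd refl) = lookup-2nd x d
    lookup-in x d (3rd refl) = lookup-3rd x d

    changed⇒In : ∀ x {k a b c} → lookup (flips x a b c) k ≢ lookup x k → In k a b c
    changed⇒In x {k} {a} {b} {c} ne with In? k a b c
    ... | yes k∈ = k∈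
    ... | no k∉ = ⊥-elim (ne (lookup-out x k∉))

    In⇒changed : ∀ x {k a b c} → Distinct a b c → In k a b c → lookup (flips x a b c) k ≢ lookup x k
    In⇒changed x d k∈ e = BoolP.not-¬ e (lookup-in x d k∈)

    abstract
      -- The flipped games are exactly those whose outcome changes, so the set of games of a move
      -- can be read off from its two end states.
      same-flips⇒In : ∀ x {k a b c a₁ b₁ c₁} → flips x a b c ≡ flips x a₁ b₁ c₁ → Distinct a b c →
        In k a b c → In k a₁ b₁ c₁
      same-flips⇒In x {k} e d k∈ = changed⇒In x (subst (λ y → lookup y k ≢ lookup x k) e (In⇒changed x d k∈))

  ham : ∀ {m} → Vec Bool m → Vec Bool m → ℕ
  ham [] [] = 0
  ham (true ∷ x) (true ∷ y) = ham x y
  ham (false ∷ x) (false ∷ y) = ham x y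
  ham (true ∷ x) (false ∷ y) = suc (ham x y)
  ham (false ∷ x) (true ∷ y) = suc (ham x y)

  ham≤ : ∀ {m} (x y : Vec Bool m) → ham x y ≤ m
  ham≤ [] [] = z≤n
  ham≤ (true ∷ x) (true ∷ y) = ℕP.m≤n⇒m≤1+n (ham≤ x y)
  ham≤ (false ∷ x) (false ∷ y) = ℕP.m≤n⇒m≤1+n (ham≤ x y)
  ham≤ (true ∷ x) (false ∷ y) = s≤s (ham≤ x y)
  ham≤ (false ∷ x) (true ∷ y) = s≤s (ham≤ x y)

  ham-sym : ∀ {m} (x y : Vec Bool m) → ham x y ≡ ham y x
  ham-sym [] [] = refl
  ham-sym (true ∷ x) (true ∷ y) = ham-sym x y
  ham-sym (false ∷ x) (false ∷ y) = ham-sym x y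
  ham-sym (true ∷ x) (false ∷ y) = cong suc (ham-sym x y)
  ham-sym (false ∷ x) (true ∷ y) = cong suc (ham-sym x y)

  ham-flip-≤ : ∀ {m} (x y : Vec Bool m) k → ham (flip x k) y ≤ suc (ham x y)
  ham-flip-≤ (true ∷ x) (true ∷ y) zero = ℕP.≤-refl
  ham-flip-≤ (false ∷ x) (false ∷ y) zero = ℕP.≤-refl
  ham-flip-≤ (true ∷ x) (false ∷ y) zero = ℕP.≤-trans (ℕP.n≤1+n _) (ℕP.n≤1+n _)
  ham-flip-≤ (false ∷ x) (true ∷ y) zero = ℕP.≤-trans (ℕP.n≤1+n _) (ℕP.n≤1+n _)
  ham-flip-≤ (true ∷ x) (true ∷ y) (suc k) = ham-flip-≤ x y k
  ham-flip-≤ (false ∷ x) (false ∷ y) (suc k) = ham-flip-≤ x y k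
  ham-flip-≤ (true ∷ x) (false ∷ y) (suc k) = s≤s (ham-flip-≤ x y k)
  ham-flip-≤ (false ∷ x) (true ∷ y) (suc k) = s≤s (ham-flip-≤ x y k)

  ham-flip-< : ∀ {m} (x y : Vec Bool m) k → lookup x k ≢ lookup y k → ham (flip x k) y < ham x y
  ham-flip-< (true ∷ x) (true ∷ y) zero ne = ⊥-elim (ne refl)
  ham-flip-< (false ∷ x) (false ∷ y) zero ne = ⊥-elim (ne refl)
  ham-flip-< (true ∷ x) (false ∷ y) zero ne = ℕP.≤-refl
  ham-flip-< (false ∷ x) (true ∷ y) zero ne = ℕP.≤-refl
  ham-flip-< (true ∷ x) (true ∷ y) (suc k) ne = ham-flip-< x y k ne
  ham-flip-< (false ∷ x) (false ∷ y) (suc k) ne = ham-flip-< x y k ne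
  ham-flip-< (true ∷ x) (false ∷ y) (suc k) ne = s≤s (ham-flip-< x y k ne)
  ham-flip-< (false ∷ x) (true ∷ y) (suc k) ne = s≤s (ham-flip-< x y k ne)

  -- Two flips repair a disagreement each and the third costs at most one, for a net gain of at
  -- least one.
  ham-flips-< : ∀ {m} (x y : Vec Bool m) {a b} c → a ≢ b → lookup x a ≢ lookup y a → lookup x b ≢ lookup y b →
    ham (flips x a b c) y < ham x y
  ham-flips-< x y {a} {b} c a≢b na nb = ℕP.<-≤-trans (s≤s (ℕP.≤-trans (ham-flip-≤ (flip (flip x a) b) y c)
      (ham-flip-< (flip x a) y b (λ e → nb (trans (sym (VecP.lookup∘updateAt′ b a (≢-sym a≢b) x)) e)))))
    (ham-flip-< x y a na)

-- Neutral triples and moves in a system of roots.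

module Roots {n m : ℕ} (v : Fin m → Fin n → ℤ) where

  open import Data.Fin using (_≟_)
  open import Data.Integer using (ℤ; +_; -_; _+_; _-_; _*_; 0ℤ; _<_; +<+)
  open InnerProducts
  open Flips
  open import Data.List.Relation.Unary.Unique.Propositional.Properties using (allFin⁺)
  open import Data.Integer.Properties hiding (_≟_)
  open import Data.Integer.Solver
  open import Data.List.Membership.Propositional.Properties using (∈-filter⁺; ∈-allFin)
  import Data.List.Relation.Unary.All.Properties as AllP
  open import Relation.Unary using (Decidable)
  open import Relation.Nullary using (¬?)

  open +-*-Solver using (solve; _:+_; _:*_; :-_; _:-_; _:=_; con)

  State : Set
  State = Vec Bool m

  root : Bool → Fin m → Fin n → ℤ
  root true k i = v k i
  root false k i = - v k i

  root-not : ∀ b k i → root (not b) k i ≡ - root b k i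
  root-not true k i = refl
  root-not false k i = sym (neg-involutive (v k i))

  r : State → Fin m → Fin n → ℤ
  r x k = root (lookup x k) k

  r-same : ∀ {x y k} → lookup y k ≡ lookup x k → ∀ i → r y k i ≡ r x k i
  r-same {k = k} e i = cong (λ b → root b k i) e

  r-opp : ∀ {x y k} → lookup y k ≡ not (lookup x k) → ∀ i → r y k i ≡ - r x k i
  r-opp {x} {k = k} e i = trans (cong (λ b → root b k i) e) (root-not (lookup x k) k i)

  record Neutral (x : State) (a b c : Fin m) : Set where
    constructor neutral₃
    field vanishing : Zero3 (r x a) (r x b) (r x c)

    cancels : ∀ i → r x a i + (r x b i + r x c i) ≡ 0ℤ
    cancels = at vanishing

  open Neutral

  turn : ∀ {x a b c} → Neutral x a b c → Neutral x b c a
  turn N = neutral₃ (rotate (vanishing N))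

  mirror : ∀ {x a b c} → Neutral x a b c → Neutral x a c b
  mirror N = neutral₃ (swap₂₃ (vanishing N))

  -- Only neutrality is demanded: neither the shape of the triple nor an order of its positions.
  -- Both are recovered in `Neutral⇒shapeOK` and `Step⇒adj`.
  data Step (x y : State) : Set where
    step : ∀ a b c → Neutral x a b c → y ≡ flips x a b c → Step x y

  private
    sum0 : ∀ {p q} → p ≡ 0ℤ → q ≡ 0ℤ → p + q ≡ 0ℤ
    sum0 refl refl = refl

    neg0 : ∀ {p} → p ≡ 0ℤ → - p ≡ 0ℤ
    neg0 refl = refl

  lsum : (Fin m → ℤ) → List (Fin m) → ℤ
  lsum f [] = 0ℤ
  lsum f (k ∷ ks) = f k + lsum f ks

  lsum-↭ : ∀ f {ks ls} → ks ↭ ls → lsum f ks ≡ lsum f ls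
  lsum-↭ f Perm.refl = refl
  lsum-↭ f (prep k p) = cong (λ a → f k + a) (lsum-↭ f p)
  lsum-↭ f (swap {ks} {ls} k l p) = trans (cong (λ a → f k + (f l + a)) (lsum-↭ f p))
    (solve 3 (λ a b c → a :+ (b :+ c) := b :+ (a :+ c)) refl (f k) (f l) (lsum f ls))
  lsum-↭ f (Perm.trans p q) = trans (lsum-↭ f p) (lsum-↭ f q)

  lsum-neg : ∀ f ks → lsum f ks < 0ℤ → ∃[ k ] (k ∈ ks × f k < 0ℤ)
  lsum-neg f [] (+<+ ())
  lsum-neg f (k ∷ ks) neg with sum-neg⇒some-neg neg
  ... | inj₁ p = k , here refl , p
  ... | inj₂ q = let l , l∈ , lt = lsum-neg f ks q in l , there l∈ , lt

  lsum-cong : ∀ {f g} ks → (∀ {k} → k ∈ ks → f k ≡ g k) → lsum f ks ≡ lsum g ks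
  lsum-cong [] e = refl
  lsum-cong (k ∷ ks) e = cong₂ _+_ (e (here refl)) (lsum-cong ks (e ∘ there))

  total : State → Fin n → ℤ
  total x i = lsum (λ k → r x k i) (allFin m)

  -- All that is used of the root systems. The condition k ≢ l excludes a root and its negative,
  -- which have negative inner product but sum to zero.
  module System
    (v-norm : ∀ k → Norm (ip (v k) (v k)))
    (v-closed : ∀ a b k l → k ≢ l → ip (root a k) (root b l) < 0ℤ →
                ∃[ g ] ∃[ c ] (∀ i → root c g i ≡ root a k i + root b l i)) where

    root-norm : ∀ b k → Norm (ip (root b k) (root b k))
    root-norm true k = v-norm k
    root-norm false k = subst Norm (sym nn) (v-norm k)
      where
      nn : ip (root false k) (root false k) ≡ ip (v k) (v k)
      nn = begin
        ip (root false k) (root false k) ≡⟨ ip-neg (v k) (root false k) ⟩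
        - ip (v k) (root false k) ≡⟨ cong -_ (trans (ip-comm (v k) (root false k)) (ip-neg (v k) (v k))) ⟩
        - - ip (v k) (v k) ≡⟨ neg-involutive _ ⟩
        ip (v k) (v k) ∎
        where open ≡-Reasoning

    r-norm : ∀ x k → Norm (ip (r x k) (r x k))
    r-norm x k = root-norm (lookup x k) k

    root≢0 : ∀ b k → ¬ (∀ i → root b k i ≡ 0ℤ)
    root≢0 b k e with root-norm b k
    ... | inj₁ p with () ← trans (sym (ip-zero (root b k) e)) p
    ... | inj₂ p with () ← trans (sym (ip-zero (root b k) e)) p

    -- Otherwise the difference of two equal roots would itself be a root.
    root-inj : ∀ a b k l → (∀ i → root a k i ≡ root b l i) → k ≡ l
    root-inj a b k l e with k ≟ l
    ... | yes k≡l = k≡l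
    ... | no k≢l = let g , c , eg = v-closed a (not b) k l k≢l (subst (_< 0ℤ) (sym neg-ip) (neg-mono-< (norm-pos (root-norm a k))))
      in ⊥-elim (root≢0 c g λ i → trans (eg i) (trans (cong₂ _+_ (e i) (root-not b l i)) (+-inverseʳ (root b l i))))
      where
      neg-ip : ip (root a k) (root (not b) l) ≡ - ip (root a k) (root a k)
      neg-ip = trans (ip-comm (root a k) (root (not b) l)) (trans
        (ip-cong {w = root a k} (λ i → trans (root-not b l i) (cong -_ (sym (e i)))) (λ i → refl)) (ip-neg (root a k) (root a k)))

    r-inj : ∀ x {k l} → (∀ i → r x k i ≡ r x l i) → k ≡ l
    r-inj x {k} {l} = root-inj (lookup x k) (lookup x l) k l

    r-inj⁻ : ∀ x {k l} → (∀ i → r x k i ≡ - r x l i) → k ≡ l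
    r-inj⁻ x {k} {l} e = root-inj (lookup x k) (not (lookup x l)) k l (λ i → trans (e i) (sym (root-not (lookup x l) l i)))

    -- Doubling multiplies the squared length by 4, while squared lengths are 1 or 2.
    r≢2r : ∀ x {k l} → ¬ (∀ i → r x k i ≡ + 2 * r x l i)
    r≢2r x {k} {l} e = norm-not-4* (r-norm x k) (r-norm x l) (begin
      ip (r x k) (r x k) ≡⟨ ip-cong e e ⟩
      ip (λ i → + 2 * r x l i) (λ i → + 2 * r x l i) ≡⟨ ip-* (+ 2) (r x l) _ ⟩
      + 2 * ip (r x l) (λ i → + 2 * r x l i) ≡⟨ cong (+ 2 *_) (trans (ip-comm (r x l) _) (ip-* (+ 2) (r x l) (r x l))) ⟩
      + 2 * (+ 2 * ip (r x l) (r x l)) ≡⟨ sym (*-assoc (+ 2) (+ 2) (ip (r x l) (r x l))) ⟩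
      + 4 * ip (r x l) (r x l) ∎)
      where open ≡-Reasoning

    abstract
      -- If a = b, the root of c would be -2 times that of a, with four times its squared length.
      neutral-≢ : ∀ x {a b c} → Neutral x a b c → a ≢ b
      neutral-≢ x {a} {b} {c} N refl = norm-not-4* (r-norm x c) (r-norm x a) (trans (sq-Zero3 (vanishing (turn (turn N))))
        (solve 1 (λ a → a :+ a :+ con (+ 2) :* a := con (+ 4) :* a) refl (ip (r x a) (r x a))))

    abstract
      neutral-distinct : ∀ x {a b c} → Neutral x a b c → Distinct a b c
      neutral-distinct x N = distinct (neutral-≢ x N) (neutral-≢ x (mirror N)) (neutral-≢ x (turn N))

    abstract
      third-unique : ∀ x {a b c d} → Neutral x a b c → Neutral x a b d → c ≡ d
      third-unique x {a} {b} {c} {d} N M = r-inj x λ i → i-j≡0⇒i≡j _ _ (trans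
        (solve 4 (λ a b c d → c :- d := (a :+ (b :+ c)) :+ (:- (a :+ (b :+ d)))) refl (r x a i) (r x b i) (r x c i) (r x d i))
        (sum0 (cancels N i) (neg0 (cancels M i))))

    neutral-flips : ∀ {x a b c} → Neutral x a b c → Neutral (flips x a b c) a b c
    neutral-flips {x} {a} {b} {c} N = neutral₃ $ zero3 λ i → trans
      (cong₂ _+_ (opp (1st refl) i) (cong₂ _+_ (opp (2nd refl) i) (opp (3rd refl) i)))
      (trans (solve 3 (λ a b c → :- a :+ (:- b :+ :- c) := :- (a :+ (b :+ c))) refl (r x a i) (r x b i) (r x c i)) (neg0 (cancels N i)))
      where
      opp : ∀ {k} → In k a b c → ∀ i → r (flips x a b c) k i ≡ - r x k i
      opp k∈ = r-opp {x} {flips x a b c} (lookup-in x (neutral-distinct x N) k∈)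

    step-sym : ∀ {x y} → Step x y → Step y x
    step-sym {x} (step a b c N refl) = step a b c (neutral-flips N) (sym (flips-involutive x a b c))

    front : ∀ {x k a b c} → Neutral x a b c → In k a b c →
      ∃[ b′ ] ∃[ c′ ] (Neutral x k b′ c′ × flips x a b c ≡ flips x k b′ c′)
    front {x} {a = a} {b} {c} N (1st refl) = b , c , N , refl
    front {x} {a = a} {b} {c} N (2nd refl) = c , a , turn N , flips-rotate x a b c
    front {x} {a = a} {b} {c} N (3rd refl) = a , b , turn (turn N) , trans (flips-rotate x a b c) (flips-rotate x b c a)

    -- In the touching case the six games a, b, c, m, n, s are the edges of a tetrahedron; three of its
    -- faces are the triples abc, amn, bms and the fourth one, ncs, leads from y to y′.
    data Partner (x x′ y y′ : State) : Set where
      disjoint : ∀ a b c d e f → Neutral x a b c → x′ ≡ flips x a b c → Neutral x d e f → y ≡ flips x d e f →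
        y′ ≡ flips x′ d e f → (∀ {k} → In k a b c → ¬ In k d e f) → Partner x x′ y y′
      touching : ∀ a b c m n s → Neutral x a b c → x′ ≡ flips x a b c → Neutral x a m n → y ≡ flips x a m n →
        Neutral x′ b m s → y′ ≡ flips x′ b m s →
        m ≢ b → m ≢ c → n ≢ b → n ≢ c → s ≢ a → s ≢ c → Partner x x′ y y′

    transport : ∀ {x y a b c} → (∀ {k} → In k a b c → lookup y k ≡ lookup x k) → Neutral x a b c → Neutral y a b c
    transport {x} {y} same N = neutral₃ $ zero3 λ i → trans (cong₂ _+_ (r-same {x} {y} (same (1st refl)) i)
      (cong₂ _+_ (r-same {x} {y} (same (2nd refl)) i) (r-same {x} {y} (same (3rd refl)) i))) (cancels N i)

    -- Seen from x′, the game shared with Δ is b instead of a, and n and s exchange roles; m is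
    -- common to both moves.
    partner-sym : ∀ {x x′ y y′} → Partner x x′ y y′ → Partner x′ x y′ y
    partner-sym {x} (disjoint a b c d e f N refl M refl refl dis) =
      disjoint a b c d e f (neutral-flips N) (sym (flips-involutive x a b c))
        (transport (λ k∈ → lookup-out x (λ k∈′ → dis k∈′ k∈)) M) refl refl dis
    partner-sym {x} (touching a b c m n s N refl M refl L refl mb mc nb nc sa sc) =
      touching b a c m s n (mirror (turn (neutral-flips N)))
        (sym (trans (sym (trans (flips-rotate (flips x a b c) a b c)
          (flips-swap₂₃ (flips x a b c) b c a))) (flips-involutive x a b c)))
        L refl M refl (≢-sym (Distinct.a≢b (neutral-distinct x M))) mc sa sc nb nc

    partner-step : ∀ {x x′ y y′} → Partner x x′ y y′ → Step x′ y′
    partner-step {x} (disjoint a b c d e f N refl M refl refl dis) =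
      step d e f (transport (λ k∈ → lookup-out x (λ k∈′ → dis k∈′ k∈)) M) refl
    partner-step (touching a b c m n s N refl M refl L refl mb mc nb nc sa sc) = step b m s L refl

    -- Of the games b, m, s only b lies in Δ, so neutrality in x′ reads - b + m + s = 0 in terms of
    -- the roots in x.
    face-eq : ∀ {x a b c m s} → Neutral x a b c → Neutral (flips x a b c) b m s →
      m ≢ a → m ≢ c → s ≢ a → s ≢ c → ∀ i → r x s i ≡ r x b i - r x m i
    face-eq {x} {a} {b} {c} {m} {s} N L ma mc sa sc i = i-j≡0⇒i≡j _ _ (trans
      (solve 3 (λ b m s → s :- (b :- m) := :- b :+ (m :+ s)) refl (r x b i) (r x m i) (r x s i))
      (trans (sym (cong₂ _+_ (r-opp {x} {x′} (lookup-2nd x (neutral-distinct x N)) i)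
        (cong₂ _+_ (r-same {x} {x′} (lookup-out x m∉Δ) i) (r-same {x} {x′} (lookup-out x s∉Δ) i)))) (cancels L i)))
      where
      x′ = flips x a b c
      open Distinct (neutral-distinct x′ L)
      s∉Δ : ¬ In s a b c
      s∉Δ (1st e) = sa e
      s∉Δ (2nd e) = a≢c (sym e)
      s∉Δ (3rd e) = sc e
      m∉Δ : ¬ In m a b c
      m∉Δ (1st e) = ma e
      m∉Δ (2nd e) = a≢b (sym e)
      m∉Δ (3rd e) = mc e

    -- A disjoint Δ stays neutral after the other move. In the touching case only n among n, c, s
    -- was flipped on the way to y, and with s = b - m the face reads - n + c + b - m = (a + b + c)
    -- - (a + m + n) = 0.
    partner-close : ∀ {x x′ y y′} → Partner x x′ y y′ → Step y y′
    partner-close {x} (disjoint a b c d e f N refl M refl refl dis) =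
      step a b c (transport (λ k∈ → lookup-out x (dis k∈)) N) (flips-comm x a b c d e f)
    partner-close {x} (touching a b c m n s N refl M refl L refl mb mc nb nc sa sc) =
      step n c s face (flips-tetrahedron x a b c m n s)
      where
      y = flips x a m n
      dN = neutral-distinct x N
      dM = neutral-distinct x M
      dL = neutral-distinct (flips x a b c) L
      open Distinct
      es : ∀ i → r x s i ≡ r x b i - r x m i
      es = face-eq N L (≢-sym (a≢b dM)) mc sa sc
      s≢n : s ≢ n
      -- If s = n, then n = b - m and a = - m - n = - b, so a and b would be the same game.
      s≢n refl = a≢b dN (r-inj⁻ x λ i → i-j≡0⇒i≡j _ _ (trans
        (solve 4 (λ a b m s → a :- (:- b) := (a :+ (m :+ s)) :+ (:- (s :- (b :- m)))) refl (r x a i) (r x b i) (r x m i) (r x s i))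
        (sum0 (cancels M i) (neg0 (i≡j⇒i-j≡0 (es i))))))
      c∉ : ¬ In c a m n
      c∉ (1st e) = a≢c dN (sym e)
      c∉ (2nd e) = mc (sym e)
      c∉ (3rd e) = nc (sym e)
      s∉ : ¬ In s a m n
      s∉ (1st e) = sa e
      s∉ (2nd e) = b≢c dL (sym e)
      s∉ (3rd e) = s≢n e
      face : Neutral y n c s
      face = neutral₃ $ zero3 λ i → trans
        (cong₂ _+_ (r-opp {x} {y} (lookup-3rd x dM) i)
          (cong₂ _+_ (r-same {x} {y} (lookup-out x c∉) i) (r-same {x} {y} (lookup-out x s∉) i)))
        (trans (solve 6 (λ a b c m n s → :- n :+ (c :+ s) := (a :+ (b :+ c)) :+ ((s :- (b :- m)) :+ (:- (a :+ (m :+ n)))))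
             refl (r x a i) (r x b i) (r x c i) (r x m i) (r x n i) (r x s i))
          (sum0 (cancels N i) (sum0 (i≡j⇒i-j≡0 (es i)) (neg0 (cancels M i)))))

    partner-≢ : ∀ {x x′ y y′} → Partner x x′ y y′ → y ≢ x′
    partner-≢ {x} (disjoint a b c d e f N refl M refl refl dis) eq =
      dis (same-flips⇒In x eq (neutral-distinct x M) (1st refl)) (1st refl)
    partner-≢ {x} (touching a b c m n s N refl M refl L refl mb mc nb nc sa sc) eq
      with same-flips⇒In x eq (neutral-distinct x M) (2nd refl)
    ... | 1st e = Distinct.a≢b (neutral-distinct x M) (sym e)
    ... | 2nd e = mb e
    ... | 3rd e = mc e

    private
      -- It remains to see that a game s with root b - m lies outside Δ: s = a would give n = - b, s
      -- = b would give m = 0, and s = c would give n = 2c.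
      tetrahedron : ∀ {x a b c m n s} → Neutral x a b c → Neutral x a m n →
        m ≢ b → m ≢ c → n ≢ b → n ≢ c → (∀ i → r x s i ≡ r x b i - r x m i) →
        Partner x (flips x a b c) (flips x a m n) (flips (flips x a b c) b m s)
      tetrahedron {x} {a} {b} {c} {m} {n} {s} N M mb mc nb nc es =
        touching a b c m n s N refl M refl L refl mb mc nb nc sa sc
        where
        dN = neutral-distinct x N
        dM = neutral-distinct x M
        open Distinct
        sa : s ≢ a
        sa refl = nb (r-inj⁻ x λ i → i-j≡0⇒i≡j _ _ (trans
          (solve 4 (λ a b m n → n :- (:- b) := (a :+ (m :+ n)) :+ (:- (a :- (b :- m)))) refl (r x a i) (r x b i) (r x m i) (r x n i))
          (sum0 (cancels M i) (neg0 (i≡j⇒i-j≡0 (es i))))))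
        sb : s ≢ b
        sb refl = root≢0 (lookup x m) m λ i → trans (solve 2 (λ b m → m := b :- (b :- m)) refl (r x b i) (r x m i)) (i≡j⇒i-j≡0 (es i))
        sc : s ≢ c
        sc refl = r≢2r x {n} {c} λ i → i-j≡0⇒i≡j _ _ (trans
          (solve 5 (λ a b c m n → n :- con (+ 2) :* c := (a :+ (m :+ n)) :+ ((:- (a :+ (b :+ c))) :+ (:- (c :- (b :- m)))))
             refl (r x a i) (r x b i) (r x c i) (r x m i) (r x n i))
          (sum0 (cancels M i) (sum0 (neg0 (cancels N i)) (neg0 (i≡j⇒i-j≡0 (es i))))))
        s∉Δ : ¬ In s a b c
        s∉Δ (1st e) = sa e
        s∉Δ (2nd e) = sb e
        s∉Δ (3rd e) = sc e
        m∉Δ : ¬ In m a b c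
        m∉Δ (1st e) = a≢b dM (sym e)
        m∉Δ (2nd e) = mb e
        m∉Δ (3rd e) = mc e
        L : Neutral (flips x a b c) b m s
        L = neutral₃ $ zero3 λ i → trans (cong₂ _+_ (r-opp {x} {flips x a b c} (lookup-2nd x dN) i)
          (cong₂ _+_ (r-same {x} {flips x a b c} (lookup-out x m∉Δ) i) (r-same {x} {flips x a b c} (lookup-out x s∉Δ) i)))
          (trans (solve 3 (λ b m s → :- b :+ (m :+ s) := s :- (b :- m)) refl (r x b i) (r x m i) (r x s i)) (i≡j⇒i-j≡0 (es i)))

      -- The root ± (b − m) = ± (n − c) is played one way or the other in x, which decides the face.
      tetrahedron-exists : ∀ {x a b c m n} → Neutral x a b c → Neutral x a m n →
        m ≢ b → m ≢ c → n ≢ b → n ≢ c → 0ℤ < ip (r x b) (r x m) →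
        ∃[ y′ ] Partner x (flips x a b c) (flips x a m n) y′
      tetrahedron-exists {x} {a} {b} {c} {m} {n} N M mb mc nb nc pos
        with v-closed (lookup x b) (not (lookup x m)) b m (≢-sym mb) neg
        where
        neg : ip (r x b) (root (not (lookup x m)) m) < 0ℤ
        neg = subst (_< 0ℤ) (sym (trans (ip-comm (r x b) _) (trans (ip-cong {w = r x b} (root-not (lookup x m) m) (λ i → refl))
                (trans (ip-neg (r x m) (r x b)) (cong -_ (ip-comm (r x m) (r x b))))))) (neg-mono-< pos)
      ... | g , s , es with s BoolP.≟ lookup x g
      ... | yes refl = _ , tetrahedron N M mb mc nb nc (λ i → trans (es i) (cong (λ a → r x b i + a) (root-not (lookup x m) m i)))
      ... | no ne = flips (flips x a c b) c n g , subst₂ (λ u w → Partner x u w (flips (flips x a c b) c n g))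
                        (sym (flips-swap₂₃ x a b c)) (sym (flips-swap₂₃ x a m n))
                        (tetrahedron (mirror N) (mirror M) nc nb mc mb es′)
        where
        rg : ∀ i → r x g i ≡ - (r x b i - r x m i)
        rg i = trans (cong (λ b → root b g i) (BoolP.¬-not (≢-sym ne))) (trans (root-not s g i)
                 (cong -_ (trans (es i) (cong (λ a → r x b i + a) (root-not (lookup x m) m i)))))
        es′ : ∀ i → r x g i ≡ r x c i - r x n i
        es′ i = i-j≡0⇒i≡j _ _ (trans
          (solve 6 (λ a b c m n g → g :- (c :- n) := (a :+ (m :+ n)) :+ ((:- (a :+ (b :+ c))) :+ (g :- (:- (b :- m)))))
            refl (r x a i) (r x b i) (r x c i) (r x m i) (r x n i) (r x g i))
          (sum0 (cancels M i) (sum0 (neg0 (cancels N i)) (i≡j⇒i-j≡0 (rg i)))))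

      -- Two moves with two common games coincide, as the third root is minus the sum of the other
      -- two. Different moves therefore share at most one game.
      meets-once : ∀ {x a b c m n} → Neutral x a b c → Neutral x a m n → flips x a m n ≢ flips x a b c → m ≢ b
      meets-once {x} {a} {b} N M ne refl = ne (cong (flips x a b) (third-unique x M N))

      -- As a + b + c = 0 and a · m < 0, one of b and c has positive inner product with m, and its
      -- difference with m is the root of the sixth edge.
      shared-neg : ∀ {x a b c m n} → Neutral x a b c → Neutral x a m n → flips x a m n ≢ flips x a b c →
        ip (r x a) (r x m) < 0ℤ → ∃[ y′ ] Partner x (flips x a b c) (flips x a m n) y′
      shared-neg {x} {a} {b} {c} {m} {n} N M ne neg = split (some-pos (vanishing N) neg)
        where
        mb : m ≢ b
        mb = meets-once N M ne
        mc : m ≢ c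
        mc = meets-once (mirror N) M (λ e → ne (trans e (flips-swap₂₃ x a c b)))
        nb : n ≢ b
        nb = meets-once N (mirror M) (λ e → ne (trans (flips-swap₂₃ x a m n) e))
        nc : n ≢ c
        nc = meets-once (mirror N) (mirror M) (λ e → ne (trans (flips-swap₂₃ x a m n) (trans e (flips-swap₂₃ x a c b))))
        split : 0ℤ < ip (r x b) (r x m) ⊎ 0ℤ < ip (r x c) (r x m) → ∃[ y′ ] Partner x (flips x a b c) (flips x a m n) y′
        split (inj₁ pos) = tetrahedron-exists N M mb mc nb nc pos
        split (inj₂ pos) = subst (λ x′ → ∃[ y′ ] Partner x x′ (flips x a m n) y′) (flips-swap₂₃ x a c b)
          (tetrahedron-exists (mirror N) M mc mb nc nb pos)

      -- Since k · m + k · n = - |k|², at least one of m and n has negative inner product with the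
      -- shared game; the two are interchanged if necessary.
      shared : ∀ {x x′ y k b c m n} → Neutral x k b c → x′ ≡ flips x k b c → Neutral x k m n → y ≡ flips x k m n → y ≢ x′ →
        ∃[ y′ ] Partner x x′ y y′
      shared {x} {k = k} {m = m} {n} N refl M refl ne with Zero3⇒some-neg (vanishing M) (r-norm x k)
      ... | inj₁ neg = shared-neg N M ne neg
      ... | inj₂ neg = subst (λ y → ∃[ y′ ] Partner x _ y y′) (flips-swap₂₃ x k n m)
                         (shared-neg N (mirror M) (λ e → ne (trans (flips-swap₂₃ x k m n) e)) neg)

    -- A common game is rotated to the front of both triples, where `shared` applies. Without one,
    -- the move itself is still available in x′.
    partner-exists : ∀ {x x′ y} → Step x x′ → Step x y → y ≢ x′ → ∃[ y′ ] Partner x x′ y y′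
    partner-exists {x} (step a b c N refl) (step d e f M refl) ne = split (In? d a b c) (In? e a b c) (In? f a b c)
      where
      touch : ∀ {k} → In k a b c → In k d e f → ∃[ y′ ] Partner x (flips x a b c) (flips x d e f) y′
      touch k∈ k∈′ = let _ , _ , N′ , eN = front N k∈ ; _ , _ , M′ , eM = front M k∈′ in shared N′ eN M′ eM ne
      split : Dec (In d a b c) → Dec (In e a b c) → Dec (In f a b c) → ∃[ y′ ] Partner x (flips x a b c) (flips x d e f) y′
      split (yes d∈) _ _ = touch d∈ (1st refl)
      split (no _) (yes e∈) _ = touch e∈ (2nd refl)
      split (no _) (no _) (yes f∈) = touch f∈ (3rd refl)
      split (no d∉) (no e∉) (no f∉) = _ , disjoint a b c d e f N refl M refl refl
        λ { k∈ (1st refl) → d∉ k∈ ; k∈ (2nd refl) → e∉ k∈ ; k∈ (3rd refl) → f∉ k∈ }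

    private
      abstract
        others : ∀ (x : State) {a b c b′ c′} → Distinct a b c → Distinct a b′ c′ → flips x a b c ≡ flips x a b′ c′ →
          (b′ ≡ b × c′ ≡ c) ⊎ (b′ ≡ c × c′ ≡ b)
        others x d d′ e with same-flips⇒In x (sym e) d′ (2nd refl) | same-flips⇒In x (sym e) d′ (3rd refl)
        ... | 1st p | _ = ⊥-elim (Distinct.a≢b d′ (sym p))
        ... | _ | 1st p = ⊥-elim (Distinct.a≢c d′ (sym p))
        ... | 2nd p | 3rd q = inj₁ (p , q)
        ... | 3rd p | 2nd q = inj₂ (p , q)
        ... | 2nd p | 2nd q = ⊥-elim (Distinct.b≢c d′ (trans p (sym q)))
        ... | 3rd p | 3rd q = ⊥-elim (Distinct.b≢c d′ (trans p (sym q)))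

      abstract
        -- The shared game is the only one flipped by both moves, hence it is determined by x, x′
        -- and y alone.
        apex : ∀ (x : State) {a b c m n a′ b′ c′ m′ n′} → Distinct a′ b′ c′ → Distinct a′ m′ n′ →
          flips x a b c ≡ flips x a′ b′ c′ → flips x a m n ≡ flips x a′ m′ n′ →
          m ≢ b → m ≢ c → n ≢ b → n ≢ c → a′ ≡ a
        apex x d d′ e e′ mb mc nb nc with same-flips⇒In x (sym e) d (1st refl) | same-flips⇒In x (sym e′) d′ (1st refl)
        ... | 1st p | _ = p
        ... | _ | 1st p = p
        ... | 2nd p | 2nd q = ⊥-elim (mb (trans (sym q) p))
        ... | 2nd p | 3rd q = ⊥-elim (nb (trans (sym q) p))
        ... | 3rd p | 2nd q = ⊥-elim (mc (trans (sym q) p))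
        ... | 3rd p | 3rd q = ⊥-elim (nc (trans (sym q) p))

      i+i≡0⇒i≡0 : ∀ i → i + i ≡ 0ℤ → i ≡ 0ℤ
      i+i≡0⇒i≡0 i e = *-cancelˡ-≡ (+ 2) i 0ℤ (trans (solve 1 (λ i → con (+ 2) :* i := i :+ i) refl i) e)

      -- Both b - m and c - m would be roots, which `not-both-roots` excludes.
      crossed : ∀ {x a b c m n} → Neutral x a b c → Neutral x a m n →
        ∀ s → (∀ i → r x s i ≡ r x b i - r x m i) → ∀ β t → (∀ i → root β t i ≡ r x c i - r x m i) → ⊥
      crossed {x} {a} {b} {c} {m} {n} N M s es β t et = not-both-roots (vanishing N) (vanishing M) (r-norm x a) (r-norm x b) (r-norm x c) (r-norm x m) (r-norm x n)
        (subst Norm (sq-diff {s = r x s} {r x b} {r x m} es) (r-norm x s)) (subst Norm (sq-diff {s = root β t} {r x c} {r x m} et) (root-norm β t))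

    -- Disjoint partners are given by a formula in x, x′ and y, and a disjoint and a touching
    -- description disagree on whether the moves meet. For two touching ones `apex` fixes the shared
    -- game, and the open question is which of b, c forms a face with which of m, n.
    partner-unique : ∀ {x x′ y y₁ y₂} → Partner x x′ y y₁ → Partner x x′ y y₂ → y₁ ≡ y₂
    partner-unique {x} (disjoint a b c d e f N refl M refl refl dis) (disjoint a₂ b₂ c₂ d₂ e₂ f₂ N₂ eN M₂ eM refl _) =
      vec-ext λ k → trans (flips-difference x a b c d e f k) (trans
        (cong₂ (λ u w → lookup w k xor (lookup x k xor lookup u k)) eN eM)
        (sym (trans (cong (λ u → lookup (flips u d₂ e₂ f₂) k) eN) (flips-difference x a₂ b₂ c₂ d₂ e₂ f₂ k))))
    partner-unique {x} (disjoint a b c d e f N refl M refl refl dis) (touching a₂ b₂ c₂ m n s N₂ eN M₂ eM _ _ _ _ _ _ _ _) =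
      ⊥-elim (dis (same-flips⇒In x (sym eN) (neutral-distinct x N₂) (1st refl)) (same-flips⇒In x (sym eM) (neutral-distinct x M₂) (1st refl)))
    partner-unique {x} (touching a₂ b₂ c₂ m n s N₂ eN M₂ eM _ _ _ _ _ _ _ _) (disjoint a b c d e f N refl M refl refl dis) =
      ⊥-elim (dis (same-flips⇒In x (sym eN) (neutral-distinct x N₂) (1st refl)) (same-flips⇒In x (sym eM) (neutral-distinct x M₂) (1st refl)))
    partner-unique {x} (touching a b c m n s N refl M refl L refl mb mc nb nc sa sc)
      (touching a₂ b₂ c₂ m₂ n₂ s₂ N₂ eN M₂ eM L₂ refl mb₂ mc₂ nb₂ nc₂ sa₂ sc₂)
      with refl ← apex x (neutral-distinct x N₂) (neutral-distinct x M₂) eN eM mb mc nb nc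
      with others x (neutral-distinct x N) (neutral-distinct x N₂) eN | others x (neutral-distinct x M) (neutral-distinct x M₂) eM
    ... | inj₁ (refl , refl) | inj₁ (refl , refl) = cong (flips (flips x a b c) b m) (third-unique (flips x a b c) L L₂)
    -- The second face is b, n, s₂ with root b - n for s₂, and - (b - n) = c - m.
    ... | inj₁ (refl , refl) | inj₂ (refl , refl) = ⊥-elim (crossed N M s es (not (lookup x s₂)) s₂ λ i → trans (root-not (lookup x s₂) s₂ i)
            (trans (cong -_ (es₂ i)) (i-j≡0⇒i≡j _ _ (trans
              (solve 5 (λ a b c m n → :- (b :- n) :- (c :- m) := (a :+ (m :+ n)) :+ (:- (a :+ (b :+ c)))) refl (r x a i) (r x b i) (r x c i) (r x m i) (r x n i))
              (sum0 (cancels M i) (neg0 (cancels N i)))))))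
      where
      open Distinct
      es : ∀ i → r x s i ≡ r x b i - r x m i
      es = face-eq N L (≢-sym (a≢b (neutral-distinct x M))) mc sa sc
      es₂ : ∀ i → r x s₂ i ≡ r x b i - r x n i
      es₂ = face-eq N L₂ (≢-sym (a≢c (neutral-distinct x M))) nc sa₂ sc₂
    ... | inj₂ (refl , refl) | inj₁ (refl , refl) = ⊥-elim (crossed N M s es (lookup x s₂) s₂ es₂)
      where
      open Distinct
      es : ∀ i → r x s i ≡ r x b i - r x m i
      es = face-eq N L (≢-sym (a≢b (neutral-distinct x M))) mc sa sc
      es₂ : ∀ i → r x s₂ i ≡ r x c i - r x m i
      es₂ = face-eq N₂ (subst (λ u → Neutral u c m s₂) eN L₂) (≢-sym (a≢b (neutral-distinct x M))) mc₂ sa₂ sc₂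
    -- The second face is c, n, s₂. Its root c - n is minus b - m, so s₂ is the game s, which would
    -- have to be played both ways in x.
    ... | inj₂ (refl , refl) | inj₂ (refl , refl) = ⊥-elim (root≢0 (lookup x s) s λ i → i+i≡0⇒i≡0 (r x s i) (trans
            (cong (λ k → r x s i + r x k i) (sym s₂≡s)) (opp i)))
      where
      open Distinct
      es : ∀ i → r x s i ≡ r x b i - r x m i
      es = face-eq N L (≢-sym (a≢b (neutral-distinct x M))) mc sa sc
      es₂ : ∀ i → r x s₂ i ≡ r x c i - r x n i
      es₂ = face-eq N₂ (subst (λ u → Neutral u c n s₂) eN L₂) (≢-sym (a≢c (neutral-distinct x M))) mc₂ sa₂ sc₂
      opp : ∀ i → r x s i + r x s₂ i ≡ 0ℤ
      opp i = trans (cong₂ _+_ (es i) (es₂ i)) (trans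
        (solve 5 (λ a b c m n → (b :- m) :+ (c :- n) := (a :+ (b :+ c)) :+ (:- (a :+ (m :+ n)))) refl (r x a i) (r x b i) (r x c i) (r x m i) (r x n i))
        (sum0 (cancels N i) (neg0 (cancels M i))))
      s₂≡s : s₂ ≡ s
      s₂≡s = r-inj⁻ x λ i → i-j≡0⇒i≡j _ _ (trans (solve 2 (λ s t → t :- (:- s) := s :+ t) refl (r x s i) (r x s₂ i)) (opp i))

    -- Scores, connectivity and the diameter.

    total-flip : ∀ x k i → total (flip x k) i ≡ total x i - + 2 * r x k i
    total-flip x k i with zs , p ← ∈⇒↭ (∈-allFin k)
      with k∉ ∷ _ ← Unique-resp-↭ p (allFin⁺ m) = begin
      total (flip x k) i ≡⟨ lsum-↭ (λ l → r (flip x k) l i) p ⟩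
      r (flip x k) k i + lsum (λ l → r (flip x k) l i) zs
        ≡⟨ cong₂ _+_ (r-opp {x} {flip x k} (VecP.lookup∘updateAt k x) i)
             (lsum-cong zs (λ {l} l∈ → r-same {x} {flip x k} (VecP.lookup∘updateAt′ l k (≢-sym (All.lookup k∉ l∈)) x) i)) ⟩
      - r x k i + lsum (λ l → r x l i) zs ≡⟨ solve 2 (λ a z → :- a :+ z := (a :+ z) :- con (+ 2) :* a) refl (r x k i) _ ⟩
      (r x k i + lsum (λ l → r x l i) zs) - + 2 * r x k i ≡⟨ cong (_- + 2 * r x k i) (sym (lsum-↭ (λ l → r x l i) p)) ⟩
      total x i - + 2 * r x k i ∎
      where open ≡-Reasoning

    total-step : ∀ {x y} → Step x y → ∀ i → total y i ≡ total x i
    total-step {x} (step a b c N refl) i = begin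
      total (flips x a b c) i ≡⟨ total-flip x₂ c i ⟩
      total x₂ i - + 2 * r x₂ c i ≡⟨ cong (_- + 2 * r x₂ c i) (total-flip x₁ b i) ⟩
      total x₁ i - + 2 * r x₁ b i - + 2 * r x₂ c i ≡⟨ cong (λ t → t - + 2 * r x₁ b i - + 2 * r x₂ c i) (total-flip x a i) ⟩
      total x i - + 2 * r x a i - + 2 * r x₁ b i - + 2 * r x₂ c i
        ≡⟨ cong₂ (λ p q → total x i - + 2 * r x a i - + 2 * p - + 2 * q) (r-same {x} {x₁} (VecP.lookup∘updateAt′ b a (≢-sym a≢b) x) i)
             (r-same {x} {x₂} (trans (VecP.lookup∘updateAt′ c b (≢-sym b≢c) x₁) (VecP.lookup∘updateAt′ c a (≢-sym a≢c) x)) i) ⟩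
      total x i - + 2 * r x a i - + 2 * r x b i - + 2 * r x c i
        ≡⟨ solve 4 (λ t a b c → t :- con (+ 2) :* a :- con (+ 2) :* b :- con (+ 2) :* c := t :- con (+ 2) :* (a :+ (b :+ c)))
             refl (total x i) (r x a i) (r x b i) (r x c i) ⟩
      total x i - + 2 * (r x a i + (r x b i + r x c i)) ≡⟨ cong (λ z → total x i - + 2 * z) (cancels N i) ⟩
      total x i + 0ℤ ≡⟨ +-identityʳ _ ⟩
      total x i ∎
      where
      open ≡-Reasoning
      open Distinct (neutral-distinct x N)
      x₁ = flip x a
      x₂ = flip x₁ b

    Differ : State → State → Fin m → Set
    Differ x y k = lookup x k ≢ lookup y k

    differ? : ∀ x y → Decidable (Differ x y)
    differ? x y k = ¬? (lookup x k BoolP.≟ lookup y k)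

    differing : State → State → List (Fin m) → List (Fin m)
    differing x y = filter (differ? x y)

    -- Games with equal outcomes cancel, and a game with different outcomes contributes r - (- r) =
    -- 2r.
    sum-differ : ∀ x y i ks → lsum (λ k → r x k i) ks - lsum (λ k → r y k i) ks ≡ + 2 * lsum (λ k → r x k i) (differing x y ks)
    sum-differ x y i [] = refl
    sum-differ x y i (k ∷ ks) with lookup x k BoolP.≟ lookup y k
    ... | yes e = trans (trans (cong (λ a → (r x k i + X) - (a + Y)) (r-same {x} {y} {k} (sym e) i))
        (solve 3 (λ a p q → (a :+ p) :- (a :+ q) := p :- q) refl (r x k i) X Y)) (sum-differ x y i ks)
      where
      X = lsum (λ k → r x k i) ks
      Y = lsum (λ k → r y k i) ks
    ... | no ne = trans (cong (λ a → (r x k i + X) - (a + Y)) (r-opp {x} {y} {k} (BoolP.¬-not (≢-sym ne)) i))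
        (trans (solve 3 (λ a p q → (a :+ p) :- (:- a :+ q) := con (+ 2) :* a :+ (p :- q)) refl (r x k i) X Y)
        (trans (cong (λ z → + 2 * r x k i + z) (sum-differ x y i ks)) (sym (*-distribˡ-+ (+ 2) (r x k i) _))))
      where
      X = lsum (λ k → r x k i) ks
      Y = lsum (λ k → r y k i) ks

    ip-lsum : ∀ x (w : Fin n → ℤ) ks → ip (λ i → lsum (λ k → r x k i) ks) w ≡ lsum (λ k → ip (r x k) w) ks
    ip-lsum x w [] = ip-zero w (λ i → refl)
    ip-lsum x w (k ∷ ks) = trans (ip-+ (r x k) (λ i → lsum (λ k → r x k i) ks) w) (cong (λ z → ip (r x k) w + z) (ip-lsum x w ks))

    data Progress (x y : State) : Set where
      left  : ∀ {x₁} → Step x x₁ → ham x₁ y ℕ.< ham x y → Progress x y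
      right : ∀ {y₁} → Step y y₁ → ham x y₁ ℕ.< ham x y → Progress x y

    -- The inner product of the vanishing sum with the root of k leaves minus its squared length for
    -- the remaining games.
    neg-sum : ∀ x k ks → (∀ i → r x k i + lsum (λ l → r x l i) ks ≡ 0ℤ) → lsum (λ l → ip (r x l) (r x k)) ks < 0ℤ
    neg-sum x k ks zero-sum = begin-strict
      S ≡⟨ sym (+-identityˡ S) ⟩
      0ℤ + S <⟨ +-monoˡ-< S (norm-pos (r-norm x k)) ⟩
      ip (r x k) (r x k) + S ≡⟨ sym (ip-lsum x (r x k) (k ∷ ks)) ⟩
      ip (λ i → lsum (λ l → r x l i) (k ∷ ks)) (r x k) ≡⟨ ip-zero (r x k) zero-sum ⟩
      0ℤ ∎
      where
      open ≤-Reasoning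
      S = lsum (λ l → ip (r x l) (r x k)) ks

    -- A sum of roots vanishes only if two of them have negative inner product.  If their sum is a game
    -- on which x and y also disagree, it replaces the two in the (multi)set of games; otherwise the
    -- three games are neutral in x or in y.
    progress : ∀ {x y} h k ks → length ks ℕ.≤ h → lookup x k ≢ lookup y k → All (λ l → lookup x l ≢ lookup y l) ks →
      (∀ i → r x k i + lsum (λ l → r x l i) ks ≡ 0ℤ) → Progress x y
    progress {x} {y} h k ks len nk nks zero-sum
      with l , l∈ , neg ← lsum-neg (λ l → ip (r x l) (r x k)) ks (neg-sum x k ks zero-sum)
      with ls , p ← ∈⇒↭ l∈
      with nl ∷ nls ← PermP.All-resp-↭ p nks
      -- The replacements made by the recursion may produce repeated games, so l ≢ k is not a matter
      -- of list uniqueness; it follows because the inner product of a root with itself is positive.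
      with l≢k ← (λ (e : l ≡ k) → <-asym (norm-pos (r-norm x k)) (subst (λ l → ip (r x l) (r x k) < 0ℤ) e neg))
      with g , c , eg ← v-closed (lookup x l) (lookup x k) l k l≢k neg
      with c BoolP.≟ lookup x g
    ... | no ne = left (step k l g N refl) (ham-flips-< x y g (≢-sym l≢k) nk nl)
      where
      N : Neutral x k l g
      N = neutral₃ $ zero3 λ i → trans (cong (λ z → r x k i + (r x l i + z))
          (trans (cong (λ b → root b g i) (BoolP.¬-not (≢-sym ne))) (trans (root-not c g i) (cong -_ (eg i)))))
        (solve 2 (λ k l → k :+ (l :+ (:- (l :+ k))) := con 0ℤ) refl (r x k i) (r x l i))
    progress {x} {y} h k ks len nk nks zero-sum | yes refl with lookup x g BoolP.≟ lookup y g
    ... | yes e = right (step k l g N refl) (subst₂ ℕ._<_ (ham-sym (flips y k l g) x) (ham-sym y x)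
                    (ham-flips-< y x g (≢-sym l≢k) (≢-sym nk) (≢-sym nl)))
      where
      N : Neutral y k l g
      N = neutral₃ $ zero3 λ i → trans (cong₂ _+_ (r-opp {x} {y} (BoolP.¬-not (≢-sym nk)) i)
            (cong₂ _+_ (r-opp {x} {y} (BoolP.¬-not (≢-sym nl)) i) (trans (r-same {x} {y} (sym e) i) (eg i))))
        (solve 2 (λ k l → :- k :+ (:- l :+ (l :+ k)) := con 0ℤ) refl (r x k i) (r x l i))
    progress {x} {y} zero k ks len nk nks zero-sum | yes refl | no ng
      with () ← subst (ℕ._≤ 0) (PermP.↭-length p) len
    progress {x} {y} (suc h) k ks len nk nks zero-sum | yes refl | no ng =
      progress h g ls (ℕ.s≤s⁻¹ (subst (ℕ._≤ suc h) (PermP.↭-length p) len)) ng nls λ i →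
        trans (cong (_+ lsum (λ l → r x l i) ls) (eg i)) (trans
          (solve 3 (λ l k z → (l :+ k) :+ z := k :+ (l :+ z)) refl (r x l i) (r x k i) (lsum (λ l → r x l i) ls))
          (trans (cong (λ z → r x k i + z) (sym (lsum-↭ (λ l → r x l i) p))) (zero-sum i)))

    -- Moves are taken from either end, since `progress` finds one in x or in y without a choice
    -- between the two.
    data Path : ℕ → State → State → Set where
      stop  : ∀ {h x} → Path h x x
      left  : ∀ {h x x₁ y} → Step x x₁ → Path h x₁ y → Path (suc h) x y
      right : ∀ {h x y y₁} → Step y y₁ → Path h x y₁ → Path (suc h) x y

    connected : ∀ h {x y} → ham x y ℕ.≤ h → (∀ i → total x i ≡ total y i) → Path h x y
    connected h {x} {y} le eq with differing x y (allFin m) in eqf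
    ... | [] = subst (Path h x) (vec-ext same) stop
      where
      same : ∀ k → lookup x k ≡ lookup y k
      same k with lookup x k BoolP.≟ lookup y k
      ... | yes e = e
      ... | no ne with () ← subst (k ∈_) eqf (∈-filter⁺ (differ? x y) (∈-allFin k) ne)
    ... | k ∷ ks = go h le (progress (length ks) k ks ℕP.≤-refl (All.head differ) (All.tail differ) zero-sum)
      where
      differ : All (λ l → lookup x l ≢ lookup y l) (k ∷ ks)
      differ = subst (All _) eqf (AllP.all-filter (differ? x y) (allFin m))
      zero-sum : ∀ i → r x k i + lsum (λ l → r x l i) ks ≡ 0ℤ
      zero-sum i = *-cancelˡ-≡ (+ 2) _ 0ℤ (trans (cong (λ l → + 2 * lsum (λ k → r x k i) l) (sym eqf))
        (trans (sym (sum-differ x y i (allFin m))) (i≡j⇒i-j≡0 (eq i))))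
      go : ∀ h → ham x y ℕ.≤ h → Progress x y → Path h x y
      go zero le (left s lt) with () ← ℕP.<-≤-trans lt le
      go zero le (right s lt) with () ← ℕP.<-≤-trans lt le
      go (suc h) le (left s lt) = left s (connected h (ℕ.s≤s⁻¹ (ℕP.<-≤-trans lt le)) (λ i → trans (total-step s i) (eq i)))
      go (suc h) le (right s lt) = right s (connected h (ℕ.s≤s⁻¹ (ℕP.<-≤-trans lt le)) (λ i → trans (eq i) (sym (total-step s i))))

-- Signed roots of types B and D as sums of two literals.

module SignedEdges where

  open import Defs
  open InnerProducts
  open import Data.Bool.ListAction using (any)
  open import Data.Integer using (ℤ; +_; -_; _+_; _-_; 0ℤ; 1ℤ; _<_; +<+)
  open import Data.Integer.Properties
  open import Data.Integer.Solver
  open import Data.List.Membership.Propositional.Properties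
  import Data.List.Relation.Unary.Any.Properties as AnyP
  open import Data.Unit using (⊤; tt)
  open import Relation.Nullary.Decidable using (fromWitness)
  open import Relation.Binary using (tri<; tri≈; tri>)
  open import Algebra.Properties.Semiring.Sum +-*-semiring using (sum; sum-cong-≗; sum-replicate-zero)

  open +-*-Solver using (solve; _:+_; _:*_; :-_; _:-_; _:=_; con)

  δ : ∀ {n} → Fin n → Fin n → ℤ
  δ i k = if toℕ k ℕ.≡ᵇ toℕ i then 1ℤ else 0ℤ

  δ-refl : ∀ {n} (i : Fin n) → δ i i ≡ 1ℤ
  δ-refl zero = refl
  δ-refl (suc i) = δ-refl i

  δ-≢ : ∀ {n} {i k : Fin n} → i ≢ k → δ i k ≡ 0ℤ
  δ-≢ {i = zero} {zero} ne = ⊥-elim (ne refl)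
  δ-≢ {i = zero} {suc k} ne = refl
  δ-≢ {i = suc i} {zero} ne = refl
  δ-≢ {i = suc i} {suc k} ne = δ-≢ (ne ∘ cong suc)

  ip-δ : ∀ {n} (i : Fin n) (w : Fin n → ℤ) → ip (δ i) w ≡ w i
  ip-δ {suc n} zero w = trans (cong₂ _+_ (*-identityˡ (w zero)) (trans (sum-cong-≗ (λ k → *-zeroˡ (w (suc k)))) (sum-replicate-zero n)))
    (+-identityʳ (w zero))
  ip-δ (suc i) w = trans (cong₂ _+_ (*-zeroˡ (w zero)) (ip-δ i (w ∘ suc))) (+-identityˡ (w (suc i)))

  ∧-intro : ∀ {x y} → T x → T y → T (x ∧ y)
  ∧-intro {true} _ ty = ty

  ∨-introˡ : ∀ {x} y → T x → T (x ∨ y)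
  ∨-introˡ {true} _ _ = tt

  ∨-introʳ : ∀ x {y} → T y → T (x ∨ y)
  ∨-introʳ true _ = tt
  ∨-introʳ false ty = ty

  -- The product of two signs, with `true` standing for plus.
  same : Bool → Bool → Bool
  same true b = b
  same false b = not b

  same-comm : ∀ a b → same a b ≡ same b a
  same-comm true true = refl
  same-comm true false = refl
  same-comm false true = refl
  same-comm false false = refl

  same-not : ∀ a b → same (not a) (not b) ≡ same a b
  same-not true true = refl
  same-not true false = refl
  same-not false true = refl
  same-not false false = refl

  -- A signed root of Bₙ is the sum of two literals ± eᵢ with different indices; a half edge pairs a
  -- literal with `none`.
  data Lit (n : ℕ) : Set where
    none : Lit n
    lit  : Bool → Fin n → Lit n

  module _ {n : ℕ} where

    opp : Lit n → Lit n
    opp none = none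
    opp (lit b i) = lit (not b) i

    vecL : Lit n → Fin n → ℤ
    vecL none k = 0ℤ
    vecL (lit true i) k = δ i k
    vecL (lit false i) k = - δ i k

    Apart : Lit n → Lit n → Set
    Apart none none = ⊥
    Apart none (lit _ _) = ⊤
    Apart (lit _ _) none = ⊤
    Apart (lit _ i) (lit _ j) = i ≢ j

    ip-apart : ∀ p q → Apart p q → ip (vecL p) (vecL q) ≡ 0ℤ
    ip-apart none q _ = ip-zero (vecL q) (λ _ → refl)
    ip-apart (lit true i) none _ = ip-δ i (vecL none)
    ip-apart (lit true i) (lit true j) ne = trans (ip-δ i (δ j)) (δ-≢ (≢-sym ne))
    ip-apart (lit true i) (lit false j) ne = trans (ip-δ i (vecL (lit false j))) (cong -_ (δ-≢ (≢-sym ne)))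
    ip-apart (lit false i) none _ = trans (ip-neg (δ i) (vecL none)) (cong -_ (ip-δ i (vecL none)))
    ip-apart (lit false i) (lit true j) ne = trans (ip-neg (δ i) (δ j)) (cong -_ (trans (ip-δ i (δ j)) (δ-≢ (≢-sym ne))))
    ip-apart (lit false i) (lit false j) ne = trans (ip-neg (δ i) (vecL (lit false j)))
      (cong -_ (trans (ip-δ i (vecL (lit false j))) (cong -_ (δ-≢ (≢-sym ne)))))

    ip-self : ∀ b i → ip (vecL (lit b i)) (vecL (lit b i)) ≡ 1ℤ
    ip-self true i = trans (ip-δ i (δ i)) (δ-refl i)
    ip-self false i = trans (ip-neg (δ i) (vecL (lit false i))) (cong -_ (trans (ip-δ i (vecL (lit false i))) (cong -_ (δ-refl i))))

    ip-opp : ∀ b i → ip (vecL (lit b i)) (vecL (lit (not b) i)) ≡ - 1ℤ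
    ip-opp true i = trans (ip-δ i (vecL (lit false i))) (cong -_ (δ-refl i))
    ip-opp false i = trans (ip-neg (δ i) (δ i)) (cong -_ (trans (ip-δ i (δ i)) (δ-refl i)))

    data Relation (p q : Lit n) : Set where
      apart    : Apart p q → Relation p q
      opposite : q ≡ opp p → Relation p q
      equal    : ∀ {b i} → p ≡ lit b i → q ≡ lit b i → Relation p q

    relation : ∀ p q → Relation p q
    relation none none = opposite refl
    relation none (lit c j) = apart tt
    relation (lit b i) none = apart tt
    relation (lit b i) (lit c j) with i Fin.≟ j | b BoolP.≟ c
    ... | no ne | _ = apart ne
    ... | yes refl | yes refl = equal refl refl
    ... | yes refl | no ne = opposite (cong (λ b → lit b i) (BoolP.¬-not (≢-sym ne)))

    neg-lits : ∀ p q → ip (vecL p) (vecL q) < 0ℤ → ∃[ b ] ∃[ i ] (p ≡ lit b i × q ≡ lit (not b) i)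
    neg-lits p q lt with relation p q
    ... | apart a = ⊥-elim (<-irrefl (ip-apart p q a) lt)
    ... | equal {b} {i} refl refl with +<+ () ← subst (_< 0ℤ) (ip-self b i) lt
    neg-lits none .none lt | opposite refl = ⊥-elim (<-irrefl (ip-zero (vecL none) (λ _ → refl)) lt)
    neg-lits (lit b i) _ lt | opposite refl = b , i , refl , refl

    pairV : Lit n → Lit n → Fin n → ℤ
    pairV p q k = vecL p k + vecL q k

    ip-pair : ∀ p q r s → ip (pairV p q) (pairV r s) ≡
      (ip (vecL p) (vecL r) + ip (vecL p) (vecL s)) + (ip (vecL q) (vecL r) + ip (vecL q) (vecL s))
    ip-pair p q r s = trans (ip-+ (vecL p) (vecL q) (pairV r s)) (cong₂ _+_ (right p) (right q))
      where
      right : ∀ p → ip (vecL p) (pairV r s) ≡ ip (vecL p) (vecL r) + ip (vecL p) (vecL s)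
      right p = trans (ip-comm (vecL p) (pairV r s)) (trans (ip-+ (vecL r) (vecL s) (vecL p))
        (cong₂ _+_ (ip-comm (vecL r) (vecL p)) (ip-comm (vecL s) (vecL p))))

    apart-sym : ∀ p q → Apart p q → Apart q p
    apart-sym none (lit _ _) a = tt
    apart-sym (lit _ _) none a = tt
    apart-sym (lit _ _) (lit _ _) a = ≢-sym a

    edge : Bool → Fin n → Fin n → Edge n
    edge true = pos
    edge false = neg

    data Joins : Bool → Edge n → Lit n → Lit n → Set where
      down : ∀ {i j} a c → j Fin.< i → Joins a (edge (same a c) i j) (lit a i) (lit c j)
      up   : ∀ {i j} a c → j Fin.< i → Joins a (edge (same c a) i j) (lit c j) (lit a i)
      out  : ∀ {i} a → Joins a (half i) (lit a i) none
      in′  : ∀ {i} a → Joins a (half i) none (lit a i)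

    joins-sym : ∀ {b e p q} → Joins b e p q → Joins b e q p
    joins-sym (down {i} {j} a c lt) = subst (λ k → Joins a (edge k i j) (lit c j) (lit a i)) (same-comm c a) (up a c lt)
    joins-sym (up {i} {j} a c lt) = subst (λ k → Joins a (edge k i j) (lit a i) (lit c j)) (same-comm a c) (down a c lt)
    joins-sym (out a) = in′ a
    joins-sym (in′ a) = out a

    joins-apart : ∀ {b e p q} → Joins b e p q → Apart p q
    joins-apart (down a c lt) refl = FinP.<-irrefl refl lt
    joins-apart (up a c lt) refl = FinP.<-irrefl refl lt
    joins-apart (out a) = tt
    joins-apart (in′ a) = tt

    vecE : Edge n → Fin n → ℤ
    vecE (neg i j) k = δ i k - δ j k
    vecE (pos i j) k = δ i k + δ j k
    vecE (half i) k = δ i k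

    signed : Bool → Edge n → Fin n → ℤ
    signed true e k = vecE e k
    signed false e k = - vecE e k

    joins-vec : ∀ {b e p q} → Joins b e p q → ∀ k → signed b e k ≡ pairV p q k
    joins-vec (down true true lt) k = refl
    joins-vec (down true false lt) k = refl
    joins-vec (down {i} {j} false true lt) k = solve 2 (λ a b → :- (a :- b) := :- a :+ b) refl (δ i k) (δ j k)
    joins-vec (down {i} {j} false false lt) k = neg-distrib-+ (δ i k) (δ j k)
    joins-vec (up {i} {j} true true lt) k = +-comm (δ i k) (δ j k)
    joins-vec (up {i} {j} true false lt) k = +-comm (δ i k) (- δ j k)
    joins-vec (up {i} {j} false true lt) k = solve 2 (λ a b → :- (a :- b) := b :+ :- a) refl (δ i k) (δ j k)
    joins-vec (up {i} {j} false false lt) k = solve 2 (λ a b → :- (a :+ b) := :- b :+ :- a) refl (δ i k) (δ j k)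
    joins-vec (out {i} true) k = sym (+-identityʳ _)
    joins-vec (out {i} false) k = sym (+-identityʳ _)
    joins-vec (in′ {i} true) k = sym (+-identityˡ _)
    joins-vec (in′ {i} false) k = sym (+-identityˡ _)

    Valid : Typ → Edge n → Set
    Valid Φ (neg i j) = j Fin.< i
    Valid Φ (pos i j) = j Fin.< i
    Valid Φ (half i) = Φ ≡ B

    -- In type D the missing literal is forbidden; this is what keeps the sum of two roots of Dₙ
    -- within Dₙ.
    Allowed : Typ → Lit n → Set
    Allowed Φ none = Φ ≡ B
    Allowed Φ (lit _ _) = ⊤

    valid-joins : ∀ {Φ} e b → Valid Φ e → ∃[ p ] ∃[ q ] (Joins b e p q × Allowed Φ p × Allowed Φ q)
    valid-joins (neg i j) true lt = _ , _ , down true false lt , tt , tt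
    valid-joins (neg i j) false lt = _ , _ , down false true lt , tt , tt
    valid-joins (pos i j) true lt = _ , _ , down true true lt , tt , tt
    valid-joins (pos i j) false lt = _ , _ , down false false lt , tt , tt
    valid-joins (half i) b v = _ , _ , out b , tt , v

    edge-valid : ∀ {Φ} b {i j} → j Fin.< i → Valid Φ (edge b i j)
    edge-valid true lt = lt
    edge-valid false lt = lt

    join : ∀ {Φ} p q → Apart p q → Allowed Φ p → Allowed Φ q → ∃[ b ] ∃[ e ] (Valid Φ e × Joins b e p q)
    join none (lit c j) _ v _ = c , half j , v , in′ c
    join (lit b i) none _ _ v = b , half i , v , out b
    join (lit b i) (lit c j) ne _ _ with FinP.<-cmp i j
    ... | tri< lt _ _ = _ , _ , edge-valid (same b c) lt , up c b lt
    ... | tri≈ _ e _ = ⊥-elim (ne e)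
    ... | tri> _ _ lt = _ , _ , edge-valid (same b c) lt , down b c lt

    joins-opp : ∀ {b c e f p q} → Joins b e p q → Joins c f (opp p) (opp q) → e ≡ f
    joins-opp (down {i} {j} a c _) (down _ _ _) = cong (λ k → edge k i j) (sym (same-not a c))
    joins-opp (down _ _ lt) (up _ _ gt) = ⊥-elim (FinP.<-asym lt gt)
    joins-opp (up _ _ lt) (down _ _ gt) = ⊥-elim (FinP.<-asym lt gt)
    joins-opp (up {i} {j} a c _) (up _ _ _) = cong (λ k → edge k i j) (sym (same-not c a))
    joins-opp (out a) (out _) = refl
    joins-opp (in′ a) (in′ _) = refl

    joins-norm : ∀ {b e p q} → Joins b e p q → Norm (ip (pairV p q) (pairV p q))
    joins-norm {p = p} {q} J = subst Norm (sym (trans (ip-pair p q p q)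
        (cong₂ (λ x y → (ip (vecL p) (vecL p) + x) + (y + ip (vecL q) (vecL q))) (ip-apart p q (joins-apart J))
           (ip-apart q p (apart-sym p q (joins-apart J)))))) (lengths J)
      where
      lengths : ∀ {b e p q} → Joins b e p q → Norm ((ip (vecL p) (vecL p) + 0ℤ) + (0ℤ + ip (vecL q) (vecL q)))
      lengths (down {i} {j} a c _) = inj₂ (cong₂ (λ x y → (x + 0ℤ) + (0ℤ + y)) (ip-self a i) (ip-self c j))
      lengths (up {i} {j} a c _) = inj₂ (cong₂ (λ x y → (x + 0ℤ) + (0ℤ + y)) (ip-self c j) (ip-self a i))
      lengths (out {i} a) = inj₁ (cong₂ (λ x y → (x + 0ℤ) + (0ℤ + y)) (ip-self a i) (ip-zero (vecL none) (λ _ → refl)))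
      lengths (in′ {i} a) = inj₁ (cong₂ (λ x y → (x + 0ℤ) + (0ℤ + y)) (ip-zero (vecL none) (λ _ → refl)) (ip-self a i))

    =F-refl : ∀ (i : Fin n) → T (i =F i)
    =F-refl i = fromWitness refl

    =F-≢ : ∀ {i j : Fin n} → i ≢ j → T (not (i =F j))
    =F-≢ {i} {j} ne with toℕ i ℕ.≟ toℕ j
    ... | yes e = ⊥-elim (ne (FinP.toℕ-injective e))
    ... | no _ = tt

    samePair-refl : ∀ (p : Fin n × Fin n) → T (samePair p p)
    samePair-refl (i , j) = ∧-intro (=F-refl i) (=F-refl j)

    samePair-≢ : ∀ {p q : Fin n × Fin n} → p ≢ q → T (not (samePair p q))
    samePair-≢ {i , j} {k , l} ne with toℕ i ℕ.≟ toℕ k | toℕ j ℕ.≟ toℕ l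
    ... | no _ | _ = tt
    ... | yes _ | no _ = tt
    ... | yes e | yes f = ⊥-elim (ne (cong₂ _,_ (FinP.toℕ-injective e) (FinP.toℕ-injective f)))

    any-intro : ∀ (f : Fin n → Bool) i → T (f i) → T (any f (allFin n))
    any-intro f i t = AnyP.any⁺ f (Any.map (λ { refl → t }) (∈-allFin i))

    data Side (a b c : Fin n) : Fin n × Fin n → Set where
      ab : Side a b c (a , b)
      ac : Side a b c (a , c)
      bc : Side a b c (b , c)

    triangle-intro : ∀ e₁ e₂ e₃ {a b c} → b Fin.< a → c Fin.< b →
      Side a b c (ends e₁) → Side a b c (ends e₂) → Side a b c (ends e₃) →
      ends e₁ ≢ ends e₂ → ends e₁ ≢ ends e₃ → ends e₂ ≢ ends e₃ → T (triangle e₁ e₂ e₃)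
    triangle-intro e₁ e₂ e₃ {a} {b} {c} b<a c<b s₁ s₂ s₃ n₁₂ n₁₃ n₂₃ =
      ∧-intro (samePair-≢ n₁₂) (∧-intro (samePair-≢ n₁₃) (∧-intro (samePair-≢ n₂₃)
        (any-intro _ a (any-intro _ b (any-intro _ c (∧-intro {b <F a} (fromWitness b<a) (∧-intro {c <F b} (fromWitness c<b)
          (∧-intro (side s₁) (∧-intro (side s₂) (side s₃))))))))))
      where
      side : ∀ {p} → Side a b c p → T (samePair p (a , b) ∨ samePair p (a , c) ∨ samePair p (b , c))
      side ab = ∨-introˡ _ (samePair-refl (a , b))
      side ac = ∨-introʳ (samePair (a , c) (a , b)) (∨-introˡ _ (samePair-refl (a , c)))
      side bc = ∨-introʳ (samePair (b , c) (a , b)) (∨-introʳ (samePair (b , c) (a , c)) (samePair-refl (b , c)))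

    ends-edge : ∀ k (i j : Fin n) → ends (edge k i j) ≡ (i , j)
    ends-edge true i j = refl
    ends-edge false i j = refl

    -- With signs a, -a, c, d at the corners, the product of the three edge signs is (ac)(-ad)(cd) =
    -- -1. The number of negative edges is therefore odd: one or three.
    shape-signs : ∀ a c d {i j k l u v} →
      T (triangle (edge (same a c) i j) (edge (same (not a) d) k l) (edge (same c d) u v)) →
      T (shapeOK (edge (same a c) i j) (edge (same (not a) d) k l) (edge (same c d) u v))
    shape-signs true true true t = ∨-introˡ _ (∧-intro t tt)
    shape-signs true true false t = ∨-introˡ _ (∧-intro t tt)
    shape-signs true false true t = ∨-introˡ _ (∧-intro t tt)
    shape-signs true false false t = ∨-introˡ _ (∧-intro t tt)
    shape-signs false true true t = ∨-introˡ _ (∧-intro t tt)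
    shape-signs false true false t = ∨-introˡ _ (∧-intro t tt)
    shape-signs false false true t = ∨-introˡ _ (∧-intro t tt)
    shape-signs false false false t = ∨-introˡ _ (∧-intro t tt)

    shape-signs′ : ∀ a c d {i j k l u v} →
      T (triangle (edge (same a c) i j) (edge (same c d) u v) (edge (same (not a) d) k l)) →
      T (shapeOK (edge (same a c) i j) (edge (same c d) u v) (edge (same (not a) d) k l))
    shape-signs′ true true true t = ∨-introˡ _ (∧-intro t tt)
    shape-signs′ true true false t = ∨-introˡ _ (∧-intro t tt)
    shape-signs′ true false true t = ∨-introˡ _ (∧-intro t tt)
    shape-signs′ true false false t = ∨-introˡ _ (∧-intro t tt)
    shape-signs′ false true true t = ∨-introˡ _ (∧-intro t tt)
    shape-signs′ false true false t = ∨-introˡ _ (∧-intro t tt)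
    shape-signs′ false false true t = ∨-introˡ _ (∧-intro t tt)
    shape-signs′ false false false t = ∨-introˡ _ (∧-intro t tt)

    tag : ∀ {a b c p} → Side a b c p → Fin 3
    tag ab = zero
    tag ac = suc zero
    tag bc = suc (suc zero)

    sides-≢ : ∀ {a b c p q} → b Fin.< a → c Fin.< b → (S : Side a b c p) (S′ : Side a b c q) → tag S ≢ tag S′ → p ≢ q
    sides-≢ b<a c<b ab ab ne e = ne refl
    sides-≢ b<a c<b ab ac ne e = FinP.<-irrefl (sym (cong proj₂ e)) c<b
    sides-≢ b<a c<b ab bc ne e = FinP.<-irrefl (sym (cong proj₁ e)) b<a
    sides-≢ b<a c<b ac ab ne e = FinP.<-irrefl (cong proj₂ e) c<b
    sides-≢ b<a c<b ac ac ne e = ne refl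
    sides-≢ b<a c<b ac bc ne e = FinP.<-irrefl (sym (cong proj₁ e)) b<a
    sides-≢ b<a c<b bc ab ne e = FinP.<-irrefl (cong proj₁ e) b<a
    sides-≢ b<a c<b bc ac ne e = FinP.<-irrefl (cong proj₁ e) b<a
    sides-≢ b<a c<b bc bc ne e = ne refl

    triangles : ∀ x y z {p q s : Fin n × Fin n} {a b c} → b Fin.< a → c Fin.< b →
      (S₁ : Side a b c p) (S₂ : Side a b c q) (S₃ : Side a b c s) → tag S₁ ≢ tag S₂ → tag S₁ ≢ tag S₃ → tag S₂ ≢ tag S₃ →
      T (triangle (edge x (proj₁ p) (proj₂ p)) (edge y (proj₁ q) (proj₂ q)) (edge z (proj₁ s) (proj₂ s)))
    triangles x y z {p} {q} {s} lt lt′ S₁ S₂ S₃ n₁ n₂ n₃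
      = triangle-intro e₁ e₂ e₃ lt lt′ (subst (Side _ _ _) (sym E₁) S₁) (subst (Side _ _ _) (sym E₂) S₂) (subst (Side _ _ _) (sym E₃) S₃)
          (λ e → sides-≢ lt lt′ S₁ S₂ n₁ (trans (sym E₁) (trans e E₂)))
          (λ e → sides-≢ lt lt′ S₁ S₃ n₂ (trans (sym E₁) (trans e E₃)))
          (λ e → sides-≢ lt lt′ S₂ S₃ n₃ (trans (sym E₂) (trans e E₃)))
      where
      e₁ = edge x (proj₁ p) (proj₂ p)
      e₂ = edge y (proj₁ q) (proj₂ q)
      e₃ = edge z (proj₁ s) (proj₂ s)
      E₁ = ends-edge x (proj₁ p) (proj₂ p)
      E₂ = ends-edge y (proj₁ q) (proj₂ q)
      E₃ = ends-edge z (proj₁ s) (proj₂ s)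

    half-shape : ∀ k {i j} {p : Fin n × Fin n} → i ≢ j → (p ≡ (i , j) ⊎ p ≡ (j , i)) →
      T (halfShape (edge k (proj₁ p) (proj₂ p)) (half i) (half j))
    half-shape k {i} {j} {p} ne e = ∧-intro (np k) (∧-intro (=F-≢ ne) (side k e))
      where
      np : ∀ k → T (negOrPos (edge k (proj₁ p) (proj₂ p)))
      np true = tt
      np false = tt
      side : ∀ k → (p ≡ (i , j) ⊎ p ≡ (j , i)) →
        T (samePair (ends (edge k (proj₁ p) (proj₂ p))) (i , j) ∨ samePair (ends (edge k (proj₁ p) (proj₂ p))) (j , i))
      side true (inj₁ refl) = ∨-introˡ _ (samePair-refl p)
      side true (inj₂ refl) = ∨-introʳ (samePair (j , i) (i , j)) (samePair-refl p)
      side false (inj₁ refl) = ∨-introˡ _ (samePair-refl p)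
      side false (inj₂ refl) = ∨-introʳ (samePair (j , i) (i , j)) (samePair-refl p)

    shape-ehh : ∀ k {u v i j : Fin n} → T (halfShape (edge k u v) (half i) (half j)) → T (shapeOK (edge k u v) (half i) (half j))
    shape-ehh true t = ∨-introˡ _ t
    shape-ehh false t = ∨-introˡ _ t

    shape-heh : ∀ k {u v i j : Fin n} → T (halfShape (edge k u v) (half i) (half j)) → T (shapeOK (half i) (edge k u v) (half j))
    shape-heh true t = ∨-introˡ _ t
    shape-heh false t = ∨-introˡ _ t

    shape-hhe : ∀ k {u v i j : Fin n} → T (halfShape (edge k u v) (half i) (half j)) → T (shapeOK (half i) (half j) (edge k u v))
    shape-hhe true t = t
    shape-hhe false t = t

    -- Two orders are needed because the third game, found as the sum of the other two, may occupy
    -- the last or the middle position of the triple.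
    Shapes : Edge n → Edge n → Edge n → Set
    Shapes e f g = T (shapeOK e f g) × T (shapeOK e g f)

    -- Three literals with different indices span a triangle; six of the eight up and down patterns
    -- are the orders of i, j, k, and the other two are cyclic. If one literal is `none`, the edges
    -- are two half edges and the edge between their vertices.
    shape : ∀ {b₁ b₂ b₃ e₁ e₂ e₃ a i q s} → Joins b₁ e₁ (lit a i) q → Joins b₂ e₂ (lit (not a) i) s → Joins b₃ e₃ q s →
      Shapes e₁ e₂ e₃
    shape (down a c j<i) (down _ d k<i) (down _ _ k<j) =
      shape-signs a c d (triangles (same a c) (same (not a) d) (same c d) j<i k<j ab ac bc (λ ()) (λ ()) (λ ())) ,
      shape-signs′ a c d (triangles (same a c) (same c d) (same (not a) d) j<i k<j ab bc ac (λ ()) (λ ()) (λ ()))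
    shape (down a c j<i) (down _ d k<i) (up _ _ j<k) =
      shape-signs a c d (triangles (same a c) (same (not a) d) (same c d) k<i j<k ac ab bc (λ ()) (λ ()) (λ ())) ,
      shape-signs′ a c d (triangles (same a c) (same c d) (same (not a) d) k<i j<k ac bc ab (λ ()) (λ ()) (λ ()))
    shape (down a c j<i) (up d _ i<k) (down _ _ k<j) = ⊥-elim (FinP.<-asym j<i (FinP.<-trans i<k k<j))
    shape (down a c j<i) (up d _ i<k) (up _ _ j<k) =
      shape-signs a c d (triangles (same a c) (same (not a) d) (same c d) i<k j<i bc ab ac (λ ()) (λ ()) (λ ())) ,
      shape-signs′ a c d (triangles (same a c) (same c d) (same (not a) d) i<k j<i bc ac ab (λ ()) (λ ()) (λ ()))
    shape (up c a i<j) (down _ d k<i) (down _ _ k<j) =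
      shape-signs a c d (triangles (same a c) (same (not a) d) (same c d) i<j k<i ab bc ac (λ ()) (λ ()) (λ ())) ,
      shape-signs′ a c d (triangles (same a c) (same c d) (same (not a) d) i<j k<i ab ac bc (λ ()) (λ ()) (λ ()))
    shape (up c a i<j) (down _ d k<i) (up _ _ j<k) = ⊥-elim (FinP.<-asym i<j (FinP.<-trans j<k k<i))
    shape (up c a i<j) (up d _ i<k) (down _ _ k<j) =
      shape-signs a c d (triangles (same a c) (same (not a) d) (same c d) k<j i<k ac bc ab (λ ()) (λ ()) (λ ())) ,
      shape-signs′ a c d (triangles (same a c) (same c d) (same (not a) d) k<j i<k ac ab bc (λ ()) (λ ()) (λ ()))
    shape (up c a i<j) (up d _ i<k) (up _ _ j<k) =
      shape-signs a c d (triangles (same a c) (same (not a) d) (same c d) j<k i<j bc ac ab (λ ()) (λ ()) (λ ())) ,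
      shape-signs′ a c d (triangles (same a c) (same c d) (same (not a) d) j<k i<j bc ab ac (λ ()) (λ ()) (λ ()))
    shape (down {i} {j} a c j<i) (out _) (out _) =
      shape-ehh (same a c) (half-shape (same a c) (≢-sym (FinP.<⇒≢ j<i)) (inj₁ refl)) ,
      shape-ehh (same a c) (half-shape (same a c) (FinP.<⇒≢ j<i) (inj₂ refl))
    shape (up c a i<j) (out _) (out _) =
      shape-ehh (same a c) (half-shape (same a c) (FinP.<⇒≢ i<j) (inj₂ refl)) ,
      shape-ehh (same a c) (half-shape (same a c) (≢-sym (FinP.<⇒≢ i<j)) (inj₁ refl))
    shape (out a) (down _ d k<i) (in′ _) =
      shape-heh (same (not a) d) (half-shape (same (not a) d) (≢-sym (FinP.<⇒≢ k<i)) (inj₁ refl)) ,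
      shape-hhe (same (not a) d) (half-shape (same (not a) d) (≢-sym (FinP.<⇒≢ k<i)) (inj₁ refl))
    shape (out a) (up d _ i<k) (in′ _) =
      shape-heh (same (not a) d) (half-shape (same (not a) d) (FinP.<⇒≢ i<k) (inj₂ refl)) ,
      shape-hhe (same (not a) d) (half-shape (same (not a) d) (FinP.<⇒≢ i<k) (inj₂ refl))

    Closed : Typ → Bool → Edge n → Bool → Edge n → Set
    Closed Φ a e b f = ∃[ c ] ∃[ g ] (Valid Φ g × (∀ k → signed c g k ≡ signed a e k + signed b f k) × Shapes e f g)

    -- The roots are p + q and - p + s, with sum q + s. If s = - q, the two games coincide; if s = q
    -- is a literal, the inner product is -1 + 1 = 0. Otherwise q and s are joined by an edge.
    closed-at : ∀ {Φ a b e f c i p q s} → Joins a e p q → Joins b f (opp p) s → p ≡ lit c i → Allowed Φ q → Allowed Φ s → e ≢ f →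
      ip (pairV p q) (pairV (opp p) s) < 0ℤ → Closed Φ a e b f
    closed-at {c = c} {i} {q = q} {s} J K refl okq oks ne lt with relation q s
    ... | opposite refl = ⊥-elim (ne (joins-opp J K))
    ... | equal {d} {j} refl refl = ⊥-elim (<-irrefl (trans (ip-pair (lit c i) q (lit (not c) i) s) (cong₂ _+_
            (cong₂ _+_ (ip-opp c i) (ip-apart (lit c i) s (joins-apart J)))
            (cong₂ _+_ (ip-apart q (lit (not c) i) (≢-sym (joins-apart J))) (ip-self d j)))) lt)
    ... | apart ap with join q s ap okq oks
    ... | b₃ , g , vg , L = b₃ , g , vg , sums , shape J K L
      where
      sums : ∀ k → _
      sums k = trans (joins-vec L k) (trans (cancel c) (sym (cong₂ _+_ (joins-vec J k) (joins-vec K k))))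
        where
        cancel : ∀ c → vecL q k + vecL s k ≡ (vecL (lit c i) k + vecL q k) + (vecL (lit (not c) i) k + vecL s k)
        cancel true = solve 3 (λ d q s → q :+ s := (d :+ q) :+ (:- d :+ s)) refl (δ i k) (vecL q k) (vecL s k)
        cancel false = solve 3 (λ d q s → q :+ s := (:- d :+ q) :+ (d :+ s)) refl (δ i k) (vecL q k) (vecL s k)

    -- The inner product expands into four products of literals, one of which is negative and so
    -- belongs to opposite literals. These are brought to the front of both roots.
    closed : ∀ {Φ} a e b f → Valid Φ e → Valid Φ f → e ≢ f → ip (signed a e) (signed b f) < 0ℤ → Closed Φ a e b f
    closed {Φ} a e b f ve vf ne lt
      with p , q , J , okp , okq ← valid-joins {Φ} e a ve
      with r , s , K , okr , oks ← valid-joins {Φ} f b vf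
      with sum-neg⇒some-neg (subst (_< 0ℤ) (trans (ip-cong (joins-vec J) (joins-vec K)) (ip-pair p q r s)) lt)
    ... | inj₁ h with sum-neg⇒some-neg {ip (vecL p) (vecL r)} h
    ... | inj₁ pr with c , i , refl , refl ← neg-lits p r pr = closed-at J K refl okq oks ne (subst (_< 0ℤ) (ip-cong (joins-vec J) (joins-vec K)) lt)
    ... | inj₂ ps with c , i , refl , refl ← neg-lits p s ps =
      closed-at J (joins-sym K) refl okq okr ne (subst (_< 0ℤ) (ip-cong (joins-vec J) (joins-vec (joins-sym K))) lt)
    closed {Φ} a e b f ve vf ne lt | inj₂ h with sum-neg⇒some-neg {ip (vecL q) (vecL r)} h
    ... | inj₁ qr with c , i , refl , refl ← neg-lits q r qr =
      closed-at (joins-sym J) K refl okp oks ne (subst (_< 0ℤ) (ip-cong (joins-vec (joins-sym J)) (joins-vec K)) lt)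
    ... | inj₂ qs with c , i , refl , refl ← neg-lits q s qs =
      closed-at (joins-sym J) (joins-sym K) refl okp okr ne (subst (_< 0ℤ) (ip-cong (joins-vec (joins-sym J)) (joins-vec (joins-sym K))) lt)

    vecE-norm : ∀ {Φ} e → Valid Φ e → Norm (ip (vecE e) (vecE e))
    vecE-norm {Φ} e ve with p , q , J , _ ← valid-joins {Φ} e true ve =
      subst Norm (sym (ip-cong (joins-vec J) (joins-vec J))) (joins-norm J)

-- Enumeration of games, tournaments and triples.

module EdgeLists where

  open import Defs
  open SignedEdges using (Valid)
  open import Data.Fin using (combine)
  open import Data.List using (concatMap; map)
  open import Data.List.Membership.Propositional using (find; lose)
  open import Data.List.Membership.Propositional.Properties
  import Data.List.Relation.Unary.All.Properties as AllP
  import Data.List.Relation.Unary.AllPairs.Properties as AllPairsP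
  import Data.List.Relation.Unary.Unique.Propositional.Properties as UniqueP
  open import Data.Vec using (fromList)

  module _ {A : Set} where

    at-∈ : ∀ (xs : List A) k → lookup (fromList xs) k ∈ xs
    at-∈ (x ∷ xs) zero = here refl
    at-∈ (x ∷ xs) (suc k) = there (at-∈ xs k)

    ∈-at : ∀ {xs : List A} {x} → x ∈ xs → ∃[ k ] lookup (fromList xs) k ≡ x
    ∈-at (here refl) = zero , refl
    ∈-at (there x∈) = let k , e = ∈-at x∈ in suc k , e

    at-injective : ∀ {xs : List A} → Unique xs → ∀ {k l} → lookup (fromList xs) k ≡ lookup (fromList xs) l → k ≡ l
    at-injective (_ ∷ _) {zero} {zero} _ = refl
    at-injective {_ ∷ xs} (x∉ ∷ _) {zero} {suc l} e = ⊥-elim (All.lookup x∉ (at-∈ xs l) e)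
    at-injective {_ ∷ xs} (x∉ ∷ _) {suc k} {zero} e = ⊥-elim (All.lookup x∉ (at-∈ xs k) (sym e))
    at-injective (_ ∷ u) {suc k} {suc l} e = cong suc (at-injective u e)

  concatMap-unique : ∀ {A B : Set} (f : A → List B) {xs} → Unique xs → (∀ x → Unique (f x)) →
    (∀ {x y z} → z ∈ f x → z ∈ f y → x ≡ y) → Unique (concatMap f xs)
  concatMap-unique f u uf disj = UniqueP.concat⁺ (AllP.map⁺ (All.universal uf _))
    (AllPairsP.map⁺ (AllPairs.map (λ x≢y {z} → λ (z∈ , z∈′) → x≢y (disj z∈ z∈′)) u))

  module _ {n : ℕ} where

    pairs-unique : Unique (pairs n)
    pairs-unique = concatMap-unique _ (UniqueP.allFin⁺ n)
      (λ i → UniqueP.map⁺ (cong proj₂) (UniqueP.filter⁺ (λ j → toℕ j ℕ.<? toℕ i) (UniqueP.allFin⁺ n)))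
      (λ z∈ z∈′ → let _ , _ , e = ∈-map⁻ _ z∈ ; _ , _ , e′ = ∈-map⁻ _ z∈′ in trans (sym (cong proj₁ e)) (cong proj₁ e′))

    ∈-pairs⁺ : ∀ {i j : Fin n} → j Fin.< i → (i , j) ∈ pairs n
    ∈-pairs⁺ {i} {j} lt = ∈-concatMap⁺ _ (lose (∈-allFin i) (∈-map⁺ (i ,_) (∈-filter⁺ (λ j → toℕ j ℕ.<? toℕ i) (∈-allFin j) lt)))

    ∈-pairs⁻ : ∀ {i j : Fin n} → (i , j) ∈ pairs n → j Fin.< i
    ∈-pairs⁻ p with k , _ , q ← find (∈-concatMap⁻ _ {xs = allFin n} p) with l , l∈ , refl ← ∈-map⁻ (k ,_) q =
      proj₂ (∈-filter⁻ (λ j → toℕ j ℕ.<? toℕ k) {xs = allFin n} l∈)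

    edgesD-unique : Unique (edgesD n)
    edgesD-unique = concatMap-unique _ pairs-unique (λ { (i , j) → ((λ ()) ∷ []) ∷ [] ∷ [] })
      λ { {i , j} {k , l} (here refl) (here refl) → refl
        ; {i , j} {k , l} (here refl) (there (here ()))
        ; {i , j} {k , l} (there (here refl)) (here ())
        ; {i , j} {k , l} (there (here refl)) (there (here refl)) → refl }

    ∈-edgesD-neg : ∀ {i j : Fin n} → j Fin.< i → neg i j ∈ edgesD n
    ∈-edgesD-neg lt = ∈-concatMap⁺ _ (lose (∈-pairs⁺ lt) (here refl))

    ∈-edgesD-pos : ∀ {i j : Fin n} → j Fin.< i → pos i j ∈ edgesD n
    ∈-edgesD-pos lt = ∈-concatMap⁺ _ (lose (∈-pairs⁺ lt) (there (here refl)))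

    edgesD-valid : ∀ {Φ e} → e ∈ edgesD n → Valid Φ e
    edgesD-valid e∈ with find (∈-concatMap⁻ _ {xs = pairs n} e∈)
    ... | (i , j) , p , here refl = ∈-pairs⁻ p
    ... | (i , j) , p , there (here refl) = ∈-pairs⁻ p

    half∉edgesD : ∀ {i} → ¬ half i ∈ edgesD n
    half∉edgesD {i} h with () ← edgesD-valid {D} h

    edges-unique : ∀ Φ → Unique (edges Φ n)
    edges-unique D = edgesD-unique
    edges-unique B = UniqueP.++⁺ edgesD-unique (UniqueP.map⁺ (λ { refl → refl }) (UniqueP.allFin⁺ n))
      λ (z∈ , z∈′) → let _ , _ , e = ∈-map⁻ half z∈′ in half∉edgesD (subst (_∈ edgesD n) e z∈)

    edges-valid : ∀ Φ {e} → e ∈ edges Φ n → Valid Φ e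
    edges-valid D e∈ = edgesD-valid {D} e∈
    edges-valid B e∈ with ∈-++⁻ (edgesD n) e∈
    ... | inj₁ p = edgesD-valid {B} p
    ... | inj₂ q with _ , _ , refl ← ∈-map⁻ half q = refl

    valid-∈ : ∀ Φ {e} → Valid Φ e → e ∈ edges Φ n
    valid-∈ D {neg i j} lt = ∈-edgesD-neg lt
    valid-∈ D {pos i j} lt = ∈-edgesD-pos lt
    valid-∈ B {neg i j} lt = ∈-++⁺ˡ (∈-edgesD-neg lt)
    valid-∈ B {pos i j} lt = ∈-++⁺ˡ (∈-edgesD-pos lt)
    valid-∈ B {half i} _ = ∈-++⁺ʳ (edgesD n) (∈-map⁺ half (∈-allFin i))

    -- Negative edges fill one side of the diagonal of an n × n square, positive edges the other
    -- side and half edges the diagonal, whence at most n² games.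
    code : Edge n → Fin (n ℕ.* n)
    code (neg i j) = combine i j
    code (pos i j) = combine j i
    code (half i) = combine i i

    code-injective : ∀ {Φ e f} → Valid Φ e → Valid Φ f → code e ≡ code f → e ≡ f
    code-injective {e = neg i j} {neg k l} p q eq with refl , refl ← FinP.combine-injective i j k l eq = refl
    code-injective {e = neg i j} {pos k l} p q eq with refl , refl ← FinP.combine-injective i j l k eq = ⊥-elim (FinP.<-asym p q)
    code-injective {e = neg i j} {half k} p q eq with refl , refl ← FinP.combine-injective i j k k eq = ⊥-elim (FinP.<-irrefl refl p)
    code-injective {e = pos i j} {neg k l} p q eq with refl , refl ← FinP.combine-injective j i k l eq = ⊥-elim (FinP.<-asym p q)
    code-injective {e = pos i j} {pos k l} p q eq with refl , refl ← FinP.combine-injective j i l k eq = refl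
    code-injective {e = pos i j} {half k} p q eq with refl , refl ← FinP.combine-injective j i k k eq = ⊥-elim (FinP.<-irrefl refl p)
    code-injective {e = half i} {neg k l} p q eq with refl , refl ← FinP.combine-injective i i k l eq = ⊥-elim (FinP.<-irrefl refl q)
    code-injective {e = half i} {pos k l} p q eq with refl , refl ← FinP.combine-injective i i l k eq = ⊥-elim (FinP.<-irrefl refl q)
    code-injective {e = half i} {half k} p q eq with refl , _ ← FinP.combine-injective i i k k eq = refl

    edgeAt-valid : ∀ Φ k → Valid Φ (edgeAt Φ n k)
    edgeAt-valid Φ k = edges-valid Φ (at-∈ (edges Φ n) k)

    edgeAt-injective : ∀ Φ {k l} → edgeAt Φ n k ≡ edgeAt Φ n l → k ≡ l
    edgeAt-injective Φ = at-injective (edges-unique Φ)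

    games≤n*n : ∀ Φ → games Φ n ℕ.≤ n ℕ.* n
    games≤n*n Φ = FinP.injective⇒≤ {f = code ∘ edgeAt Φ n}
      (λ {k} {l} e → edgeAt-injective Φ (code-injective {Φ} (edgeAt-valid Φ k) (edgeAt-valid Φ l) e))

  ∈-allVecs : ∀ {m} (x : Vec Bool m) → x ∈ allVecs m
  ∈-allVecs Vec.[] = here refl
  ∈-allVecs (false Vec.∷ x) = ∈-concatMap⁺ _ (lose (∈-allVecs x) (here refl))
  ∈-allVecs (true Vec.∷ x) = ∈-concatMap⁺ _ (lose (∈-allVecs x) (there (here refl)))

  allVecs-unique : ∀ m → Unique (allVecs m)
  allVecs-unique zero = [] ∷ []
  allVecs-unique (suc m) = concatMap-unique _ (allVecs-unique m) (λ x → ((λ ()) ∷ []) ∷ [] ∷ [])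
    λ { (here refl) (here refl) → refl ; (here refl) (there (here ())) ; (there (here refl)) (here ())
      ; (there (here refl)) (there (here refl)) → refl }

  ∈-triples⁺ : ∀ {m} {a b c : Fin m} → a Fin.< b → b Fin.< c → (a , b , c) ∈ triples m
  ∈-triples⁺ {m} {a} {b} {c} a<b b<c = ∈-concatMap⁺ _ (lose (∈-allFin a)
    (∈-concatMap⁺ _ (lose (∈-filter⁺ (λ b → toℕ a ℕ.<? toℕ b) (∈-allFin b) a<b)
      (∈-map⁺ (λ c → a , b , c) (∈-filter⁺ (λ c → toℕ b ℕ.<? toℕ c) (∈-allFin c) b<c)))))

-- The interchange graph: adjacency, degree and mixing time.

module Interchange where

  open import Defs
  open Chains
  open InnerProducts
  open Flips
  open SignedEdges using (vecE; signed; closed; vecE-norm; ∧-intro; Shapes)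
  open EdgeLists
  open import Data.Nat.Induction using (Acc; acc)
  open import Data.Nat.Logarithm using (⌈log₂_⌉)
  open import Data.Nat.Logarithm.Core using (⌈log2⌉)
  open import Data.Integer using (0ℤ; 1ℤ)
  import Data.Integer.Properties as ℤP
  open import Data.Rational
  open import Data.Rational.Properties
  open import Data.Rational.Solver
  open import Data.List using (foldr; map)
  open import Data.List.Membership.Propositional using (lose)
  open import Data.List.Membership.Propositional.Properties
  import Data.List.Relation.Unary.Any.Properties as AnyP
  import Data.List.Relation.Unary.Unique.Propositional.Properties as UniqueP
  open import Relation.Nullary.Decidable using (isYes≗does; toWitness; fromWitness)
  open import Relation.Binary using (Tri; tri<; tri≈; tri>)

  open +-*-Solver using (solve; _:+_; _:*_; :-_; _:-_; _:=_; con)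

  n≤2^⌈log₂n⌉ : ∀ n → n ℕ.≤ 2 ℕ.^ ⌈log₂ n ⌉
  n≤2^⌈log₂n⌉ n = go n _
    where
    go : ∀ n (a : Acc ℕ._<_ n) → n ℕ.≤ 2 ℕ.^ ⌈log2⌉ n a
    go 0 _ = ℕ.z≤n
    go 1 _ = ℕ.s≤s ℕ.z≤n
    go (suc (suc n)) (acc rs) = begin
      2 ℕ.+ n ≡⟨ cong (2 ℕ.+_) (sym (ℕP.⌊n/2⌋+⌈n/2⌉≡n n)) ⟩
      2 ℕ.+ (ℕ.⌊ n /2⌋ ℕ.+ h) ≤⟨ ℕP.+-monoʳ-≤ 2 (ℕP.+-monoˡ-≤ h (ℕP.⌊n/2⌋≤⌈n/2⌉ n)) ⟩
      2 ℕ.+ (h ℕ.+ h) ≡⟨ cong suc (sym (ℕP.+-suc h h)) ⟩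
      suc h ℕ.+ suc h ≤⟨ ℕP.+-mono-≤ ih ih ⟩
      p ℕ.+ p ≡⟨ cong (p ℕ.+_) (sym (ℕP.+-identityʳ p)) ⟩
      2 ℕ.^ ⌈log2⌉ (suc (suc n)) (acc rs) ∎
      where
      open ℕP.≤-Reasoning
      h = ℕ.⌈ n /2⌉
      p = 2 ℕ.^ ⌈log2⌉ (suc h) (rs (ℕP.⌈n/2⌉<n n))
      ih : suc h ℕ.≤ p
      ih = go (suc h) (rs (ℕP.⌈n/2⌉<n n))

  nat-2^ : ∀ k → nat (2 ℕ.^ k) * pow ½ k ≡ 1ℚ
  nat-2^ zero = refl
  nat-2^ (suc k) = begin
    nat (2^k ℕ.+ (2^k ℕ.+ 0)) * (½ * pow ½ k) ≡⟨ cong (λ a → nat (2^k ℕ.+ a) * (½ * pow ½ k)) (ℕP.+-identityʳ 2^k) ⟩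
    nat (2^k ℕ.+ 2^k) * (½ * pow ½ k) ≡⟨ cong (_* (½ * pow ½ k)) (ι-+ (ℤ.+ 2^k) (ℤ.+ 2^k)) ⟩
    (nat 2^k + nat 2^k) * (½ * pow ½ k) ≡⟨ solve 2 (λ a p → (a :+ a) :* (con ½ :* p) := a :* p) refl (nat 2^k) (pow ½ k) ⟩
    nat 2^k * pow ½ k ≡⟨ nat-2^ k ⟩
    1ℚ ∎
    where
    open ≡-Reasoning
    2^k = 2 ℕ.^ k

  pow-½-≤1 : ∀ k → pow ½ k ≤ 1ℚ
  pow-½-≤1 zero = ≤-refl
  pow-½-≤1 (suc k) = ≤-trans (*-monoˡ (≤ᵇ⇒≤ {0ℚ} {½} _) (pow-½-≤1 k)) (≤ᵇ⇒≤ {½ * 1ℚ} {1ℚ} _)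

  final-bound : ∀ d ℓ {m} → m ℕ.≤ 2 ℕ.^ (suc ℓ ℕ.+ suc ℓ) →
    nat m * pow (κ (suc d)) (4 ℕ.* suc d ℕ.* suc ℓ) ≤ ¼
  final-bound d ℓ {m} le = begin
    nat m * pow k (4 ℕ.* suc d ℕ.* L) ≡⟨ cong (λ t → nat m * pow k t) (trans (ℕP.*-assoc 4 (suc d) L)
          (trans (cong (4 ℕ.*_) (ℕP.*-comm (suc d) L)) (sym (ℕP.*-assoc 4 L (suc d))))) ⟩
    nat m * pow k (4 ℕ.* L ℕ.* suc d) ≡⟨ cong (nat m *_) (pow-* k (suc d) (4 ℕ.* L)) ⟩
    nat m * pow (pow k (suc d)) (4 ℕ.* L)
      ≤⟨ *-monoˡ (nat-nonNeg m) (pow-mono (pow-nonNeg (κ-nonNeg d) (suc d)) (κ-halves d) (4 ℕ.* L)) ⟩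
    nat m * pow ½ (4 ℕ.* L) ≡⟨ cong (λ t → nat m * pow ½ t) (trans (cong (λ a → L ℕ.+ (L ℕ.+ (L ℕ.+ a))) (ℕP.+-identityʳ L)) (sym (ℕP.+-assoc L L (L ℕ.+ L)))) ⟩
    nat m * pow ½ ((L ℕ.+ L) ℕ.+ (L ℕ.+ L)) ≡⟨ cong (nat m *_) (pow-+ ½ (L ℕ.+ L) (L ℕ.+ L)) ⟩
    -- One factor A = 2^(-2L) cancels the bound 2^(2L) on m; the other one is the final estimate.
    nat m * (A * A) ≤⟨ *-mono (*-nonNeg 0≤A 0≤A) (nat-nonNeg (2 ℕ.^ (L ℕ.+ L))) (nat-mono le) ≤-refl ⟩
    nat (2 ℕ.^ (L ℕ.+ L)) * (A * A) ≡⟨ sym (*-assoc (nat (2 ℕ.^ (L ℕ.+ L))) A A) ⟩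
    (nat (2 ℕ.^ (L ℕ.+ L)) * A) * A ≡⟨ cong (_* A) (nat-2^ (L ℕ.+ L)) ⟩
    1ℚ * A ≡⟨ *-identityˡ A ⟩
    A ≡⟨ cong (λ t → ½ * pow ½ t) (ℕP.+-suc ℓ ℓ) ⟩
    ½ * (½ * pow ½ (ℓ ℕ.+ ℓ)) ≤⟨ *-monoˡ (≤ᵇ⇒≤ {0ℚ} {½} _) (*-monoˡ (≤ᵇ⇒≤ {0ℚ} {½} _) (pow-½-≤1 (ℓ ℕ.+ ℓ))) ⟩
    ½ * (½ * 1ℚ) ≤⟨ ≤ᵇ⇒≤ _ ⟩
    ¼ ∎
    where
    open ≤-Reasoning
    k = κ (suc d)
    L = suc ℓ
    A = pow ½ (L ℕ.+ L)
    0≤A : 0ℚ ≤ A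
    0≤A = pow-nonNeg (≤ᵇ⇒≤ {0ℚ} {½} _) (L ℕ.+ L)

  ι-δ : ∀ {n} (i k : Fin n) → lookup (unit i) k ≡ ι (SignedEdges.δ i k)
  ι-δ i k = trans (VecP.lookup∘tabulate _ k) (trans (cong (if_then 1ℚ else 0ℚ) (isYes≗does (toℕ k ℕ.≟ toℕ i))) (bool (toℕ k ℕ.≡ᵇ toℕ i)))
    where
    bool : ∀ b → (if b then 1ℚ else 0ℚ) ≡ ι (if b then 1ℤ else 0ℤ)
    bool true = refl
    bool false = refl

  ι-vecE : ∀ {n} (e : Edge n) k → lookup (vecOf e) k ≡ ι (vecE e k)
  ι-vecE (neg i j) k = trans (VecP.lookup-zipWith _-_ k (unit i) (unit j)) (trans (cong₂ _-_ (ι-δ i k) (ι-δ j k))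
    (sym (trans (ι-+ (SignedEdges.δ i k) (ℤ.- SignedEdges.δ j k)) (cong (ι (SignedEdges.δ i k) +_) (ι-neg (SignedEdges.δ j k))))))
  ι-vecE (pos i j) k = trans (VecP.lookup-zipWith _+_ k (unit i) (unit j)) (trans (cong₂ _+_ (ι-δ i k) (ι-δ j k))
    (sym (ι-+ (SignedEdges.δ i k) (SignedEdges.δ j k))))
  ι-vecE (half i) k = ι-δ i k

  -- Outcomes are ± 1/2, so each rational score is half of an integer sum of signed roots.
  ½ι : ℤ → ℚ
  ½ι z = ½ * ι z

  ½ι-+ : ∀ y z → ½ι (y ℤ.+ z) ≡ ½ι y + ½ι z
  ½ι-+ y z = trans (cong (½ *_) (ι-+ y z)) (*-distribˡ-+ ½ (ι y) (ι z))

  ½ι-injective : ∀ {y z} → ½ι y ≡ ½ι z → y ≡ z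
  ½ι-injective {y} {z} e = ι-injective (trans (sym (twice (ι y))) (trans (cong ((1ℚ + 1ℚ) *_) e) (twice (ι z))))
    where
    twice : ∀ q → (1ℚ + 1ℚ) * (½ * q) ≡ q
    twice = solve 1 (λ q → (con 1ℚ :+ con 1ℚ) :* (con ½ :* q) := q) refl

  vecℚ-ext : ∀ {n} {u w : Vecℚ n} → (∀ i → lookup u i ≡ lookup w i) → u ≡ w
  vecℚ-ext {u = u} {w} e = trans (sym (VecP.tabulate∘lookup u)) (trans (VecP.tabulate-cong e) (VecP.tabulate∘lookup w))

  module Game (Φ : Typ) (n : ℕ) where

    m : ℕ
    m = games Φ n

    v : Fin m → Fin n → ℤ
    v k = vecE (edgeAt Φ n k)

    open Roots v public

    root-signed : ∀ b k i → root b k i ≡ signed b (edgeAt Φ n k) i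
    root-signed true k i = refl
    root-signed false k i = refl

    closed-games : ∀ a b k l → k ≢ l → ip (root a k) (root b l) ℤ.< 0ℤ →
      ∃[ g ] ∃[ c ] ((∀ i → root c g i ≡ root a k i ℤ.+ root b l i) × Shapes (edgeAt Φ n k) (edgeAt Φ n l) (edgeAt Φ n g))
    closed-games a b k l k≢l lt
      with c , e , ve , sums , shapes ← closed {Φ = Φ} a (edgeAt Φ n k) b (edgeAt Φ n l) (edgeAt-valid Φ k) (edgeAt-valid Φ l)
             (k≢l ∘ edgeAt-injective Φ) (subst (ℤ._< 0ℤ) (ip-cong (root-signed a k) (root-signed b l)) lt)
      with g , refl ← ∈-at (valid-∈ Φ ve)
      = g , c , (λ i → trans (root-signed c g i) (trans (sums i) (sym (cong₂ ℤ._+_ (root-signed a k i) (root-signed b l i))))) , shapes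

    v-norm : ∀ k → Norm (ip (v k) (v k))
    v-norm k = vecE-norm {Φ = Φ} (edgeAt Φ n k) (edgeAt-valid Φ k)

    v-closed : ∀ a b k l → k ≢ l → ip (root a k) (root b l) ℤ.< 0ℤ →
      ∃[ g ] ∃[ c ] (∀ i → root c g i ≡ root a k i ℤ.+ root b l i)
    v-closed a b k l ne lt = let g , c , e , _ = closed-games a b k l ne lt in g , c , e

    open System v-norm v-closed public

    lookup-contrib : ∀ x k i → lookup (contrib Φ n x k) i ≡ ½ι (r x k i)
    lookup-contrib x k i = trans (VecP.lookup-map i (outcome (lookup x k) *_) (vecOf (edgeAt Φ n k)))
      (trans (cong (outcome (lookup x k) *_) (ι-vecE (edgeAt Φ n k) i)) (sign (lookup x k)))
      where
      sign : ∀ b → outcome b * ι (v k i) ≡ ½ι (root b k i)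
      sign true = refl
      sign false = trans (solve 1 (λ q → (:- con ½) :* q := con ½ :* (:- q)) refl (ι (v k i))) (cong (½ *_) (sym (ι-neg (v k i))))

    lookup-score : ∀ x i → lookup (score Φ n x) i ≡ ½ι (total x i)
    lookup-score x i = go (allFin m)
      where
      go : ∀ ks → lookup (foldr _⊕_ zeroV (map (contrib Φ n x) ks)) i ≡ ½ι (lsum (λ k → r x k i) ks)
      go [] = VecP.lookup-replicate i 0ℚ
      go (k ∷ ks) = trans (VecP.lookup-zipWith _+_ i (contrib Φ n x k) _)
        (trans (cong₂ _+_ (lookup-contrib x k i) (go ks)) (sym (½ι-+ (r x k i) (lsum (λ k → r x k i) ks))))

    score⇒total : ∀ {x y} → score Φ n x ≡ score Φ n y → ∀ i → total x i ≡ total y i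
    score⇒total {x} {y} e i = ½ι-injective (trans (sym (lookup-score x i)) (trans (cong (λ s → lookup s i) e) (lookup-score y i)))

    total⇒score : ∀ {x y} → (∀ i → total x i ≡ total y i) → score Φ n x ≡ score Φ n y
    total⇒score {x} {y} e = vecℚ-ext λ i → trans (lookup-score x i) (trans (cong ½ι (e i)) (sym (lookup-score y i)))

    lookup-triple : ∀ x a b c i → lookup (contrib Φ n x a ⊕ (contrib Φ n x b ⊕ contrib Φ n x c)) i ≡
      ½ι (r x a i ℤ.+ (r x b i ℤ.+ r x c i))
    lookup-triple x a b c i = begin
      lookup (ca ⊕ (cb ⊕ cc)) i ≡⟨ trans (VecP.lookup-zipWith _+_ i ca _) (cong (lookup ca i +_) (VecP.lookup-zipWith _+_ i cb cc)) ⟩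
      lookup ca i + (lookup cb i + lookup cc i) ≡⟨ cong₂ _+_ (lookup-contrib x a i) (cong₂ _+_ (lookup-contrib x b i) (lookup-contrib x c i)) ⟩
      ½ι (r x a i) + (½ι (r x b i) + ½ι (r x c i)) ≡⟨ cong (½ι (r x a i) +_) (sym (½ι-+ (r x b i) (r x c i))) ⟩
      ½ι (r x a i) + ½ι (r x b i ℤ.+ r x c i) ≡⟨ sym (½ι-+ (r x a i) _) ⟩
      ½ι (r x a i ℤ.+ (r x b i ℤ.+ r x c i)) ∎
      where
      open ≡-Reasoning
      ca = contrib Φ n x a
      cb = contrib Φ n x b
      cc = contrib Φ n x c

    neutral⇒Neutral : ∀ x a b c → T (neutral Φ n x (a , b , c)) → Neutral x a b c
    neutral⇒Neutral x a b c t = neutral₃ $ zero3 λ i → ½ι-injective (trans (sym (lookup-triple x a b c i))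
      (trans (cong (λ s → lookup s i) (toWitness t)) (VecP.lookup-replicate i 0ℚ)))

    Neutral⇒neutral : ∀ x a b c → Neutral x a b c → T (neutral Φ n x (a , b , c))
    Neutral⇒neutral x a b c N = fromWitness (vecℚ-ext λ i → trans (lookup-triple x a b c i)
      (trans (cong ½ι (Neutral.cancels N i)) (sym (VecP.lookup-replicate i 0ℚ))))

    -- The roots of a and b add up to minus the root of c, and by `root-inj` a game is determined by
    -- either of its signed roots.
    Neutral⇒third : ∀ {x a b c} → Neutral x a b c → ∀ {g s} → (∀ i → root s g i ≡ r x a i ℤ.+ r x b i) → g ≡ c
    Neutral⇒third {x} {a} {b} {c} N {g} {s} sums = root-inj (not s) (lookup x c) g c λ i → trans (root-not s g i)
      (trans (cong ℤ.-_ (sums i)) (sym (ℤP.i-j≡0⇒i≡j (r x c i) _ (trans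
        (cong (λ z → r x c i ℤ.+ z) (ℤP.neg-involutive _)) (trans (ℤP.+-comm (r x c i) _)
          (trans (ℤP.+-assoc (r x a i) (r x b i) (r x c i)) (Neutral.cancels N i)))))))

    -- The root of a has negative inner product with that of b or c. Closure then yields a game of
    -- the right shape whose root is the sum, and this game has to be the remaining one.
    Neutral⇒shapeOK : ∀ x {a b c} → Neutral x a b c → T (shapeOK (edgeAt Φ n a) (edgeAt Φ n b) (edgeAt Φ n c))
    Neutral⇒shapeOK x {a} {b} {c} N = split (Zero3⇒some-neg (Neutral.vanishing N) (r-norm x a))
      where
      E = edgeAt Φ n
      split : ip (r x a) (r x b) ℤ.< 0ℤ ⊎ ip (r x a) (r x c) ℤ.< 0ℤ → T (shapeOK (E a) (E b) (E c))
      split (inj₁ lt) = let g , s , sums , shapes = closed-games (lookup x a) (lookup x b) a b (neutral-≢ x N) lt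
        in subst (λ k → T (shapeOK (E a) (E b) (E k))) (Neutral⇒third N {g} {s} sums) (proj₁ shapes)
      split (inj₂ lt) = let g , s , sums , shapes = closed-games (lookup x a) (lookup x c) a c (neutral-≢ x (mirror N)) lt
        in subst (λ k → T (shapeOK (E a) (E k) (E c))) (Neutral⇒third (mirror N) {g} {s} sums) (proj₂ shapes)

    ∧-elim : ∀ {p q} → T (p ∧ q) → T p × T q
    ∧-elim {true} t = _ , t

    adj⇒Step : ∀ {x y} → T (adj Φ n x y) → Step x y
    adj⇒Step {x} {y} t = let (a , b , c) , ok = Any.satisfied (AnyP.any⁻ _ (triples m) t)
                             gen , same = ∧-elim {isGenCopy Φ n x (a , b , c)} ok
                         in step a b c (neutral⇒Neutral x a b c (proj₂ (∧-elim gen))) (toWitness same)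

    -- `triples` lists increasing positions only, so the neutral triple is first sorted by `turn`
    -- and `mirror`; the result of the flip does not depend on the order.
    Step⇒adj : ∀ {x y} → Step x y → T (adj Φ n x y)
    Step⇒adj {x} (step a b c N refl) = sort (FinP.<-cmp a b) (FinP.<-cmp b c) (FinP.<-cmp a c)
      where
      ordered : ∀ {a b c} → Neutral x a b c → a Fin.< b → b Fin.< c → T (adj Φ n x (flips x a b c))
      ordered {a} {b} {c} N a<b b<c = AnyP.any⁺ _ (lose (∈-triples⁺ a<b b<c)
        (∧-intro {x = isGenCopy Φ n x (a , b , c)} (∧-intro {x = shapeOK (edgeAt Φ n a) (edgeAt Φ n b) (edgeAt Φ n c)}
          (Neutral⇒shapeOK x N) (Neutral⇒neutral x a b c N)) (fromWitness refl)))
      open Distinct (neutral-distinct x N)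
      sort : Tri (a Fin.< b) (a ≡ b) (b Fin.< a) → Tri (b Fin.< c) (b ≡ c) (c Fin.< b) → Tri (a Fin.< c) (a ≡ c) (c Fin.< a) →
        T (adj Φ n x (flips x a b c))
      sort (tri≈ _ e _) _ _ = ⊥-elim (a≢b e)
      sort _ (tri≈ _ e _) _ = ⊥-elim (b≢c e)
      sort _ _ (tri≈ _ e _) = ⊥-elim (a≢c e)
      sort (tri< p _ _) (tri< q _ _) _ = ordered N p q
      sort (tri< p _ _) (tri> _ _ q) (tri< u _ _) = subst (T ∘ adj Φ n x) (flips-swap₂₃ x a c b) (ordered (mirror N) u q)
      sort (tri< p _ _) (tri> _ _ q) (tri> _ _ u) = subst (T ∘ adj Φ n x) (flips-rotate x c a b) (ordered (turn (turn N)) u p)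
      sort (tri> _ _ p) (tri< q _ _) (tri< u _ _) =
        subst (T ∘ adj Φ n x) (trans (flips-rotate x b a c) (flips-swap₂₃ x a c b)) (ordered (mirror (turn N)) p u)
      sort (tri> _ _ p) (tri< q _ _) (tri> _ _ u) = subst (T ∘ adj Φ n x) (sym (flips-rotate x a b c)) (ordered (turn N) q u)
      sort (tri> _ _ p) (tri> _ _ q) _ =
        subst (T ∘ adj Φ n x) (trans (flips-swap₂₃ x c b a) (flips-rotate x c a b)) (ordered (mirror (turn (turn N))) q p)

    module Fibre (T₀ : Tournament Φ n) where

      s : Vecℚ n
      s = score Φ n T₀

      V : List (Tournament Φ n)
      V = vertices Φ n s

      V-unique : Unique V
      V-unique = UniqueP.filter⁺ _ (allVecs-unique m)

      ∈V⁺ : ∀ {x} → score Φ n x ≡ s → x ∈ V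
      ∈V⁺ {x} e = ∈-filter⁺ _ (∈-allVecs x) (fromWitness e)

      ∈V⁻ : ∀ {x} → x ∈ V → score Φ n x ≡ s
      ∈V⁻ x∈ = toWitness (proj₂ (∈-filter⁻ _ {xs = allVecs m} x∈))

      step-∈V : ∀ {x y} → x ∈ V → Step x y → y ∈ V
      step-∈V {x} {y} x∈ st = ∈V⁺ (trans (total⇒score {y} {x} (total-step st)) (∈V⁻ x∈))

      path : ∀ {x y} → x ∈ V → y ∈ V → Path m x y
      path {x} {y} x∈ y∈ = connected m (ham≤ x y) (score⇒total {x} {y} (trans (∈V⁻ x∈) (sym (∈V⁻ y∈))))

      open LazyWalk V V-unique _=T_ (adj Φ n) (fromWitness refl) toWitness

      R : Tournament Φ n → Tournament Φ n → Set
      R y y′ = y ∈ V × y′ ∈ V × Step y y′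

      ∈nbrs⁺ : ∀ {x y} → x ∈ V → Step x y → y ∈ nbrs x
      ∈nbrs⁺ x∈ st = ∈-filter⁺ _ (step-∈V x∈ st) (Step⇒adj st)

      ∈nbrs⁻ : ∀ {x y} → y ∈ nbrs x → y ∈ V × Step x y
      ∈nbrs⁻ {x} y∈ = let y∈V , t = ∈-filter⁻ (λ y → T? (adj Φ n x y)) {xs = V} y∈ in y∈V , adj⇒Step t

      paired : ∀ {x x′ xs ys y} → x ∈ V → x′ ∈ V → Step x x′ → nbrs x ↭ x′ ∷ xs → nbrs x′ ↭ x ∷ ys → All (x′ ≢_) xs →
        y ∈ xs → ∃[ y′ ] (y′ ∈ ys × Partner x x′ y y′)
      paired {x} {x′} x∈ x′∈ st p q x′∉ y∈ =
        let y∈V , st′ = ∈nbrs⁻ (PermP.∈-resp-↭ (Perm.↭-sym p) (there y∈))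
            y′ , P = partner-exists st st′ (≢-sym (All.lookup x′∉ y∈))
        -- By symmetry y′ ≢ x, so y′ is among the neighbours of x′ that are left after x is removed.
        in y′ , Any.tail (partner-≢ (partner-sym P)) (PermP.∈-resp-↭ q (∈nbrs⁺ x′∈ (partner-step P))) , P

      -- Injectivity of `Partner` and existence from the side of x′ both come from `partner-sym`,
      -- with x and x′ exchanged.
      match : ∀ {x x′} → x ∈ V → x′ ∈ V → Step x x′ → Matched R x x′
      match {x} {x′} x∈ x′∈ st = let _ , p = ∈⇒↭ (∈nbrs⁺ x∈ st) ; _ , q = ∈⇒↭ (∈nbrs⁺ x′∈ (step-sym st))
                                 in build p q (Unique-resp-↭ p nbrs-unique) (Unique-resp-↭ q nbrs-unique)
        where
        nbrs-unique : ∀ {x} → Unique (nbrs x)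
        nbrs-unique {x} = UniqueP.filter⁺ (λ y → T? (adj Φ n x y)) V-unique
        close : ∀ {y y′} → Partner x x′ y y′ → R y y′
        close P = let st′ = partner-step (partner-sym P)
                  in step-∈V x∈ st′ , step-∈V x′∈ (partner-step P) , partner-close P
        build : ∀ {xs ys} → nbrs x ↭ x′ ∷ xs → nbrs x′ ↭ x ∷ ys → Unique (x′ ∷ xs) → Unique (x ∷ ys) → Matched R x x′
        build p q (x′∉ ∷ ux) (x∉ ∷ uy) =
          let _ , w , pw = matching {R = Partner x x′} partner-unique
                (λ P P′ → partner-unique (partner-sym P) (partner-sym P′)) ux uy
                (paired x∈ x′∈ st p q x′∉)
                (λ y′∈ → let y , y∈ , P = paired x′∈ x∈ (step-sym st) q p x∉ y′∈ in y , y∈ , partner-sym P)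
          in matched p (Perm.trans q (prep x w)) (Pointwise.map close pw)

      step-deg : ∀ {x y} → x ∈ V → Step x y → deg x ≡ deg y
      step-deg x∈ st = let M = match x∈ (step-∈V x∈ st) st
                       in trans (proj₁ (matched-deg M)) (sym (proj₂ (matched-deg M)))

      path-deg : ∀ {h x y} → x ∈ V → y ∈ V → Path h x y → deg x ≡ deg y
      path-deg x∈ y∈ stop = refl
      path-deg x∈ y∈ (left st p) = trans (step-deg x∈ st) (path-deg (step-∈V x∈ st) y∈ p)
      path-deg x∈ y∈ (right st p) = trans (path-deg x∈ (step-∈V y∈ st) p) (sym (step-deg y∈ st))

      d : ℕ
      d = degree Φ n s T₀

      deg≡d : ∀ {x} → x ∈ V → deg x ≡ d
      deg≡d x∈ = path-deg x∈ (∈V⁺ refl) (path x∈ (∈V⁺ refl))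

      Pt-zero : ∀ (f : Tournament Φ n → ℚ) {x} → x ∈ V → sumOver V (λ y → Pt Φ n s 0 x y * f y) ≡ f x
      Pt-zero f {x} x∈ = trans (sum-indicator (x =T_) 1ℚ f V-unique x∈ (fromWitness refl) toWitness) (*-identityˡ (f x))

      Pt-suc : ∀ t x y → Pt Φ n s (suc t) x y ≡ sumOver V (λ z → Pt Φ n s t x z * P Φ n s z y)
      Pt-suc t x y = refl

      open Contraction V (P Φ n s) (Pt Φ n s) Step Pt-zero Pt-suc

      diameter : ∀ {f K} → 0ℚ ≤ K → Lip f K → ∀ {x y} → x ∈ V → y ∈ V → f x ≤ f y + nat m * K
      diameter {f} {K} 0≤K lip x∈ y∈ = go x∈ y∈ (path x∈ y∈)
        where
        one-more : ∀ c h → (c + nat h * K) + K ≡ c + nat (suc h) * K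
        one-more c h = trans (solve 3 (λ c h K → (c :+ h :* K) :+ K := c :+ (con 1ℚ :+ h) :* K) refl c (nat h) K)
          (cong (λ z → c + z * K) (sym (nat-suc h)))
        go : ∀ {h x y} → x ∈ V → y ∈ V → Path h x y → f x ≤ f y + nat h * K
        go {h} {x} x∈ y∈ stop = subst (_≤ f x + nat h * K) (+-identityʳ (f x)) (+-monoʳ-≤ (f x) (*-nonNeg (nat-nonNeg h) 0≤K))
        go {suc h} {x} {y} x∈ y∈ (left {x₁ = x₁} st p) = begin
          f x ≤⟨ lip x∈ (step-∈V x∈ st) st ⟩
          f x₁ + K ≤⟨ +-monoˡ-≤ K (go (step-∈V x∈ st) y∈ p) ⟩
          (f y + nat h * K) + K ≡⟨ one-more (f y) h ⟩
          f y + nat (suc h) * K ∎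
          where open ≤-Reasoning
        go {suc h} {x} {y} x∈ y∈ (right {y₁ = y₁} st p) = begin
          f x ≤⟨ go x∈ (step-∈V y∈ st) p ⟩
          -- A move made at the far end is used backwards.
          f y₁ + nat h * K ≤⟨ +-monoˡ-≤ (nat h * K) (lip (step-∈V y∈ st) y∈ (step-sym st)) ⟩
          (f y + K) + nat h * K ≡⟨ solve 3 (λ a b c → (a :+ b) :+ c := (a :+ c) :+ b) refl (f y) K (nat h * K) ⟩
          (f y + nat h * K) + K ≡⟨ one-more (f y) h ⟩
          f y + nat (suc h) * K ∎
          where open ≤-Reasoning

      contract : ∀ {f K} → 0ℚ ≤ K → Lip f K → Lip (act f) (κ d * K)
      contract {f} {K} 0≤K lip {x} {y} x∈ y∈ st = subst (λ e → act f x ≤ act f y + κ e * K) (deg≡d x∈)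
        (matched-contract x∈ y∈ (match x∈ y∈ st) f (lip x∈ y∈ st) (λ (u∈ , w∈ , st′) → lip u∈ w∈ st′))

      module _ (π : Tournament Φ n → ℚ) (stat : Stationary Φ n s π) where

        private
          π-nonNeg : ∀ {x} → x ∈ V → 0ℚ ≤ π x
          π-nonNeg x∈ = proj₁ stat _ (∈V⁻ x∈)
          π-total : sumOver V π ≡ 1ℚ
          π-total = proj₁ (proj₂ stat)
          π-stat : ∀ {y} → y ∈ V → sumOver V (λ z → π z * P Φ n s z y) ≡ π y
          π-stat y∈ = proj₂ (proj₂ stat) _ (∈V⁻ y∈)

        -- If there are no moves the rows of P only sum to 1/2.
        d≢0 : d ≢ 0
        d≢0 d≡0 = half≢one (trans (sym (mass ½)) (trans (sym (sum-cong V (λ {z} z∈ → cong (π z *_) (row z∈))))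
            (trans (π-iter π π-nonNeg π-total π-stat 1 (λ _ → 1ℚ)) (mass 1ℚ))))
          where
          mass : ∀ c → sumOver V (λ z → π z * c) ≡ c
          mass c = trans (sum-*ʳ V c π) (trans (cong (_* c) π-total) (*-identityˡ c))
          half≢one : ½ ≢ 1ℚ
          half≢one ()
          row : ∀ {z} → z ∈ V → act (λ _ → 1ℚ) z ≡ ½
          row {z} z∈ = trans (average (λ _ → 1ℚ) z∈) (trans
            (cong (λ k → ½ * 1ℚ + (½ * inv k) * S) (trans (deg≡d z∈) d≡0))
            (solve 1 (λ S → con ½ :* con 1ℚ :+ (con ½ :* con 0ℚ) :* S := con ½) refl S))
            where S = sumOver (nbrs z) (λ _ → 1ℚ)

        games-bound : m ℕ.≤ 2 ℕ.^ (⌈log₂ n ⌉ ℕ.+ ⌈log₂ n ⌉)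
        games-bound = ℕP.≤-trans (games≤n*n Φ) (ℕP.≤-trans (ℕP.*-mono-≤ (n≤2^⌈log₂n⌉ n) (n≤2^⌈log₂n⌉ n))
          (ℕP.≤-reflexive (sym (ℕP.^-distribˡ-+-* 2 ⌈log₂ n ⌉ ⌈log₂ n ⌉))))

        -- A nonzero degree provides a move out of T₀, and a neutral triple contains two different
        -- games.
        two-games : d ≢ 0 → ¬ m ℕ.≤ 1
        two-games d≢0 m≤1 = go (nbrs T₀) refl
          where
          go : ∀ ys → nbrs T₀ ≡ ys → ⊥
          go [] eq = d≢0 (cong length eq)
          go (y ∷ ys) eq = one-game (proj₂ (∈nbrs⁻ (subst (y ∈_) (sym eq) (here refl))))
            where
            only-zero : ∀ (k : Fin m) → toℕ k ≡ 0
            only-zero k = ℕP.n<1⇒n≡0 (ℕP.<-≤-trans (FinP.toℕ<n k) m≤1)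
            one-game : ¬ Step T₀ y
            one-game (step a b c N _) = neutral-≢ T₀ N (FinP.toℕ-injective (trans (only-zero a) (sym (only-zero b))))

        small : ∀ e ℓ → d ≡ e → m ℕ.≤ 2 ℕ.^ (ℓ ℕ.+ ℓ) → nat m * pow (κ e) (4 ℕ.* e ℕ.* ℓ) ≤ ¼
        small zero ℓ eq _ = ⊥-elim (d≢0 eq)
        -- Here the bound on m is 2⁰ = 1, which leaves no room for a move.
        small (suc e) zero _ le = ⊥-elim (two-games d≢0 le)
        small (suc e) (suc ℓ) _ le = final-bound e ℓ le

        0≤κd : ∀ e → d ≡ e → 0ℚ ≤ κ e
        0≤κd zero eq = ⊥-elim (d≢0 eq)
        0≤κd (suc e) _ = κ-nonNeg e

        mixes : MixesBy Φ n s π (4 ℕ.* d ℕ.* ⌈log₂ n ⌉)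
        mixes = 4 ℕ.* d ℕ.* ⌈log₂ n ⌉ , ℕP.≤-refl , λ x e →
          ≤-trans (mixing π π-nonNeg π-total π-stat (κ d) (nat m) contract (0≤κd d refl) diameter (4 ℕ.* d ℕ.* ⌈log₂ n ⌉) (∈V⁺ e))
            (small d ⌈log₂ n ⌉ refl games-bound)

open import Defs
open import Data.Nat using (ℕ; _*_)
open import Data.Nat.Logarithm using (⌈log₂_⌉)
open import Data.Rational using (ℚ)

theorem24 : ∃[ C ] ((Φ : Typ) (n : ℕ) (T₀ : Tournament Φ n) (π : Tournament Φ n → ℚ) →
    Stationary Φ n (score Φ n T₀) π →
    MixesBy Φ n (score Φ n T₀) π (C * degree Φ n (score Φ n T₀) T₀ * ⌈log₂ n ⌉))
theorem24 = 4 , λ Φ n T₀ π stat → Interchange.Game.Fibre.mixes Φ n T₀ π stat
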